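{- There exists a randomized semi-streaming algorithm for the maximum coverage problem in the dynamic set streaming model that, for any constant $\varepsilon\in(0,1)$, with high probability computes an $\left(\frac{e}{e-1}+\varepsilon\right)$-approximation in $O(\log m/\varepsilon)$ passes over the stream.
   Context: Maximum coverage: given a collection of $m$ sets over $[n]$ and an integer $k$, find $k$ of the sets whose union has maximum size; an $\alpha$-approximation is a choice of at most $k$ sets covering at least a $1/\alpha$ fraction of the optimum. Dynamic (set) streaming model: the input is a stream $\langle a_1,\dots,a_t\rangle$ with $a_i=(S_i,\Delta_i)$, $S_i\subseteq[n]$, $\Delta_i\in\{ -1,+1\}$ (insertion or deletion of a set). The multiplicity of a set $S$ is $\sum_{i:S_i=S}\Delta_i$ and is required to be non-negative at all times; the collection of sets is that defined by the multiplicities at the end of the stream (at most $m$ sets). A semi-streaming algorithm uses $O(n\cdot\mathrm{poly}\{\log m,\log n\})$ space. -}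

module Defs where

open import Data.Bool.Base using (Bool; true; false; T)
import Data.Bool.Properties as Bool
open import Data.Fin.Subset using (Subset; ⋃; ∣_∣)
open import Data.Integer.Base as ℤ using (ℤ; +_; 0ℤ; _◃_)
open import Data.List.Base using (List; []; _∷_; length; take; filter; filterᵇ; deduplicate)
open import Data.Nat.Base as ℕ using (ℕ; zero; suc; _!; NonTrivial; nonTrivial⇒nonZero)
open import Data.Nat.Properties using (m*n≢0; m^n≢0; _!≢0)
open import Data.Product.Base using (∃-syntax; _×_; _,_)
open import Data.Rational.Base as ℚ using (ℚ; 0ℚ; 1ℚ; ½; _÷_)
import Data.Rational.Properties as ℚ
open import Data.Sign.Base using (Sign)
open import Data.Vec.Base using (Vec)
open import Data.Vec.Properties using (≡-dec)
open import Relation.Binary.Definitions using (DecidableEquality)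
open import Relation.Binary.PropositionalEquality using (_≡_)
open import Relation.Nullary.Decidable using (yes; no)

fromℕ : ℕ → ℚ
fromℕ k = + k ℚ./ 1

------------------------------------------------------------------------
-- Real numbers, given by rational sequences converging to them

-- q ≤lim s says that q ≤ lim s, for a convergent sequence s.
infix 4 _≤lim_
_≤lim_ : ℚ → (ℕ → ℚ) → Set
q ≤lim s = ∀ δ → 0ℚ ℚ.< δ → ∃[ N₀ ] ∀ N → N₀ ℕ.≤ N → q ℚ.≤ s N ℚ.+ δ

1/_! : ℕ → ℚ
1/ k ! = (+ 1 ℚ./ (k !)) {{k !≢0}}

-- ∑_{1 ≤ j ≤ N+1} 1/j!, which converges to e - 1.  The term for j = 1 is
-- always present, so that one can divide by these sums.
e-1 : ℕ → ℚ
e-1 zero    = 1/ 1 !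
e-1 (suc N) = e-1 N ℚ.+ 1/ suc (suc N) !

e : ℕ → ℚ
e N = 1ℚ ℚ.+ e-1 N

e-1-positive : ∀ N → ℚ.Positive (e-1 N)
e-1-positive zero    = _
e-1-positive (suc N) =
  ℚ.pos+pos⇒pos (e-1 N) {{e-1-positive N}} (1/ suc (suc N) !)
    {{ℚ.normalize-pos 1 (suc (suc N) !) {{suc (suc N) !≢0}}}}

e/[e-1] : ℕ → ℚ
e/[e-1] N = (e N ÷ e-1 N) {{ℚ.pos⇒nonZero (e-1 N) {{e-1-positive N}}}}

------------------------------------------------------------------------
-- Maximum coverage

infix 4 _≟ˢ_
_≟ˢ_ : ∀ {n} → DecidableEquality (Subset n)
_≟ˢ_ = ≡-dec Bool._≟_

occurrences : ∀ {n} → Subset n → List (Subset n) → ℕ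
occurrences S 𝒯 = length (filter (S ≟ˢ_) 𝒯)

coverage : ∀ {n} → List (Subset n) → ℕ
coverage 𝒯 = ∣ ⋃ 𝒯 ∣

-- Collections are multisets, represented by lists: 𝒯 consists of at most k
-- of the members of 𝒞.
IsChoice : ∀ {n} → List (Subset n) → ℕ → List (Subset n) → Set
IsChoice 𝒞 k 𝒯 = length 𝒯 ℕ.≤ k × (∀ S → occurrences S 𝒯 ℕ.≤ occurrences S 𝒞)

IsOptimum : ∀ {n} → List (Subset n) → ℕ → ℕ → Set
IsOptimum 𝒞 k v =
  (∃[ 𝒯 ] IsChoice 𝒞 k 𝒯 × coverage 𝒯 ≡ v) ×
  (∀ 𝒯 → IsChoice 𝒞 k 𝒯 → coverage 𝒯 ℕ.≤ v)

-- The ratio is the real number lim α.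
IsApproximation : ∀ {n} → (ℕ → ℚ) → List (Subset n) → ℕ → List (Subset n) → Set
IsApproximation α 𝒞 k 𝒯 =
  IsChoice 𝒞 k 𝒯 ×
  ∃[ opt ] IsOptimum 𝒞 k opt ×
           fromℕ opt ≤lim (λ N → α N ℚ.* fromℕ (coverage 𝒯))

------------------------------------------------------------------------
-- Dynamic set streams

Update : ℕ → Set
Update n = Subset n × Sign

multiplicity : ∀ {n} → List (Update n) → Subset n → ℤ
multiplicity []            S = 0ℤ
multiplicity ((S′ , Δ) ∷ a) S with S′ ≟ˢ S
... | yes _ = (Δ ◃ 1) ℤ.+ multiplicity a S
... | no  _ = multiplicity a S

IsDynamicStream : ∀ {n} → List (Update n) → Set
IsDynamicStream a = ∀ i S → 0ℤ ℤ.≤ multiplicity (take i a) S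

-- 𝒞 is the collection present at the end of the stream.
Defines : ∀ {n} → List (Update n) → List (Subset n) → Set
Defines a 𝒞 = ∀ S → + occurrences S 𝒞 ≡ multiplicity a S

------------------------------------------------------------------------
-- Randomized computations: finite trees of fair coin flips

data Rand (A : Set) : Set where
  return : A → Rand A
  flip   : Rand A → Rand A → Rand A

infixl 1 _>>=_
_>>=_ : ∀ {A B : Set} → Rand A → (A → Rand B) → Rand B
return x >>= f = f x
flip l r >>= f = flip (l >>= f) (r >>= f)

prob : ∀ {A : Set} → (A → Bool) → Rand A → ℚ
prob E (flip l r) = ½ ℚ.* (prob E l ℚ.+ prob E r)
prob E (return x) with E x
... | true  = 1ℚ
... | false = 0ℚ

-- P has probability at least q.  As P need not be decidable, this is
-- expressed by a Boolean-valued event E contained in P.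
Pr[_∈_]≥_ : ∀ {A : Set} → Rand A → (A → Set) → ℚ → Set
Pr[ X ∈ P ]≥ q = ∃[ E ] (∀ x → T (E x) → P x) × q ℚ.≤ prob E X

-- 1 - 1/(n m)^c
highProbability : ∀ (c n m : ℕ) .{{_ : ℕ.NonZero n}} .{{_ : NonTrivial m}} → ℚ
highProbability c n m = 1ℚ ℚ.- (+ 1 ℚ./ ((n ℕ.* m) ℕ.^ c)) {{nz}}
  where
  instance
    m≢0 : ℕ.NonZero m
    m≢0 = nonTrivial⇒nonZero m
    nm≢0 : ℕ.NonZero (n ℕ.* m)
    nm≢0 = m*n≢0 n m
  nz : ℕ.NonZero ((n ℕ.* m) ℕ.^ c)
  nz = m^n≢0 (n ℕ.* m) c

------------------------------------------------------------------------
-- Multi-pass streaming algorithms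

-- Everything remembered from one stream item to the next, including random
-- bits that are to be used again, is part of the memory of `space` bits.
record StreamingAlgorithm (Item Output : Set) : Set where
  field
    passes space : ℕ

  Memory : Set
  Memory = Vec Bool space

  field
    init    : Rand Memory
    update  : Item → Memory → Rand Memory
    endPass : Memory → Rand Memory
    output  : Memory → Output

  read : List Item → Memory → Rand Memory
  read []      s = return s
  read (x ∷ a) s = update x s >>= read a

  runPasses : ℕ → List Item → Memory → Rand Memory
  runPasses zero    a s = return s
  runPasses (suc p) a s = read a s >>= endPass >>= runPasses p a

  run : List Item → Rand Memory
  run a = init >>= runPasses passes a

-- Sets in a dynamic stream have no short names, and k explicitly listed sets
-- may need k n bits, far more than the memory.  The final memory therefore
-- describes the chosen sets by telling, for each member of the collection,
-- whether it is chosen.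
CoverageAlgorithm : ℕ → Set
CoverageAlgorithm n = StreamingAlgorithm (Update n) (Subset n → Bool)

-- Copies of one and the same set are chosen only once.
chosen : ∀ {n} → (Subset n → Bool) → List (Subset n) → List (Subset n)
chosen select 𝒞 = filterᵇ select (deduplicate _≟ˢ_ 𝒞)

{-# OPTIONS --safe #-}
-- Threshold greedy, run in parallel for every guess g with 2^g ≤ opt < 2^(g+1).  The thresholds decrease
-- from 2^(g+1)/k by factors 1 - 1/q with q = O(1/ε), so O(q) of them suffice; every pick has a gain of at
-- least (1 - 1/q) (opt - c)/k for the current coverage c, and the bound e/(e-1) follows by comparing
-- (1 - (1 - 1/q)/k)^k with the Taylor polynomials of exp.
--
-- A threshold τ takes O(log m) passes.  In a pass, the sets whose gain is between θ = τ 2^i and 2 θ are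
-- sampled about n/θ times; a sample costs O~(θ) bits, as a random linear sketch recovers a single set of
-- O(θ) new elements.  Once the samples have been picked greedily, at most a quarter of the class keeps a
-- gain of θ, since otherwise further picks would be likely, and there is room for only n/θ of them.  The
-- other sets move to lower classes, so the number of sets, with weight 4^i in class i, is halved.
--
-- Chosen sets are stored by random names of O(log (n m)) bits.  All randomness is public: for a fixed
-- outcome of the coins the algorithm depends only on the final collection.  By Newman's argument a table
-- of 2^O(log (n m)) deterministic algorithms is as good as the random one, and only an index into it is
-- kept in memory.

module Submission where

open import Defs
open import Data.Bool.Base using (Bool; true; false; T; _∧_; not; if_then_else_)
import Data.Bool.Properties as Bool
open import Data.Empty using (⊥; ⊥-elim)
open import Data.Fin.Base using (Fin)
open import Data.Fin.Subset as Sub using (Subset; ⋃; ∣_∣; _∪_; _─_)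
import Data.Fin.Subset.Properties as Sub
open import Data.Integer.Base as ℤ using (ℤ; +_)
import Data.Integer.Properties as ℤ
import Data.Integer.Tactic.RingSolver as ℤRing
import Data.Nat.Coprimality as Coprime
import Data.Vec.Relation.Unary.All as VecAll
open import Data.List.Base as List using (List; []; _∷_; length; map; _++_; filter; deduplicate; take; drop)
import Data.List.Properties as List
open import Data.List.Membership.Propositional as Mem using (_∈_)
import Data.List.Membership.Propositional.Properties as Mem
open import Data.List.Relation.Unary.All as All using (All; []; _∷_)
open import Data.List.Relation.Unary.Any as Any using (Any; here; there)
import Data.List.Relation.Unary.All.Properties as AllP
import Data.List.Relation.Unary.Any.Properties as AnyP
import Data.List.Relation.Unary.Unique.DecPropositional.Properties as Unique
import Data.List.Relation.Unary.Unique.Propositional.Properties as UniqueP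
open import Data.List.Relation.Unary.AllPairs using ([]; _∷_)
open import Data.List.Relation.Unary.Unique.Propositional using (Unique)
open import Data.Nat.Base as ℕ using (ℕ; zero; suc; _+_; _*_; _∸_; _^_; _≤_; _<_; _⊓_; pred; _!; z≤n; s≤s; NonZero; NonTrivial)
import Data.Nat.DivMod as ℕ
open import Data.Nat.Induction using (<-rec)
open import Data.Nat.Logarithm using (⌈log₂_⌉; ⌈log₂⌉-mono-≤; ⌈log₂⌈n/2⌉⌉≡⌈log₂n⌉∸1)
import Data.Nat.Properties as ℕ
open import Data.Nat.Tactic.RingSolver using (solve-∀)
open import Data.Product.Base using (∃-syntax; Σ-syntax; _×_; _,_; proj₁; proj₂)
open import Data.Rational.Base as ℚ using (ℚ; 0ℚ; 1ℚ; ½)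
import Data.Rational.Properties as ℚ
import Data.Rational.Unnormalised.Base as ℚᵘ
import Data.Rational.Unnormalised.Properties as ℚᵘ
open import Data.Sign.Base as Sign using (Sign)
open import Data.Sum.Base using (_⊎_; inj₁; inj₂)
open import Data.Unit.Base using (⊤; tt)
open import Data.Vec.Base as Vec using (Vec; []; _∷_)
import Data.Vec.Properties as Vec
open import Function.Base using (_∘_; case_of_)
open import Relation.Binary.Construct.Closure.ReflexiveTransitive using (Star; _◅_; _◅◅_) renaming (ε to none)
open import Relation.Binary.PropositionalEquality
open import Relation.Nullary.Decidable as Dec using (Dec; yes; no; does; _×-dec_; _⊎-dec_; toWitness; dec⇒maybe)
open import Relation.Nullary.Negation using (¬_; contradiction)
import Tactic.RingSolver as Ring
import Tactic.RingSolver.Core.AlmostCommutativeRing as Ring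

ℚ-ring : Ring.AlmostCommutativeRing _ _
ℚ-ring = Ring.fromCommutativeRing ℚ.+-*-commutativeRing (λ x → dec⇒maybe (0ℚ ℚ.≟ x))

≤-by-slack : ∀ {p q} x → 0ℚ ℚ.≤ x → q ≡ p ℚ.+ x → p ℚ.≤ q
≤-by-slack {p} x 0≤x refl = subst (ℚ._≤ p ℚ.+ x) (ℚ.+-identityʳ p) (ℚ.+-monoʳ-≤ p 0≤x)

0≤*ℚ : ∀ {p q} → 0ℚ ℚ.≤ p → 0ℚ ℚ.≤ q → 0ℚ ℚ.≤ p ℚ.* q
0≤*ℚ {p} {q} 0≤p 0≤q =
  ℚ.nonNegative⁻¹ _ {{ℚ.nonNeg*nonNeg⇒nonNeg p {{ℚ.nonNegative 0≤p}} q {{ℚ.nonNegative 0≤q}}}}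

0≤+ℚ : ∀ {p q} → 0ℚ ℚ.≤ p → 0ℚ ℚ.≤ q → 0ℚ ℚ.≤ p ℚ.+ q
0≤+ℚ 0≤p 0≤q = ℚ.+-mono-≤ 0≤p 0≤q

slack : ∀ {p q} → p ℚ.≤ q → 0ℚ ℚ.≤ q ℚ.- p
slack {p} {q} p≤q = subst (ℚ._≤ q ℚ.- p) (ℚ.+-inverseʳ p) (ℚ.+-monoˡ-≤ (ℚ.- p) p≤q)

*-monoˡℚ : ∀ {p q} r → 0ℚ ℚ.≤ r → p ℚ.≤ q → r ℚ.* p ℚ.≤ r ℚ.* q
*-monoˡℚ r 0≤r = ℚ.*-monoˡ-≤-nonNeg r {{ℚ.nonNegative 0≤r}}

*-mono-≤ℚ : ∀ {p q r s} → 0ℚ ℚ.≤ p → 0ℚ ℚ.≤ r → p ℚ.≤ q → r ℚ.≤ s → p ℚ.* r ℚ.≤ q ℚ.* s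
*-mono-≤ℚ {p} {q} {r} {s} 0≤p 0≤r p≤q r≤s =
  ≤-by-slack ((q ℚ.- p) ℚ.* s ℚ.+ p ℚ.* (s ℚ.- r))
    (0≤+ℚ (0≤*ℚ (slack p≤q) (ℚ.≤-trans 0≤r r≤s)) (0≤*ℚ 0≤p (slack r≤s))) (lemma p q r s)
  where
  lemma : ∀ p q r s → q ℚ.* s ≡ p ℚ.* r ℚ.+ ((q ℚ.- p) ℚ.* s ℚ.+ p ℚ.* (s ℚ.- r))
  lemma = Ring.solve-∀ ℚ-ring

0≤1ℚ : 0ℚ ℚ.≤ 1ℚ
0≤1ℚ = ℚ.nonNegative⁻¹ 1ℚ

0≤½ : 0ℚ ℚ.≤ ½
0≤½ = ℚ.nonNegative⁻¹ ½

½^_ : ℕ → ℚ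
½^ zero = 1ℚ
½^ suc r = ½ ℚ.* ½^ r

0≤½^ : ∀ r → 0ℚ ℚ.≤ ½^ r
0≤½^ zero = 0≤1ℚ
0≤½^ (suc r) = 0≤*ℚ 0≤½ (0≤½^ r)

½*[p+p]≡p : ∀ p → ½ ℚ.* (p ℚ.+ p) ≡ p
½*[p+p]≡p p = trans (lemma ½ p) (ℚ.*-identityˡ p)
  where
  lemma : ∀ h p → h ℚ.* (p ℚ.+ p) ≡ (h ℚ.+ h) ℚ.* p
  lemma = Ring.solve-∀ ℚ-ring

½^-+ : ∀ r s → ½^ (r + s) ≡ ½^ r ℚ.* ½^ s
½^-+ zero s = sym (ℚ.*-identityˡ _)
½^-+ (suc r) s = trans (cong (½ ℚ.*_) (½^-+ r s)) (sym (ℚ.*-assoc ½ (½^ r) (½^ s)))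

-- Expectation and probability

E : ∀ {A : Set} → (A → ℚ) → Rand A → ℚ
E f (return x) = f x
E f (flip l r) = ½ ℚ.* (E f l ℚ.+ E f r)

E-mono : ∀ {A : Set} {f g : A → ℚ} (X : Rand A) → (∀ x → f x ℚ.≤ g x) → E f X ℚ.≤ E g X
E-mono (return x) f≤g = f≤g x
E-mono (flip l r) f≤g = *-monoˡℚ ½ 0≤½ (ℚ.+-mono-≤ (E-mono l f≤g) (E-mono r f≤g))

E-cong : ∀ {A : Set} {f g : A → ℚ} (X : Rand A) → (∀ x → f x ≡ g x) → E f X ≡ E g X
E-cong (return x) f≡g = f≡g x
E-cong (flip l r) f≡g = cong₂ (λ p q → ½ ℚ.* (p ℚ.+ q)) (E-cong l f≡g) (E-cong r f≡g)

E-const : ∀ {A : Set} c (X : Rand A) → E (λ _ → c) X ≡ c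
E-const c (return x) = refl
E-const c (flip l r) rewrite E-const c l | E-const c r = ½*[p+p]≡p c

E-+ : ∀ {A : Set} (f g : A → ℚ) (X : Rand A) → E (λ x → f x ℚ.+ g x) X ≡ E f X ℚ.+ E g X
E-+ f g (return x) = refl
E-+ f g (flip l r) rewrite E-+ f g l | E-+ f g r = lemma ½ (E f l) (E g l) (E f r) (E g r)
  where
  lemma : ∀ h a b c d → h ℚ.* (a ℚ.+ b ℚ.+ (c ℚ.+ d)) ≡ h ℚ.* (a ℚ.+ c) ℚ.+ h ℚ.* (b ℚ.+ d)
  lemma = Ring.solve-∀ ℚ-ring

E-* : ∀ {A : Set} c (f : A → ℚ) (X : Rand A) → E (λ x → c ℚ.* f x) X ≡ c ℚ.* E f X
E-* c f (return x) = refl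
E-* c f (flip l r) rewrite E-* c f l | E-* c f r = lemma ½ c (E f l) (E f r)
  where
  lemma : ∀ h c a b → h ℚ.* (c ℚ.* a ℚ.+ c ℚ.* b) ≡ c ℚ.* (h ℚ.* (a ℚ.+ b))
  lemma = Ring.solve-∀ ℚ-ring

E->>= : ∀ {A B : Set} (f : B → ℚ) (X : Rand A) (Y : A → Rand B) → E f (X >>= Y) ≡ E (λ x → E f (Y x)) X
E->>= f (return x) Y = refl
E->>= f (flip l r) Y = cong₂ (λ p q → ½ ℚ.* (p ℚ.+ q)) (E->>= f l Y) (E->>= f r Y)

E-attained : ∀ {A : Set} (f : A → ℚ) (X : Rand A) → ∃[ x ] f x ℚ.≤ E f X
E-attained f (return x) = x , ℚ.≤-refl
E-attained f (flip l r) with E-attained f l | E-attained f r | ℚ.≤-total (E f l) (E f r)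
... | x , fx≤ | _ | inj₁ l≤r = x , ℚ.≤-trans fx≤
  (subst (ℚ._≤ ½ ℚ.* (E f l ℚ.+ E f r)) (½*[p+p]≡p _) (*-monoˡℚ ½ 0≤½ (ℚ.+-monoʳ-≤ (E f l) l≤r)))
... | _ | x , fx≤ | inj₂ r≤l = x , ℚ.≤-trans fx≤
  (subst (ℚ._≤ ½ ℚ.* (E f l ℚ.+ E f r)) (½*[p+p]≡p _) (*-monoˡℚ ½ 0≤½ (ℚ.+-monoˡ-≤ (E f r) r≤l)))

𝟙 : Bool → ℚ
𝟙 true = 1ℚ
𝟙 false = 0ℚ

0≤𝟙 : ∀ b → 0ℚ ℚ.≤ 𝟙 b
0≤𝟙 true = 0≤1ℚ
0≤𝟙 false = ℚ.≤-refl

-- P fails with probability at most δ.  An inductive definition makes sense of this for undecidable P.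
data Failure {A : Set} (P : A → Set) : Rand A → ℚ → Set where
  success : ∀ {x δ} → P x → 0ℚ ℚ.≤ δ → Failure P (return x) δ
  failure : ∀ {x δ} → 1ℚ ℚ.≤ δ → Failure P (return x) δ
  average : ∀ {l r δˡ δʳ δ} → Failure P l δˡ → Failure P r δʳ → ½ ℚ.* (δˡ ℚ.+ δʳ) ℚ.≤ δ → Failure P (flip l r) δ

Fail : ∀ {A : Set} → Rand A → (A → Set) → ℚ → Set
Fail X P δ = Failure P X δ

fail-weaken : ∀ {A : Set} {P Q : A → Set} {δ δ′} (X : Rand A) → (∀ x → P x → Q x) → δ ℚ.≤ δ′ → Fail X P δ → Fail X Q δ′
fail-weaken (return x) P⇒Q δ≤ (success px 0≤δ) = success (P⇒Q x px) (ℚ.≤-trans 0≤δ δ≤)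
fail-weaken (return x) P⇒Q δ≤ (failure 1≤δ) = failure (ℚ.≤-trans 1≤δ δ≤)
fail-weaken (flip l r) P⇒Q δ≤ (average L R avg) =
  average (fail-weaken l P⇒Q ℚ.≤-refl L) (fail-weaken r P⇒Q ℚ.≤-refl R) (ℚ.≤-trans avg δ≤)

fail-sure : ∀ {A : Set} {P : A → Set} {δ} (X : Rand A) → 0ℚ ℚ.≤ δ → (∀ x → P x) → Fail X P δ
fail-sure (return x) 0≤δ p = success (p x) 0≤δ
fail-sure {δ = δ} (flip l r) 0≤δ p = average (fail-sure l 0≤δ p) (fail-sure r 0≤δ p) (ℚ.≤-reflexive (½*[p+p]≡p δ))

fail-trivial : ∀ {A : Set} {P : A → Set} {δ} (X : Rand A) → 1ℚ ℚ.≤ δ → Fail X P δ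
fail-trivial (return x) 1≤δ = failure 1≤δ
fail-trivial {δ = δ} (flip l r) 1≤δ = average (fail-trivial l 1≤δ) (fail-trivial r 1≤δ) (ℚ.≤-reflexive (½*[p+p]≡p δ))

fail-0≤ : ∀ {A : Set} {P : A → Set} {δ} (X : Rand A) → Fail X P δ → 0ℚ ℚ.≤ δ
fail-0≤ (return x) (success _ 0≤δ) = 0≤δ
fail-0≤ (return x) (failure 1≤δ) = ℚ.≤-trans 0≤1ℚ 1≤δ
fail-0≤ (flip l r) (average L R avg) = ℚ.≤-trans (0≤*ℚ 0≤½ (0≤+ℚ (fail-0≤ l L) (fail-0≤ r R))) avg

fail-× : ∀ {A : Set} {P Q : A → Set} {δ δ′} (X : Rand A) → Fail X P δ → Fail X Q δ′ → Fail X (λ x → P x × Q x) (δ ℚ.+ δ′)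
fail-× (return x) (success p 0≤δ) (success q 0≤δ′) = success (p , q) (0≤+ℚ 0≤δ 0≤δ′)
fail-× (return x) (success p 0≤δ) (failure 1≤δ′) = failure (ℚ.+-mono-≤ 0≤δ 1≤δ′)
fail-× (return x) (failure 1≤δ) F = failure (ℚ.+-mono-≤ 1≤δ (fail-0≤ (return x) F))
fail-× {δ = δ} {δ′} (flip l r) (average {δˡ = δˡ} {δʳ} L R avg) (average {δˡ = δˡ′} {δʳ′} L′ R′ avg′) =
  average (fail-× l L L′) (fail-× r R R′)
    (subst (ℚ._≤ δ ℚ.+ δ′) (lemma ½ δˡ δʳ δˡ′ δʳ′) (ℚ.+-mono-≤ avg avg′))
  where
  lemma : ∀ h a b c d → h ℚ.* (a ℚ.+ b) ℚ.+ h ℚ.* (c ℚ.+ d) ≡ h ℚ.* (a ℚ.+ c ℚ.+ (b ℚ.+ d))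
  lemma = Ring.solve-∀ ℚ-ring

fail->>= : ∀ {A B : Set} {P : A → Set} {Q : B → Set} {p a b} (X : Rand A) (Y : A → Rand B) → Fail X P p →
  (∀ x → P x → Fail (Y x) Q a) → (∀ x → Fail (Y x) Q b) → a ℚ.≤ b → Fail (X >>= Y) Q (a ℚ.+ p ℚ.* (b ℚ.- a))
fail->>= {p = p} {a} {b} (return x) Y (success px 0≤p) ya yb a≤b =
  fail-weaken (Y x) (λ _ q → q) (≤-by-slack _ (0≤*ℚ 0≤p (slack a≤b)) refl) (ya x px)
fail->>= {p = p} {a} {b} (return x) Y (failure 1≤p) ya yb a≤b =
  fail-weaken (Y x) (λ _ q → q) (≤-by-slack _ (0≤*ℚ (slack 1≤p) (slack a≤b)) (lemma p a b)) (yb x)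
  where
  lemma : ∀ p a b → a ℚ.+ p ℚ.* (b ℚ.- a) ≡ b ℚ.+ (p ℚ.- 1ℚ) ℚ.* (b ℚ.- a)
  lemma = Ring.solve-∀ ℚ-ring
fail->>= {p = p} {a} {b} (flip l r) Y (average {δˡ = pˡ} {pʳ} L R avg) ya yb a≤b = average (fail->>= l Y L ya yb a≤b) (fail->>= r Y R ya yb a≤b)
  (begin
    ½ ℚ.* (a ℚ.+ pˡ ℚ.* (b ℚ.- a) ℚ.+ (a ℚ.+ pʳ ℚ.* (b ℚ.- a))) ≡⟨ lemma ½ a (b ℚ.- a) pˡ pʳ ⟩
    ½ ℚ.* (a ℚ.+ a) ℚ.+ ½ ℚ.* (pˡ ℚ.+ pʳ) ℚ.* (b ℚ.- a) ≡⟨ cong (ℚ._+ ½ ℚ.* (pˡ ℚ.+ pʳ) ℚ.* (b ℚ.- a)) (½*[p+p]≡p a) ⟩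
    a ℚ.+ ½ ℚ.* (pˡ ℚ.+ pʳ) ℚ.* (b ℚ.- a) ≤⟨ ℚ.+-monoʳ-≤ a (ℚ.*-monoʳ-≤-nonNeg (b ℚ.- a) {{ℚ.nonNegative (slack a≤b)}} avg) ⟩
    a ℚ.+ p ℚ.* (b ℚ.- a) ∎)
  where
  open ℚ.≤-Reasoning
  lemma : ∀ h a d x y → h ℚ.* (a ℚ.+ x ℚ.* d ℚ.+ (a ℚ.+ y ℚ.* d)) ≡ h ℚ.* (a ℚ.+ a) ℚ.+ h ℚ.* (x ℚ.+ y) ℚ.* d
  lemma = Ring.solve-∀ ℚ-ring

fail-bind : ∀ {A B : Set} {P : A → Set} {Q : B → Set} {p a} (X : Rand A) (Y : A → Rand B) → Fail X P p →
  0ℚ ℚ.≤ a → (∀ x → P x → Fail (Y x) Q a) → Fail (X >>= Y) Q (p ℚ.+ a)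
fail-bind {p = p} {a} X Y F 0≤a ya with ℚ.≤-total a 1ℚ
... | inj₁ a≤1 = fail-weaken (X >>= Y) (λ _ q → q)
  (≤-by-slack (p ℚ.* a) (0≤*ℚ (fail-0≤ X F) 0≤a) (lemma p a))
  (fail->>= X Y F ya (λ x → fail-trivial (Y x) ℚ.≤-refl) a≤1)
  where
  lemma : ∀ p a → p ℚ.+ a ≡ a ℚ.+ p ℚ.* (1ℚ ℚ.- a) ℚ.+ p ℚ.* a
  lemma = Ring.solve-∀ ℚ-ring
... | inj₂ 1≤a = fail-trivial (X >>= Y) (ℚ.+-mono-≤ (fail-0≤ X F) 1≤a)

fail-map : ∀ {A B : Set} {Q : B → Set} {a} (X : Rand A) (f : A → B) → Fail X (Q ∘ f) a → Fail (X >>= (return ∘ f)) Q a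
fail-map (return x) f (success q 0≤a) = success q 0≤a
fail-map (return x) f (failure 1≤a) = failure 1≤a
fail-map (flip l r) f (average L R avg) = average (fail-map l f L) (fail-map r f R) avg

fail-E : ∀ {A : Set} {P : A → Set} (X : Rand A) (c : A → ℚ) → (∀ x → 0ℚ ℚ.≤ c x) → (∀ x → P x ⊎ 1ℚ ℚ.≤ c x) → Fail X P (E c X)
fail-E (return x) c 0≤c h with h x
... | inj₁ p = success p (0≤c x)
... | inj₂ 1≤ = failure 1≤
fail-E (flip l r) c 0≤c h = average (fail-E l c 0≤c h) (fail-E r c 0≤c h) ℚ.≤-refl

E-fail : ∀ {A : Set} {P : A → Set} {δ} (X : Rand A) (bad : A → Bool) → (∀ x → P x → bad x ≡ false) → Fail X P δ → E (𝟙 ∘ bad) X ℚ.≤ δ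
E-fail (return x) bad good (success p 0≤δ) rewrite good x p = 0≤δ
E-fail (return x) bad good (failure 1≤δ) with bad x
... | true = 1≤δ
... | false = ℚ.≤-trans 0≤1ℚ 1≤δ
E-fail (flip l r) bad good (average L R avg) =
  ℚ.≤-trans (*-monoˡℚ ½ 0≤½ (ℚ.+-mono-≤ (E-fail l bad good L) (E-fail r bad good R))) avg

fail-both : ∀ {A B C : Set} {P : A → Set} {Q : B → Set} {R : C → Set} {p q} (X : Rand A) (Y : Rand B) (f : A → B → C) →
  Fail X P p → Fail Y Q q → (∀ x y → P x ⊎ Q y → R (f x y)) →
  Fail (X >>= λ x → Y >>= λ y → return (f x y)) R (p ℚ.* q)
fail-both {R = R} {p} {q} X Y f F G h = fail-weaken _ (λ _ r → r) (ℚ.≤-reflexive (lemma p q))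
  (fail->>= X _ F (λ x px → fail-map Y (f x) (fail-sure Y ℚ.≤-refl (λ y → h x y (inj₁ px))))
     (λ x → fail-map Y (f x) (fail-weaken Y (λ y qy → h x y (inj₂ qy)) ℚ.≤-refl G)) (fail-0≤ Y G))
  where
  lemma : ∀ p q → 0ℚ ℚ.+ p ℚ.* (q ℚ.- 0ℚ) ≡ p ℚ.* q
  lemma = Ring.solve-∀ ℚ-ring

fromℕ-mk : ∀ k → fromℕ k ≡ ℚ.mkℚ (+ k) 0 (Coprime.sym (Coprime.1-coprimeTo k))
fromℕ-mk k = ℚ.normalize-coprime {k} {0} (Coprime.sym (Coprime.1-coprimeTo k))

fromℕ-+ : ∀ a b → fromℕ (a + b) ≡ fromℕ a ℚ.+ fromℕ b
fromℕ-+ a b rewrite fromℕ-mk a | fromℕ-mk b =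
  cong (ℚ._/ 1) (trans (ℤ.pos-+ a b) (sym (cong₂ ℤ._+_ (ℤ.*-identityʳ (+ a)) (ℤ.*-identityʳ (+ b)))))

fromℕ-* : ∀ a b → fromℕ (a * b) ≡ fromℕ a ℚ.* fromℕ b
fromℕ-* a b rewrite fromℕ-mk a | fromℕ-mk b = cong (ℚ._/ 1) (ℤ.pos-* a b)

fromℕ-mono : ∀ {a b} → a ≤ b → fromℕ a ℚ.≤ fromℕ b
fromℕ-mono {a} {b} a≤b rewrite fromℕ-mk a | fromℕ-mk b = ℚ.*≤* (ℤ.*-monoʳ-≤-nonNeg (+ 1) (ℤ.+≤+ a≤b))

fromℕ-cancel-≤ : ∀ {a b} → fromℕ a ℚ.≤ fromℕ b → a ≤ b
fromℕ-cancel-≤ {a} {b} h rewrite fromℕ-mk a | fromℕ-mk b with h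
... | ℚ.*≤* h′ = ℤ.drop‿+≤+ (ℤ.*-cancelʳ-≤-pos (+ a) (+ b) (+ 1) h′)

0≤fromℕ : ∀ k → 0ℚ ℚ.≤ fromℕ k
0≤fromℕ k = fromℕ-mono {0} {k} z≤n

½^*2^ : ∀ r → ½^ r ℚ.* fromℕ (2 ^ r) ≡ 1ℚ
½^*2^ zero = refl
½^*2^ (suc r) = begin
  ½ ℚ.* ½^ r ℚ.* fromℕ (2 * 2 ^ r) ≡⟨ cong (½ ℚ.* ½^ r ℚ.*_) (fromℕ-* 2 (2 ^ r)) ⟩
  ½ ℚ.* ½^ r ℚ.* (fromℕ 2 ℚ.* fromℕ (2 ^ r)) ≡⟨ lemma ½ (½^ r) (fromℕ 2) (fromℕ (2 ^ r)) ⟩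
  ½ ℚ.* fromℕ 2 ℚ.* (½^ r ℚ.* fromℕ (2 ^ r)) ≡⟨ cong (½ ℚ.* fromℕ 2 ℚ.*_) (½^*2^ r) ⟩
  1ℚ ∎
  where
  open ≡-Reasoning
  lemma : ∀ a b c d → a ℚ.* b ℚ.* (c ℚ.* d) ≡ a ℚ.* c ℚ.* (b ℚ.* d)
  lemma = Ring.solve-∀ ℚ-ring

*½^-≤ : ∀ {k r} p → 0ℚ ℚ.≤ p → k ≤ 2 ^ r → fromℕ k ℚ.* (½^ r ℚ.* p) ℚ.≤ p
*½^-≤ {k} {r} p 0≤p k≤ = begin
  fromℕ k ℚ.* (½^ r ℚ.* p) ≤⟨ ℚ.*-monoʳ-≤-nonNeg (½^ r ℚ.* p) {{ℚ.nonNegative (0≤*ℚ (0≤½^ r) 0≤p)}} (fromℕ-mono k≤) ⟩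
  fromℕ (2 ^ r) ℚ.* (½^ r ℚ.* p) ≡⟨ lemma (fromℕ (2 ^ r)) (½^ r) p ⟩
  (½^ r ℚ.* fromℕ (2 ^ r)) ℚ.* p ≡⟨ cong (ℚ._* p) (½^*2^ r) ⟩
  1ℚ ℚ.* p ≡⟨ ℚ.*-identityˡ p ⟩
  p ∎
  where
  open ℚ.≤-Reasoning
  lemma : ∀ a b c → a ℚ.* (b ℚ.* c) ≡ (b ℚ.* a) ℚ.* c
  lemma = Ring.solve-∀ ℚ-ring

fromℕ-suc : ∀ k → fromℕ (suc k) ≡ 1ℚ ℚ.+ fromℕ k
fromℕ-suc k = fromℕ-+ 1 k

fromℕ-suc-* : ∀ k p → fromℕ (suc k) ℚ.* p ≡ p ℚ.+ fromℕ k ℚ.* p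
fromℕ-suc-* k p = trans (cong (ℚ._* p) (fromℕ-suc k)) (trans (ℚ.*-distribʳ-+ p 1ℚ (fromℕ k)) (cong (ℚ._+ fromℕ k ℚ.* p) (ℚ.*-identityˡ p)))

-- Independent repetition

drawVec : ∀ {A : Set} → Rand A → (r : ℕ) → Rand (Vec A r)
drawVec X zero = return []
drawVec X (suc r) = X >>= λ x → drawVec X r >>= λ v → return (x ∷ v)

drawAll : ∀ {A : Set} {P : A → Set} → (∀ x → Rand (P x)) → ∀ xs → Rand (All P xs)
drawAll X [] = return []
drawAll X (x ∷ xs) = X x >>= λ y → drawAll X xs >>= λ v → return (y ∷ v)

fail-∀∈ : ∀ {A B : Set} {P : B → A → Set} {δ} (X : Rand A) (xs : List B) →
  (∀ b → b ∈ xs → Fail X (P b) δ) → Fail X (λ a → ∀ b → b ∈ xs → P b a) (fromℕ (length xs) ℚ.* δ)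
fail-∀∈ {δ = δ} X [] h = fail-sure X (ℚ.≤-reflexive (sym (ℚ.*-zeroˡ δ))) (λ _ _ ())
fail-∀∈ {δ = δ} X (b ∷ xs) h =
  fail-weaken X (λ { a (p , ps) .b (here refl) → p ; a (p , ps) b′ (there b∈) → ps b′ b∈ })
    (ℚ.≤-reflexive (sym (fromℕ-suc-* (length xs) δ)))
    (fail-× X (h b (here refl)) (fail-∀∈ X xs (λ b′ → h b′ ∘ there)))

fail-drawVec-∀ : ∀ {A : Set} {P : A → Set} {δ} (X : Rand A) → Fail X P δ → ∀ r →
  Fail (drawVec X r) (VecAll.All P) (fromℕ r ℚ.* δ)
fail-drawVec-∀ {δ = δ} X F zero = success VecAll.[] (ℚ.≤-reflexive (sym (ℚ.*-zeroˡ δ)))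
fail-drawVec-∀ {δ = δ} X F (suc r) =
  fail-weaken (drawVec X (suc r)) (λ _ p → p) (ℚ.≤-reflexive (sym (fromℕ-suc-* r δ)))
    (fail-bind X _ F (fail-0≤ _ (fail-drawVec-∀ X F r)) (λ x px →
      fail-map (drawVec X r) (x ∷_) (fail-weaken _ (λ v pv → px VecAll.∷ pv) ℚ.≤-refl (fail-drawVec-∀ X F r))))

fail-drawAll-∀ : ∀ {A : Set} {B : A → Set} {P : ∀ {x} → B x → Set} {δ} (X : ∀ x → Rand (B x)) → (∀ x → Fail (X x) P δ) → ∀ xs →
  Fail (drawAll X xs) (λ v → ∀ {x} (x∈ : x ∈ xs) → P (All.lookup v x∈)) (fromℕ (length xs) ℚ.* δ)
fail-drawAll-∀ {δ = δ} X F [] = success (λ ()) (ℚ.≤-reflexive (sym (ℚ.*-zeroˡ δ)))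
fail-drawAll-∀ {δ = δ} X F (x ∷ xs) =
  fail-weaken (drawAll X (x ∷ xs)) (λ _ p → p) (ℚ.≤-reflexive (sym (fromℕ-suc-* (length xs) δ)))
    (fail-bind (X x) _ (F x) (fail-0≤ _ (fail-drawAll-∀ X F xs)) (λ y py →
      fail-map (drawAll X xs) (y ∷_) (fail-weaken _ (λ { v pv (here refl) → py ; v pv (there x∈) → pv x∈ }) ℚ.≤-refl (fail-drawAll-∀ X F xs))))

E-drawVec : ∀ {A : Set} (f : ∀ {r} → Vec A r → ℚ) (X : Rand A) r →
  E f (drawVec X (suc r)) ≡ E (λ x → E (λ v → f (x ∷ v)) (drawVec X r)) X
E-drawVec f X r = trans (E->>= f X _) (E-cong X (λ x → E->>= f (drawVec X r) _))

-- Uniformly random Boolean functions on the subsets of [n]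

Table : ℕ → Set
Table zero = Bool
Table (suc n) = Table n × Table n

_at_ : ∀ {n} → Table n → Subset n → Bool
f at [] = f
(f , g) at (true ∷ z) = f at z
(f , g) at (false ∷ z) = g at z

set : ∀ {n} → Subset n → Bool → Table n → Table n
set [] b f = b
set (true ∷ z) b (f , g) = set z b f , g
set (false ∷ z) b (f , g) = f , set z b g

set-at : ∀ {n} (z : Subset n) b f → set z b f at z ≡ b
set-at [] b f = refl
set-at (true ∷ z) b (f , g) = set-at z b f
set-at (false ∷ z) b (f , g) = set-at z b g

set-at-≢ : ∀ {n} {z z′ : Subset n} b f → z ≢ z′ → set z b f at z′ ≡ f at z′
set-at-≢ {z = []} {[]} b f z≢ = ⊥-elim (z≢ refl)
set-at-≢ {z = true ∷ z} {true ∷ z′} b (f , g) z≢ = set-at-≢ b f (z≢ ∘ cong (true ∷_))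
set-at-≢ {z = true ∷ z} {false ∷ z′} b (f , g) z≢ = refl
set-at-≢ {z = false ∷ z} {true ∷ z′} b (f , g) z≢ = refl
set-at-≢ {z = false ∷ z} {false ∷ z′} b (f , g) z≢ = set-at-≢ b g (z≢ ∘ cong (false ∷_))

randomTable : ∀ n → Rand (Table n)
randomTable zero = flip (return true) (return false)
randomTable (suc n) = randomTable n >>= λ f → randomTable n >>= λ g → return (f , g)

resample : ∀ {n} (z : Subset n) (Ψ : Table n → ℚ) →
  E Ψ (randomTable n) ≡ E (λ f → ½ ℚ.* (Ψ (set z true f) ℚ.+ Ψ (set z false f))) (randomTable n)
resample [] Ψ = sym (½*[p+p]≡p _)
resample {suc n} z Ψ = trans (pair Ψ) (trans (go z) (sym (pair _)))
  where
  X = randomTable n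
  pair : ∀ (Φ : Table (suc n) → ℚ) → E Φ (randomTable (suc n)) ≡ E (λ f → E (λ g → Φ (f , g)) X) X
  pair Φ = trans (E->>= Φ X _) (E-cong X (λ f → E->>= Φ X _))
  go : ∀ z → E (λ f → E (λ g → Ψ (f , g)) X) X ≡
    E (λ f → E (λ g → ½ ℚ.* (Ψ (set z true (f , g)) ℚ.+ Ψ (set z false (f , g)))) X) X
  go (false ∷ z) = E-cong X (λ f → resample z (λ g → Ψ (f , g)))
  go (true ∷ z) = trans (resample z (λ f → E (λ g → Ψ (f , g)) X)) (E-cong X (λ f →
    sym (trans (E-* ½ (λ g → Ψ (set z true f , g) ℚ.+ Ψ (set z false f , g)) X)
               (cong (½ ℚ.*_) (E-+ (λ g → Ψ (set z true f , g)) (λ g → Ψ (set z false f , g)) X)))))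

fail-table : ∀ {n} (z : Subset n) (bad : Table n → Bool) →
  (∀ f → bad (set z true f) ≡ true → bad (set z false f) ≡ false) → Fail (randomTable n) (λ f → bad f ≡ false) ½
fail-table {n} z bad h = fail-weaken X (λ _ p → p) bound
  (fail-E X (𝟙 ∘ bad) (0≤𝟙 ∘ bad) (λ f → dichotomy (bad f)))
  where
  X = randomTable n
  dichotomy : ∀ b → b ≡ false ⊎ 1ℚ ℚ.≤ 𝟙 b
  dichotomy true = inj₂ ℚ.≤-refl
  dichotomy false = inj₁ refl
  pointwise : ∀ b b′ → (b ≡ true → b′ ≡ false) → ½ ℚ.* (𝟙 b ℚ.+ 𝟙 b′) ℚ.≤ ½
  pointwise true true i = case i refl of λ ()
  pointwise true false i = ℚ.≤-refl
  pointwise false true i = ℚ.≤-refl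
  pointwise false false i = 0≤½
  bound : E (𝟙 ∘ bad) X ℚ.≤ ½
  bound = ℚ.≤-trans (ℚ.≤-reflexive (resample z (𝟙 ∘ bad)))
    (ℚ.≤-trans (E-mono X (λ f → pointwise _ _ (h f))) (ℚ.≤-reflexive (E-const ½ X)))

fail-tables : ∀ {n} (z : Subset n) (f g : Table n → ℕ) →
  (∀ φ → f (set z true φ) ≡ g (set z true φ) → f (set z false φ) ≢ g (set z false φ)) → ∀ r →
  Fail (drawVec (randomTable n) r) (λ φs → map f (Vec.toList φs) ≢ map g (Vec.toList φs)) (½^ r)
fail-tables z f g h zero = failure ℚ.≤-refl
fail-tables {n} z f g h (suc r) =
  fail-both (randomTable n) (drawVec (randomTable n) r) _∷_
    (fail-table z (λ φ → f φ ℕ.≡ᵇ g φ) (λ φ t → bad-false (h φ (bad-true t))))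
    (fail-tables z f g h r)
    λ { φ φs (inj₁ ≡false) eq → case trans (sym ≡false) (Dec.dec-true (f φ ℕ.≟ g φ) (List.∷-injectiveˡ eq)) of λ ()
      ; φ φs (inj₂ rest) eq → rest (List.∷-injectiveʳ eq) }
  where
  bad-true : ∀ {a b} → (a ℕ.≡ᵇ b) ≡ true → a ≡ b
  bad-true {a} {b} t = ℕ.≡ᵇ⇒≡ a b (subst T (sym t) tt)
  bad-false : ∀ {a b} → a ≢ b → (a ℕ.≡ᵇ b) ≡ false
  bad-false {a} {b} = Dec.dec-false (a ℕ.≟ b)

_inAll_ : ∀ {n r} → Subset n → Vec (Table n) r → Bool
S inAll [] = true
S inAll (f ∷ fs) = (f at S) ∧ (S inAll fs)

𝟙-∧ : ∀ a b → 𝟙 (a ∧ b) ≡ 𝟙 a ℚ.* 𝟙 b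
𝟙-∧ true b = sym (ℚ.*-identityˡ _)
𝟙-∧ false b = sym (ℚ.*-zeroˡ (𝟙 b))

E-at : ∀ {n} (S : Subset n) → E (λ f → 𝟙 (f at S)) (randomTable n) ≡ ½
E-at {n} S = trans (resample S (λ f → 𝟙 (f at S)))
  (trans (E-cong (randomTable n) (λ f → cong₂ (λ a b → ½ ℚ.* (𝟙 a ℚ.+ 𝟙 b)) (set-at S true f) (set-at S false f)))
         (E-const ½ (randomTable n)))

E-at² : ∀ {n} {S S′ : Subset n} → S ≢ S′ → E (λ f → 𝟙 (f at S) ℚ.* 𝟙 (f at S′)) (randomTable n) ≡ ½ ℚ.* ½
E-at² {n} {S} {S′} S≢S′ = trans (resample S _) (trans (E-cong X pointwise) (trans (E-* ½ (λ f → 𝟙 (f at S′)) X) (cong (½ ℚ.*_) (E-at S′))))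
  where
  X = randomTable n
  lemma : ∀ x → 1ℚ ℚ.* x ℚ.+ 0ℚ ℚ.* x ≡ x
  lemma x = trans (cong₂ ℚ._+_ (ℚ.*-identityˡ x) (ℚ.*-zeroˡ x)) (ℚ.+-identityʳ x)
  pointwise : ∀ f → ½ ℚ.* (𝟙 (set S true f at S) ℚ.* 𝟙 (set S true f at S′) ℚ.+ 𝟙 (set S false f at S) ℚ.* 𝟙 (set S false f at S′)) ≡ ½ ℚ.* 𝟙 (f at S′)
  pointwise f rewrite set-at S true f | set-at S false f | set-at-≢ true f S≢S′ | set-at-≢ false f S≢S′ = cong (½ ℚ.*_) (lemma (𝟙 (f at S′)))

E-inAll : ∀ {n} (S : Subset n) r → E (λ fs → 𝟙 (S inAll fs)) (drawVec (randomTable n) r) ≡ ½^ r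
E-inAll S zero = refl
E-inAll {n} S (suc r) = begin
  E (λ fs → 𝟙 (S inAll fs)) (drawVec X (suc r)) ≡⟨ E-drawVec (λ fs → 𝟙 (S inAll fs)) X r ⟩
  E (λ f → E (λ fs → 𝟙 ((f at S) ∧ (S inAll fs))) (drawVec X r)) X ≡⟨ E-cong X (λ f → E-cong (drawVec X r) (λ fs → 𝟙-∧ (f at S) (S inAll fs))) ⟩
  E (λ f → E (λ fs → 𝟙 (f at S) ℚ.* 𝟙 (S inAll fs)) (drawVec X r)) X ≡⟨ E-cong X (λ f → trans (E-* (𝟙 (f at S)) (λ fs → 𝟙 (S inAll fs)) (drawVec X r)) (trans (cong (𝟙 (f at S) ℚ.*_) (E-inAll S r)) (ℚ.*-comm (𝟙 (f at S)) (½^ r)))) ⟩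
  E (λ f → ½^ r ℚ.* 𝟙 (f at S)) X ≡⟨ E-* (½^ r) (λ f → 𝟙 (f at S)) X ⟩
  ½^ r ℚ.* E (λ f → 𝟙 (f at S)) X ≡⟨ cong (½^ r ℚ.*_) (E-at S) ⟩
  ½^ r ℚ.* ½ ≡⟨ ℚ.*-comm (½^ r) ½ ⟩
  ½^ suc r ∎
  where
  open ≡-Reasoning
  X = randomTable n

E-inAll² : ∀ {n} {S S′ : Subset n} → S ≢ S′ → ∀ r →
  E (λ fs → 𝟙 (S inAll fs) ℚ.* 𝟙 (S′ inAll fs)) (drawVec (randomTable n) r) ≡ ½^ r ℚ.* ½^ r
E-inAll² S≢ zero = refl
E-inAll² {n} {S} {S′} S≢ (suc r) = begin
  E (λ fs → 𝟙 (S inAll fs) ℚ.* 𝟙 (S′ inAll fs)) (drawVec X (suc r)) ≡⟨ E-drawVec (λ fs → 𝟙 (S inAll fs) ℚ.* 𝟙 (S′ inAll fs)) X r ⟩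
  E (λ f → E (λ fs → 𝟙 ((f at S) ∧ (S inAll fs)) ℚ.* 𝟙 ((f at S′) ∧ (S′ inAll fs))) (drawVec X r)) X
    ≡⟨ E-cong X (λ f → E-cong (drawVec X r) (λ fs → trans (cong₂ ℚ._*_ (𝟙-∧ (f at S) (S inAll fs)) (𝟙-∧ (f at S′) (S′ inAll fs)))
         (swap (𝟙 (f at S)) (𝟙 (S inAll fs)) (𝟙 (f at S′)) (𝟙 (S′ inAll fs))))) ⟩
  E (λ f → E (λ fs → (𝟙 (f at S) ℚ.* 𝟙 (f at S′)) ℚ.* (𝟙 (S inAll fs) ℚ.* 𝟙 (S′ inAll fs))) (drawVec X r)) X
    ≡⟨ E-cong X (λ f → trans (E-* (𝟙 (f at S) ℚ.* 𝟙 (f at S′)) (λ fs → 𝟙 (S inAll fs) ℚ.* 𝟙 (S′ inAll fs)) (drawVec X r))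
         (trans (cong (𝟙 (f at S) ℚ.* 𝟙 (f at S′) ℚ.*_) (E-inAll² S≢ r)) (ℚ.*-comm _ (½^ r ℚ.* ½^ r)))) ⟩
  E (λ f → (½^ r ℚ.* ½^ r) ℚ.* (𝟙 (f at S) ℚ.* 𝟙 (f at S′))) X ≡⟨ E-* (½^ r ℚ.* ½^ r) (λ f → 𝟙 (f at S) ℚ.* 𝟙 (f at S′)) X ⟩
  (½^ r ℚ.* ½^ r) ℚ.* E (λ f → 𝟙 (f at S) ℚ.* 𝟙 (f at S′)) X ≡⟨ cong ((½^ r ℚ.* ½^ r) ℚ.*_) (E-at² S≢) ⟩
  (½^ r ℚ.* ½^ r) ℚ.* (½ ℚ.* ½) ≡⟨ final (½^ r) ½ ⟩
  ½^ suc r ℚ.* ½^ suc r ∎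
  where
  open ≡-Reasoning
  X = randomTable n
  swap : ∀ a b c d → a ℚ.* b ℚ.* (c ℚ.* d) ≡ (a ℚ.* c) ℚ.* (b ℚ.* d)
  swap = Ring.solve-∀ ℚ-ring
  final : ∀ a h → (a ℚ.* a) ℚ.* (h ℚ.* h) ≡ h ℚ.* a ℚ.* (h ℚ.* a)
  final = Ring.solve-∀ ℚ-ring

sumℚ : ∀ {A : Set} → (A → ℚ) → List A → ℚ
sumℚ f [] = 0ℚ
sumℚ f (x ∷ xs) = f x ℚ.+ sumℚ f xs

sumℚ-mono : ∀ {A : Set} {f g : A → ℚ} xs → (∀ x → f x ℚ.≤ g x) → sumℚ f xs ℚ.≤ sumℚ g xs
sumℚ-mono [] f≤g = ℚ.≤-refl
sumℚ-mono (x ∷ xs) f≤g = ℚ.+-mono-≤ (f≤g x) (sumℚ-mono xs f≤g)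

sumℚ-cong : ∀ {A : Set} {f g : A → ℚ} xs → (∀ x → f x ≡ g x) → sumℚ f xs ≡ sumℚ g xs
sumℚ-cong [] f≡g = refl
sumℚ-cong (x ∷ xs) f≡g = cong₂ ℚ._+_ (f≡g x) (sumℚ-cong xs f≡g)

sumℚ-* : ∀ {A : Set} c (f : A → ℚ) xs → sumℚ (λ x → c ℚ.* f x) xs ≡ c ℚ.* sumℚ f xs
sumℚ-* c f [] = sym (ℚ.*-zeroʳ c)
sumℚ-* c f (x ∷ xs) = trans (cong (c ℚ.* f x ℚ.+_) (sumℚ-* c f xs)) (sym (ℚ.*-distribˡ-+ c (f x) (sumℚ f xs)))

sumℚ-const : ∀ {A : Set} c (xs : List A) → sumℚ (λ _ → c) xs ≡ fromℕ (length xs) ℚ.* c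
sumℚ-const c [] = sym (ℚ.*-zeroˡ c)
sumℚ-const c (x ∷ xs) = trans (cong (c ℚ.+_) (sumℚ-const c xs))
  (sym (fromℕ-suc-* (length xs) c))

0≤sumℚ : ∀ {A : Set} {f : A → ℚ} xs → (∀ x → 0ℚ ℚ.≤ f x) → 0ℚ ℚ.≤ sumℚ f xs
0≤sumℚ [] 0≤f = ℚ.≤-refl
0≤sumℚ (x ∷ xs) 0≤f = 0≤+ℚ (0≤f x) (0≤sumℚ xs 0≤f)

term≤sumℚ : ∀ {A : Set} {f : A → ℚ} {x xs} → (∀ x → 0ℚ ℚ.≤ f x) → x ∈ xs → f x ℚ.≤ sumℚ f xs
term≤sumℚ {f = f} {x} {.x ∷ xs} 0≤f (here refl) = ≤-by-slack _ (0≤sumℚ xs 0≤f) refl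
term≤sumℚ {f = f} {x} {y ∷ xs} 0≤f (there x∈) = ≤-by-slack (f y ℚ.+ (sumℚ f xs ℚ.- f x))
  (0≤+ℚ (0≤f y) (slack (term≤sumℚ 0≤f x∈))) (lemma (f y) (f x) (sumℚ f xs))
  where
  lemma : ∀ a b c → a ℚ.+ c ≡ b ℚ.+ (a ℚ.+ (c ℚ.- b))
  lemma = Ring.solve-∀ ℚ-ring

E-sumℚ : ∀ {A B : Set} (f : B → A → ℚ) xs (X : Rand A) → E (λ a → sumℚ (λ b → f b a) xs) X ≡ sumℚ (λ b → E (f b) X) xs
E-sumℚ f [] X = E-const 0ℚ X
E-sumℚ f (b ∷ xs) X = trans (E-+ (f b) (λ a → sumℚ (λ b → f b a) xs) X) (cong (E (f b) X ℚ.+_) (E-sumℚ f xs X))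

-- Derandomization down to few random bits

uniform : (r : ℕ) → Rand (Vec Bool r)
uniform zero = return []
uniform (suc r) = flip (uniform r >>= λ v → return (true ∷ v)) (uniform r >>= λ v → return (false ∷ v))

E-uniform-suc : ∀ r (f : Vec Bool (suc r) → ℚ) →
  E f (uniform (suc r)) ≡ ½ ℚ.* (E (f ∘ (true ∷_)) (uniform r) ℚ.+ E (f ∘ (false ∷_)) (uniform r))
E-uniform-suc r f = cong₂ (λ p q → ½ ℚ.* (p ℚ.+ q)) (E->>= f (uniform r) _) (E->>= f (uniform r) _)

toℕ : Bool → ℕ
toℕ true = 1
toℕ false = 0

countBits : ∀ {r} → (Vec Bool r → Bool) → ℕ
countBits {zero} f = toℕ (f [])
countBits {suc r} f = countBits (f ∘ (true ∷_)) + countBits (f ∘ (false ∷_))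

E-countBits : ∀ r (f : Vec Bool r → Bool) → E (𝟙 ∘ f) (uniform r) ≡ fromℕ (countBits f) ℚ.* ½^ r
E-countBits zero f with f []
... | true = refl
... | false = refl
E-countBits (suc r) f = begin
  E (𝟙 ∘ f) (uniform (suc r)) ≡⟨ E-uniform-suc r (𝟙 ∘ f) ⟩
  ½ ℚ.* (E (𝟙 ∘ f₁) (uniform r) ℚ.+ E (𝟙 ∘ f₀) (uniform r)) ≡⟨ cong₂ (λ p q → ½ ℚ.* (p ℚ.+ q)) (E-countBits r f₁) (E-countBits r f₀) ⟩
  ½ ℚ.* (fromℕ (countBits f₁) ℚ.* ½^ r ℚ.+ fromℕ (countBits f₀) ℚ.* ½^ r) ≡⟨ lemma ½ (½^ r) (fromℕ (countBits f₁)) (fromℕ (countBits f₀)) ⟩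
  (fromℕ (countBits f₁) ℚ.+ fromℕ (countBits f₀)) ℚ.* ½^ suc r ≡⟨ cong (ℚ._* ½^ suc r) (sym (fromℕ-+ (countBits f₁) (countBits f₀))) ⟩
  fromℕ (countBits f) ℚ.* ½^ suc r ∎
  where
  open ≡-Reasoning
  f₁ = f ∘ (true ∷_)
  f₀ = f ∘ (false ∷_)
  lemma : ∀ h p a b → h ℚ.* (a ℚ.* p ℚ.+ b ℚ.* p) ≡ (a ℚ.+ b) ℚ.* (h ℚ.* p)
  lemma = Ring.solve-∀ ℚ-ring

2ℚ^ : ℕ → ℚ
2ℚ^ k = fromℕ (2 ^ k)

2ℚ^-+ : ∀ a b → 2ℚ^ (a + b) ≡ 2ℚ^ a ℚ.* 2ℚ^ b
2ℚ^-+ a b = trans (cong fromℕ (ℕ.^-distribˡ-+-* 2 a b)) (fromℕ-* (2 ^ a) (2 ^ b))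

2ℚ^-toℕ : ∀ b → 2ℚ^ (toℕ b) ≡ 1ℚ ℚ.+ 𝟙 b
2ℚ^-toℕ true = refl
2ℚ^-toℕ false = refl

module Derandomize {Ω Config : Set} (X : Rand Ω) (bad : Config → Ω → Bool) (δ : ℚ) (0≤δ : 0ℚ ℚ.≤ δ)
  (bad≤δ : ∀ x → E (𝟙 ∘ bad x) X ℚ.≤ δ) (configs : List Config) where

  growth : ℕ → ℚ
  growth zero = 1ℚ ℚ.+ δ
  growth (suc r) = growth r ℚ.* growth r

  0≤growth : ∀ r → 0ℚ ℚ.≤ growth r
  0≤growth zero = 0≤+ℚ 0≤1ℚ 0≤δ
  0≤growth (suc r) = 0≤*ℚ (0≤growth r) (0≤growth r)

  bads : ∀ {r} → Config → (Vec Bool r → Ω) → ℕ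
  bads x t = countBits (bad x ∘ t)

  -- The weight of a configuration doubles with every bad choice; a choice that is no worse than the
  -- average one increases the total weight by a factor of at most 1 + δ.
  choose : ∀ r (w : Config → ℚ) → (∀ x → 0ℚ ℚ.≤ w x) →
    ∃[ t ] sumℚ (λ x → w x ℚ.* 2ℚ^ (bads {r} x t)) configs ℚ.≤ growth r ℚ.* sumℚ w configs
  choose zero w 0≤w = (λ _ → ω) , ℚ.≤-trans ω≤ mean
    where
    open ℚ.≤-Reasoning
    weight : Config → Ω → ℚ
    weight x ω = w x ℚ.* 2ℚ^ (toℕ (bad x ω))
    attained = E-attained (λ ω → sumℚ (λ x → weight x ω) configs) X
    ω = proj₁ attained
    ω≤ = proj₂ attained
    lemma : ∀ x → E (weight x) X ℚ.≤ (1ℚ ℚ.+ δ) ℚ.* w x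
    lemma x = begin
      E (weight x) X ≡⟨ E-cong X (λ ω → cong (w x ℚ.*_) (2ℚ^-toℕ (bad x ω))) ⟩
      E (λ ω → w x ℚ.* (1ℚ ℚ.+ 𝟙 (bad x ω))) X ≡⟨ E-* (w x) (λ ω → 1ℚ ℚ.+ 𝟙 (bad x ω)) X ⟩
      w x ℚ.* E (λ ω → 1ℚ ℚ.+ 𝟙 (bad x ω)) X ≡⟨ cong (w x ℚ.*_) (trans (E-+ (λ _ → 1ℚ) (𝟙 ∘ bad x) X) (cong (ℚ._+ E (𝟙 ∘ bad x) X) (E-const 1ℚ X))) ⟩
      w x ℚ.* (1ℚ ℚ.+ E (𝟙 ∘ bad x) X) ≤⟨ *-monoˡℚ (w x) (0≤w x) (ℚ.+-monoʳ-≤ 1ℚ (bad≤δ x)) ⟩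
      w x ℚ.* (1ℚ ℚ.+ δ) ≡⟨ ℚ.*-comm (w x) (1ℚ ℚ.+ δ) ⟩
      (1ℚ ℚ.+ δ) ℚ.* w x ∎
    mean : E (λ ω → sumℚ (λ x → weight x ω) configs) X ℚ.≤ (1ℚ ℚ.+ δ) ℚ.* sumℚ w configs
    mean = begin
      E (λ ω → sumℚ (λ x → weight x ω) configs) X ≡⟨ E-sumℚ weight configs X ⟩
      sumℚ (λ x → E (weight x) X) configs ≤⟨ sumℚ-mono configs lemma ⟩
      sumℚ (λ x → (1ℚ ℚ.+ δ) ℚ.* w x) configs ≡⟨ sumℚ-* (1ℚ ℚ.+ δ) w configs ⟩
      (1ℚ ℚ.+ δ) ℚ.* sumℚ w configs ∎
  choose (suc r) w 0≤w = t , bound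
    where
    open ℚ.≤-Reasoning
    c₁ = choose r w 0≤w
    t₁ = proj₁ c₁
    w′ : Config → ℚ
    w′ x = w x ℚ.* 2ℚ^ (bads x t₁)
    c₀ = choose r w′ (λ x → 0≤*ℚ (0≤w x) (0≤fromℕ (2 ^ bads x t₁)))
    t₀ = proj₁ c₀
    t : Vec Bool (suc r) → Ω
    t (true ∷ v) = t₁ v
    t (false ∷ v) = t₀ v
    bound : sumℚ (λ x → w x ℚ.* 2ℚ^ (bads x t)) configs ℚ.≤ growth r ℚ.* growth r ℚ.* sumℚ w configs
    bound = begin
      sumℚ (λ x → w x ℚ.* 2ℚ^ (bads x t)) configs
        ≡⟨ sumℚ-cong configs (λ x → trans (cong (w x ℚ.*_) (2ℚ^-+ (bads x t₁) (bads x t₀))) (sym (ℚ.*-assoc (w x) (2ℚ^ (bads x t₁)) (2ℚ^ (bads x t₀))))) ⟩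
      sumℚ (λ x → w′ x ℚ.* 2ℚ^ (bads x t₀)) configs ≤⟨ proj₂ c₀ ⟩
      growth r ℚ.* sumℚ w′ configs ≤⟨ *-monoˡℚ (growth r) (0≤growth r) (proj₂ c₁) ⟩
      growth r ℚ.* (growth r ℚ.* sumℚ w configs) ≡⟨ sym (ℚ.*-assoc (growth r) (growth r) (sumℚ w configs)) ⟩
      growth r ℚ.* growth r ℚ.* sumℚ w configs ∎

  growth-bound : ∀ r → 2ℚ^ r ℚ.* δ ℚ.≤ 1ℚ → growth r ℚ.* (1ℚ ℚ.- 2ℚ^ r ℚ.* δ) ℚ.≤ 1ℚ
  growth-bound zero h = ≤-by-slack (δ ℚ.* δ) (0≤*ℚ 0≤δ 0≤δ) (lemma δ)
    where
    lemma : ∀ d → 1ℚ ≡ (1ℚ ℚ.+ d) ℚ.* (1ℚ ℚ.- 1ℚ ℚ.* d) ℚ.+ d ℚ.* d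
    lemma = Ring.solve-∀ ℚ-ring
  growth-bound (suc r) h = begin
    g ℚ.* g ℚ.* (1ℚ ℚ.- 2ℚ^ (suc r) ℚ.* δ) ≡⟨ cong (λ p → g ℚ.* g ℚ.* (1ℚ ℚ.- p)) double ⟩
    g ℚ.* g ℚ.* (1ℚ ℚ.- (y ℚ.+ y)) ≤⟨ ≤-by-slack (g ℚ.* g ℚ.* (y ℚ.* y)) (0≤*ℚ (0≤*ℚ 0≤g 0≤g) (0≤*ℚ 0≤y 0≤y)) (lemma g y) ⟩
    (g ℚ.* (1ℚ ℚ.- y)) ℚ.* (g ℚ.* (1ℚ ℚ.- y)) ≤⟨ *-mono-≤ℚ 0≤u 0≤u (growth-bound r y≤1) (growth-bound r y≤1) ⟩
    1ℚ ℚ.* 1ℚ ≡⟨ ℚ.*-identityˡ 1ℚ ⟩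
    1ℚ ∎
    where
    open ℚ.≤-Reasoning
    g = growth r
    y = 2ℚ^ r ℚ.* δ
    0≤g = 0≤growth r
    0≤y : 0ℚ ℚ.≤ y
    0≤y = 0≤*ℚ (0≤fromℕ (2 ^ r)) 0≤δ
    double : 2ℚ^ (suc r) ℚ.* δ ≡ y ℚ.+ y
    double = trans (cong (ℚ._* δ) (trans (cong (λ k → fromℕ (2 ^ r + k)) (ℕ.+-identityʳ (2 ^ r))) (fromℕ-+ (2 ^ r) (2 ^ r)))) (ℚ.*-distribʳ-+ δ (2ℚ^ r) (2ℚ^ r))
    y≤1 : y ℚ.≤ 1ℚ
    y≤1 = ℚ.≤-trans (≤-by-slack y 0≤y double) h
    0≤u : 0ℚ ℚ.≤ g ℚ.* (1ℚ ℚ.- y)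
    0≤u = 0≤*ℚ 0≤g (slack y≤1)
    lemma : ∀ g y → (g ℚ.* (1ℚ ℚ.- y)) ℚ.* (g ℚ.* (1ℚ ℚ.- y)) ≡ g ℚ.* g ℚ.* (1ℚ ℚ.- (y ℚ.+ y)) ℚ.+ g ℚ.* g ℚ.* (y ℚ.* y)
    lemma = Ring.solve-∀ ℚ-ring

  derandomize : ∀ ρ a → δ ≡ ½^ suc ρ → length configs ≤ 2 ^ a →
    Σ[ t ∈ (Vec Bool ρ → Ω) ] (∀ {x} → x ∈ configs → bads x t ≤ suc a)
  derandomize ρ a δ≡ len≤ = t , few
    where
    open ℚ.≤-Reasoning
    c = choose ρ (λ _ → 1ℚ) (λ _ → 0≤1ℚ)
    t = proj₁ c
    half : 2ℚ^ ρ ℚ.* δ ≡ ½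
    half = trans (cong (2ℚ^ ρ ℚ.*_) δ≡) (trans (lemma (2ℚ^ ρ) ½ (½^ ρ)) (trans (cong (½ ℚ.*_) (½^*2^ ρ)) (ℚ.*-identityʳ ½)))
      where
      lemma : ∀ a b c → a ℚ.* (b ℚ.* c) ≡ b ℚ.* (c ℚ.* a)
      lemma = Ring.solve-∀ ℚ-ring
    growth≤2 : growth ρ ℚ.≤ 1ℚ ℚ.+ 1ℚ
    growth≤2 = begin
      growth ρ ≡⟨ sym (½*[p+p]≡p (growth ρ)) ⟩
      ½ ℚ.* (growth ρ ℚ.+ growth ρ) ≡⟨ lemma ½ (growth ρ) ⟩
      growth ρ ℚ.* ½ ℚ.+ growth ρ ℚ.* ½ ≤⟨ ℚ.+-mono-≤ bound bound ⟩
      1ℚ ℚ.+ 1ℚ ∎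
      where
      lemma : ∀ h g → h ℚ.* (g ℚ.+ g) ≡ g ℚ.* h ℚ.+ g ℚ.* h
      lemma = Ring.solve-∀ ℚ-ring
      bound : growth ρ ℚ.* ½ ℚ.≤ 1ℚ
      bound = subst (λ p → growth ρ ℚ.* (1ℚ ℚ.- p) ℚ.≤ 1ℚ) half
        (growth-bound ρ (ℚ.≤-trans (ℚ.≤-reflexive half) (ℚ.≤ᵇ⇒≤ {½} {1ℚ} tt)))
    few : ∀ {x} → x ∈ configs → bads x t ≤ suc a
    few {x} x∈ with bads x t ℕ.≤? suc a
    ... | yes p = p
    ... | no ¬p = contradiction (ℕ.≤-trans (ℕ.^-monoʳ-< 2 (s≤s (s≤s z≤n)) (ℕ.≰⇒> ¬p)) (fromℕ-cancel-≤ bound)) (ℕ.<-irrefl refl)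
      where
      bound : 2ℚ^ (bads x t) ℚ.≤ 2ℚ^ (suc a)
      bound = begin
        2ℚ^ (bads x t) ≡⟨ sym (ℚ.*-identityˡ _) ⟩
        1ℚ ℚ.* 2ℚ^ (bads x t) ≤⟨ term≤sumℚ (λ y → 0≤*ℚ 0≤1ℚ (0≤fromℕ (2 ^ bads y t))) x∈ ⟩
        sumℚ (λ y → 1ℚ ℚ.* 2ℚ^ (bads y t)) configs ≤⟨ proj₂ c ⟩
        growth ρ ℚ.* sumℚ (λ _ → 1ℚ) configs ≡⟨ cong (growth ρ ℚ.*_) (trans (sumℚ-const 1ℚ configs) (ℚ.*-identityʳ _)) ⟩
        growth ρ ℚ.* fromℕ (length configs) ≤⟨ *-mono-≤ℚ (0≤growth ρ) (0≤fromℕ (length configs)) growth≤2 (fromℕ-mono len≤) ⟩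
        fromℕ 2 ℚ.* 2ℚ^ a ≡⟨ sym (fromℕ-* 2 (2 ^ a)) ⟩
        2ℚ^ (suc a) ∎

n<2^n : ∀ n → n < 2 ^ n
n<2^n zero = s≤s z≤n
n<2^n (suc n) = ℕ.≤-trans (ℕ.+-mono-≤ (ℕ.m^n>0 2 n) (n<2^n n)) (ℕ.≤-reflexive (cong (_+_ (2 ^ n)) (sym (ℕ.+-identityʳ (2 ^ n)))))

-- Encodings as bit vectors

take-++ : ∀ {A : Set} {a b} (u : Vec A a) (v : Vec A b) → Vec.take a (u Vec.++ v) ≡ u
take-++ [] v = refl
take-++ (x ∷ u) v = cong (x ∷_) (take-++ u v)

drop-++ : ∀ {A : Set} {a b} (u : Vec A a) (v : Vec A b) → Vec.drop a (u Vec.++ v) ≡ v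
drop-++ [] v = refl
drop-++ (x ∷ u) v = drop-++ u v

record Codec (A : Set) : Set₁ where
  field
    bits : ℕ
    enc : A → Vec Bool bits
    dec : Vec Bool bits → A
    Fit : A → Set
    dec-enc : ∀ {x} → Fit x → dec (enc x) ≡ x

open Codec

bitsCodec : ∀ n → Codec (Vec Bool n)
bitsCodec n = record { bits = n ; enc = λ v → v ; dec = λ v → v ; Fit = λ _ → ⊤ ; dec-enc = λ _ → refl }

_×-codec_ : ∀ {A B : Set} → Codec A → Codec B → Codec (A × B)
CA ×-codec CB = record
  { bits = bits CA + bits CB
  ; enc = λ (x , y) → enc CA x Vec.++ enc CB y
  ; dec = λ v → dec CA (Vec.take (bits CA) v) , dec CB (Vec.drop (bits CA) v)
  ; Fit = λ (x , y) → Fit CA x × Fit CB y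
  ; dec-enc = λ {(x , y)} (fx , fy) → cong₂ _,_
      (trans (cong (dec CA) (take-++ (enc CA x) (enc CB y))) (dec-enc CA fx))
      (trans (cong (dec CB) (drop-++ (enc CA x) (enc CB y))) (dec-enc CB fy))
  }

ℕ-codec : ℕ → Codec ℕ
ℕ-codec b = record { bits = b ; enc = encode b ; dec = decode ; Fit = _< 2 ^ b ; dec-enc = λ {x} → decode-encode b x }
  where
  encode : ∀ b → ℕ → Vec Bool b
  encode zero x = []
  encode (suc b) x = (x ℕ.% 2 ℕ.≡ᵇ 1) ∷ encode b (x ℕ./ 2)
  decode : ∀ {b} → Vec Bool b → ℕ
  decode [] = 0
  decode (x ∷ v) = toℕ x + decode v * 2
  parity : ∀ r → r < 2 → toℕ (r ℕ.≡ᵇ 1) ≡ r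
  parity zero _ = refl
  parity (suc zero) _ = refl
  parity (suc (suc r)) (s≤s (s≤s ()))
  decode-encode : ∀ b x → x < 2 ^ b → decode (encode b x) ≡ x
  decode-encode zero zero _ = refl
  decode-encode zero (suc x) (s≤s ())
  decode-encode (suc b) x x< = trans
    (cong₂ (λ r h → r + h * 2) (parity (x ℕ.% 2) (ℕ.m%n<n x 2))
      (decode-encode b (x ℕ./ 2) (ℕ.m<n*o⇒m/o<n {x} {2 ^ b} {2} (subst (x <_) (ℕ.*-comm 2 (2 ^ b)) x<))))
    (sym (ℕ.m≡m%n+[m/n]*n x 2))

listCodec : ∀ {A : Set} → ℕ → Codec A → Codec (List A)
listCodec {A} k CA = record { bits = k * suc (bits CA) ; enc = encode k ; dec = decode k
  ; Fit = λ xs → length xs ≤ k × All (Fit CA) xs ; dec-enc = λ (len , fit) → decode-encode k len fit }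
  where
  encode : ∀ k → List A → Vec Bool (k * suc (bits CA))
  encode zero xs = []
  encode (suc k) [] = Vec.replicate _ false
  encode (suc k) (x ∷ xs) = true ∷ (enc CA x Vec.++ encode k xs)
  decode : ∀ k → Vec Bool (k * suc (bits CA)) → List A
  decode zero v = []
  decode (suc k) (false ∷ v) = []
  decode (suc k) (true ∷ v) = dec CA (Vec.take (bits CA) v) ∷ decode k (Vec.drop (bits CA) v)
  decode-encode : ∀ k {xs} → length xs ≤ k → All (Fit CA) xs → decode k (encode k xs) ≡ xs
  decode-encode zero {[]} len fit = refl
  decode-encode (suc k) {[]} len fit = refl
  decode-encode (suc k) {x ∷ xs} (s≤s len) (f ∷ fit) = cong₂ _∷_
    (trans (cong (dec CA) (take-++ (enc CA x) (encode k xs))) (dec-enc CA f))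
    (trans (cong (decode k) (drop-++ (enc CA x) (encode k xs))) (decode-encode k len fit))

-- Counting queries

count : ∀ {A : Set} → (A → Bool) → List A → ℕ
count v [] = 0
count v (x ∷ xs) = toℕ (v x) + count v xs

count-++ : ∀ {A : Set} (v : A → Bool) xs ys → count v (xs ++ ys) ≡ count v xs + count v ys
count-++ v [] ys = refl
count-++ v (x ∷ xs) ys = trans (cong (_+_ (toℕ (v x))) (count-++ v xs ys)) (sym (ℕ.+-assoc (toℕ (v x)) (count v xs) (count v ys)))

count≤length : ∀ {A : Set} (v : A → Bool) xs → count v xs ≤ length xs
count≤length v [] = z≤n
count≤length v (x ∷ xs) with v x
... | true = s≤s (count≤length v xs)
... | false = ℕ.m≤n⇒m≤1+n (count≤length v xs)

length-filter≡count : ∀ {A : Set} {P : A → Set} (P? : ∀ x → Dec (P x)) xs → length (filter P? xs) ≡ count (does ∘ P?) xs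
length-filter≡count P? [] = refl
length-filter≡count P? (x ∷ xs) with does (P? x)
... | true = cong suc (length-filter≡count P? xs)
... | false = length-filter≡count P? xs

occ : ∀ {n} → Subset n → List (Subset n) → ℕ
occ S = count (λ S′ → does (S ≟ˢ S′))

occurrences≡occ : ∀ {n} (S : Subset n) 𝒯 → occurrences S 𝒯 ≡ occ S 𝒯
occurrences≡occ S = length-filter≡count (S ≟ˢ_)

occ-∷-≡ : ∀ {n} (S : Subset n) 𝒯 → occ S (S ∷ 𝒯) ≡ suc (occ S 𝒯)
occ-∷-≡ S 𝒯 = cong (λ b → toℕ b + occ S 𝒯) (Dec.dec-true (S ≟ˢ S) refl)

0<occ⇒∈ : ∀ {n} {S : Subset n} 𝒯 → 0 < occ S 𝒯 → S ∈ 𝒯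
0<occ⇒∈ {S = S} (S′ ∷ 𝒯) h with S ≟ˢ S′
... | yes p = here p
... | no ¬p = there (0<occ⇒∈ 𝒯 h)

∈⇒0<occ : ∀ {n} {S : Subset n} {𝒯} → S ∈ 𝒯 → 0 < occ S 𝒯
∈⇒0<occ {S = S} {.S ∷ 𝒯} (here refl) = subst (0 <_) (sym (occ-∷-≡ S 𝒯)) (s≤s z≤n)
∈⇒0<occ {S = S} {S′ ∷ 𝒯} (there S∈) = ℕ.≤-trans (∈⇒0<occ S∈) (ℕ.m≤n+m (occ S 𝒯) (toℕ (does (S ≟ˢ S′))))

count-determined : ∀ {n} (v : Subset n → Bool) xs ys → (∀ S → occ S xs ≡ occ S ys) → count v xs ≡ count v ys
count-determined v [] [] same = refl
count-determined v [] (S ∷ ys) same = case trans (same S) (occ-∷-≡ S ys) of λ ()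
count-determined v (S ∷ xs) ys same with Mem.∈-∃++ (0<occ⇒∈ {S = S} ys (subst (0 <_) (same S) (∈⇒0<occ {𝒯 = S ∷ xs} (here refl))))
... | ys₁ , ys₂ , refl = begin
  toℕ (v S) + count v xs ≡⟨ cong (_+_ (toℕ (v S))) (count-determined v xs (ys₁ ++ ys₂) same′) ⟩
  toℕ (v S) + count v (ys₁ ++ ys₂) ≡⟨ extract v ⟩
  count v (ys₁ ++ S ∷ ys₂) ∎
  where
  open ≡-Reasoning
  swap : ∀ a b c → a + (b + c) ≡ b + (a + c)
  swap = solve-∀
  extract : ∀ u → toℕ (u S) + count u (ys₁ ++ ys₂) ≡ count u (ys₁ ++ S ∷ ys₂)
  extract u = trans (cong (_+_ (toℕ (u S))) (count-++ u ys₁ ys₂)) (trans (swap (toℕ (u S)) (count u ys₁) (count u ys₂)) (sym (count-++ u ys₁ (S ∷ ys₂))))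
  same′ : ∀ S′ → occ S′ xs ≡ occ S′ (ys₁ ++ ys₂)
  same′ S′ = ℕ.+-cancelˡ-≡ (toℕ (does (S′ ≟ˢ S))) _ _ (trans (same S′) (sym (extract (λ S″ → does (S′ ≟ˢ S″)))))

record Sketch (n : ℕ) (X : Set) : Set where
  field
    queries : List (Subset n → Bool)
    decode : List ℕ → X

  size : ℕ
  size = length queries

  eval : List (Subset n) → X
  eval 𝒞 = decode (map (λ v → count v 𝒞) queries)

open Sketch

pureˢ : ∀ {n} {X : Set} → X → Sketch n X
pureˢ x = record { queries = [] ; decode = λ _ → x }

liftˢ : ∀ {n} {X Y Z : Set} → (X → Y → Z) → Sketch n X → Sketch n Y → Sketch n Z
liftˢ f s t = record { queries = queries s ++ queries t
  ; decode = λ cs → f (decode s (take (size s) cs)) (decode t (drop (size s) cs)) }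

size-liftˢ : ∀ {n} {X Y Z : Set} (f : X → Y → Z) (s : Sketch n X) (t : Sketch n Y) → size (liftˢ f s t) ≡ size s + size t
size-liftˢ f s t = List.length-++ (queries s)

take-map-++ : ∀ {A B : Set} (g : A → B) xs ys → take (length xs) (map g (xs ++ ys)) ≡ map g xs
take-map-++ g [] ys = refl
take-map-++ g (x ∷ xs) ys = cong (g x ∷_) (take-map-++ g xs ys)

drop-map-++ : ∀ {A B : Set} (g : A → B) xs ys → drop (length xs) (map g (xs ++ ys)) ≡ map g ys
drop-map-++ g [] ys = refl
drop-map-++ g (x ∷ xs) ys = drop-map-++ g xs ys

eval-liftˢ : ∀ {n} {X Y Z : Set} (f : X → Y → Z) (s : Sketch n X) (t : Sketch n Y) 𝒞 →
  eval (liftˢ f s t) 𝒞 ≡ f (eval s 𝒞) (eval t 𝒞)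
eval-liftˢ f s t 𝒞 = cong₂ (λ xs ys → f (decode s xs) (decode t ys))
  (take-map-++ (λ v → count v 𝒞) (queries s) (queries t)) (drop-map-++ (λ v → count v 𝒞) (queries s) (queries t))

iterate : ∀ {n} {A : Set} → List (Subset n) → (ℕ → A → Sketch n A) → ℕ → ℕ → A → A
iterate 𝒞 F i zero x = x
iterate 𝒞 F i (suc p) x = iterate 𝒞 F (suc i) p (eval (F i x) 𝒞)

iterate-shift : ∀ {n} {A : Set} 𝒞 (F G : ℕ → A → Sketch n A) i j p x → (∀ k → F (i + k) ≡ G (j + k)) → iterate 𝒞 F i p x ≡ iterate 𝒞 G j p x
iterate-shift 𝒞 F G i j zero x same = refl
iterate-shift 𝒞 F G i j (suc p) x same = trans
  (cong (λ H → iterate 𝒞 F (suc i) p (eval (H x) 𝒞)) (trans (cong F (sym (ℕ.+-identityʳ i))) (trans (same 0) (cong G (ℕ.+-identityʳ j)))))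
  (iterate-shift 𝒞 F G (suc i) (suc j) p (eval (G j x) 𝒞) (λ k → trans (cong F (sym (ℕ.+-suc i k))) (trans (same (suc k)) (cong G (ℕ.+-suc j k)))))

-- Dynamic streams answer counting queries

inserted deleted : ∀ {n} → List (Update n) → List (Subset n)
inserted [] = []
inserted ((S , Sign.+) ∷ a) = S ∷ inserted a
inserted ((S , Sign.-) ∷ a) = inserted a
deleted [] = []
deleted ((S , Sign.+) ∷ a) = deleted a
deleted ((S , Sign.-) ∷ a) = S ∷ deleted a

multiplicity-spec : ∀ {n} (a : List (Update n)) S → multiplicity a S ℤ.+ + occ S (deleted a) ≡ + occ S (inserted a)
multiplicity-spec [] S = refl
multiplicity-spec ((S′ , Sign.+) ∷ a) S with S′ ≟ˢ S
... | yes refl rewrite occ-∷-≡ S (inserted a) =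
  trans (ℤ.+-assoc (+ 1) (multiplicity a S) _) (cong (λ z → (+ 1) ℤ.+ z) (multiplicity-spec a S))
... | no ¬p rewrite Dec.dec-false (S ≟ˢ S′) (¬p ∘ sym) = multiplicity-spec a S
multiplicity-spec ((S′ , Sign.-) ∷ a) S with S′ ≟ˢ S
... | yes refl rewrite occ-∷-≡ S (deleted a) = trans (lemma (multiplicity a S) (+ occ S (deleted a))) (multiplicity-spec a S)
  where
  lemma : ∀ x y → ℤ.- (+ 1) ℤ.+ x ℤ.+ (+ 1 ℤ.+ y) ≡ x ℤ.+ y
  lemma = ℤRing.solve-∀
... | no ¬p rewrite Dec.dec-false (S ≟ˢ S′) (¬p ∘ sym) = multiplicity-spec a S

inserted-count : ∀ {n} (a : List (Update n)) 𝒞 → Defines a 𝒞 → ∀ v → count v (inserted a) ≡ count v 𝒞 + count v (deleted a)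
inserted-count a 𝒞 defines v = trans (count-determined v (inserted a) (𝒞 ++ deleted a) same) (count-++ v 𝒞 (deleted a))
  where
  same : ∀ S → occ S (inserted a) ≡ occ S (𝒞 ++ deleted a)
  same S = ℤ.+-injective (begin
    + occ S (inserted a) ≡⟨ sym (multiplicity-spec a S) ⟩
    multiplicity a S ℤ.+ + occ S (deleted a) ≡⟨ cong (ℤ._+ + occ S (deleted a)) (sym (defines S)) ⟩
    + occurrences S 𝒞 ℤ.+ + occ S (deleted a) ≡⟨ sym (ℤ.pos-+ (occurrences S 𝒞) (occ S (deleted a))) ⟩
    + (occurrences S 𝒞 + occ S (deleted a)) ≡⟨ cong (λ k → + (k + occ S (deleted a))) (occurrences≡occ S 𝒞) ⟩
    + (occ S 𝒞 + occ S (deleted a)) ≡⟨ cong (λ k → + k) (sym (count-++ (λ S′ → does (S ≟ˢ S′)) 𝒞 (deleted a))) ⟩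
    + occ S (𝒞 ++ deleted a) ∎)
    where open ≡-Reasoning

module Counter (m : ℕ) where

  weight : Sign → ℕ
  weight Sign.+ = 1
  weight Sign.- = m

  bump : ∀ {n} → Update n → (Subset n → Bool) → ℕ → ℕ
  bump (S , Δ) v c = if v S then (c + weight Δ) ℕ.% suc m else c

  bumps : ∀ {n} → List (Update n) → ((Subset n → Bool) → ℕ) → (Subset n → Bool) → ℕ
  bumps [] t v = t v
  bumps (x ∷ a) t v = bumps a (λ v → bump x v (t v)) v

  bump-≤ : ∀ {n} (x : Update n) v c → c ≤ m → bump x v c ≤ m
  bump-≤ (S , Δ) v c c≤ with v S
  ... | true = ℕ.m<1+n⇒m≤n (ℕ.m%n<n (c + weight Δ) (suc m))
  ... | false = c≤

  bumps-spec : ∀ {n} (a : List (Update n)) t v → t v ≤ m → bumps a t v ≡ (t v + (count v (inserted a) + m * count v (deleted a))) ℕ.% suc m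
  bumps-spec [] t v t≤ = sym (trans (cong (ℕ._% suc m) (lemma (t v) m)) (ℕ.m<n⇒m%n≡m (s≤s t≤)))
    where
    lemma : ∀ t m → t + (0 + m * 0) ≡ t
    lemma = solve-∀
  bumps-spec ((S , Δ) ∷ a) t v t≤ = trans (bumps-spec a _ v (bump-≤ (S , Δ) v (t v) t≤)) (go Δ)
    where
    i = count v (inserted a)
    d = count v (deleted a)
    absorb : ∀ x y → (x ℕ.% suc m + y) ℕ.% suc m ≡ (x + y) ℕ.% suc m
    absorb x y = trans (ℕ.%-distribˡ-+ (x ℕ.% suc m) y (suc m))
      (trans (cong (λ z → (z + y ℕ.% suc m) ℕ.% suc m) (ℕ.m%n%n≡m%n x (suc m))) (sym (ℕ.%-distribˡ-+ x y (suc m))))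
    lemma+ : ∀ t i d m → t + 1 + (i + m * d) ≡ t + (1 + i + m * d)
    lemma+ = solve-∀
    lemma- : ∀ t i d m → t + m + (i + m * d) ≡ t + (i + m * (1 + d))
    lemma- = solve-∀
    go : ∀ Δ → (bump (S , Δ) v (t v) + (i + m * d)) ℕ.% suc m ≡
      (t v + (count v (inserted ((S , Δ) ∷ a)) + m * count v (deleted ((S , Δ) ∷ a)))) ℕ.% suc m
    go Sign.+ with v S
    ... | true = trans (absorb (t v + 1) _) (cong (ℕ._% suc m) (lemma+ (t v) i d m))
    ... | false = refl
    go Sign.- with v S
    ... | true = trans (absorb (t v + m) _) (cong (ℕ._% suc m) (lemma- (t v) i d m))
    ... | false = refl

  bumps-counts : ∀ {n} (a : List (Update n)) 𝒞 → Defines a 𝒞 → length 𝒞 ≤ m → ∀ v → bumps a (λ _ → 0) v ≡ count v 𝒞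
  bumps-counts a 𝒞 defines len v = begin
    bumps a (λ _ → 0) v ≡⟨ bumps-spec a (λ _ → 0) v z≤n ⟩
    (count v (inserted a) + m * count v (deleted a)) ℕ.% suc m ≡⟨ cong (λ k → (k + m * count v (deleted a)) ℕ.% suc m) (inserted-count a 𝒞 defines v) ⟩
    (count v 𝒞 + d + m * d) ℕ.% suc m ≡⟨ cong (ℕ._% suc m) (lemma (count v 𝒞) d m) ⟩
    (count v 𝒞 + d * suc m) ℕ.% suc m ≡⟨ ℕ.[m+kn]%n≡m%n (count v 𝒞) d (suc m) ⟩
    count v 𝒞 ℕ.% suc m ≡⟨ ℕ.m<n⇒m%n≡m (s≤s (ℕ.≤-trans (count≤length v 𝒞) len)) ⟩
    count v 𝒞 ∎
    where
    open ≡-Reasoning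
    d = count v (deleted a)
    lemma : ∀ c d m → c + d + m * d ≡ c + d * suc m
    lemma = solve-∀

module Simulation {n} {A O : Set} (m b P W ρ : ℕ) (m<2^b : m < 2 ^ b)
  (CA : Codec A) (x₀ : A) (pass : Vec Bool ρ → ℕ → A → Sketch n A) (out : Vec Bool ρ → A → O)
  (Inv : A → Set) (Inv⇒Fit : ∀ {x} → Inv x → Fit CA x) (inv₀ : Inv x₀)
  (inv-pass : ∀ v i x cs → Inv x → Inv (decode (pass v i x) cs))
  (size≤W : ∀ v i x → size (pass v i x) ≤ W) where

  open Counter m

  Config : Set
  Config = Vec Bool ρ × ℕ × A × List ℕ

  codec : Codec Config
  codec = bitsCodec ρ ×-codec (ℕ-codec P ×-codec (CA ×-codec listCodec W (ℕ-codec b)))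

  start : Vec Bool ρ → ℕ → A → Config
  start v i x = v , i , x , map (λ _ → 0) (queries (pass v i x))

  updateConfig : Update n → Config → Config
  updateConfig u (v , i , x , cs) = v , i , x , List.zipWith (bump u) (queries (pass v i x)) cs

  endConfig : Config → Config
  endConfig (v , i , x , cs) = start v (suc i) (decode (pass v i x) cs)

  outConfig : Config → O
  outConfig (v , i , x , cs) = out v x

  algorithm : StreamingAlgorithm (Update n) O
  algorithm = record
    { passes = P
    ; space = bits codec
    ; init = uniform ρ >>= λ v → return (enc codec (start v 0 x₀))
    ; update = λ u s → return (enc codec (updateConfig u (dec codec s)))
    ; endPass = λ s → return (enc codec (endConfig (dec codec s)))
    ; output = λ s → outConfig (dec codec s)
    }

  open StreamingAlgorithm algorithm using (run; read; runPasses)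

  fit-config : ∀ {v i x} (t : (Subset n → Bool) → ℕ) → i < 2 ^ P → Inv x → (∀ u → t u ≤ m) →
    Fit codec (v , i , x , map t (queries (pass v i x)))
  fit-config {v} {i} {x} t i< inv t≤ = _ , i< , Inv⇒Fit inv ,
    subst (_≤ W) (sym (List.length-map t (queries (pass v i x)))) (size≤W v i x) ,
    all (queries (pass v i x))
    where
    all : ∀ vs → All (_< 2 ^ b) (map t vs)
    all [] = []
    all (u ∷ vs) = ℕ.≤-<-trans (t≤ u) m<2^b ∷ all vs

  zipWith-map : ∀ {X Y Z : Set} (f : X → Y → Z) (g : X → Y) xs → List.zipWith f xs (map g xs) ≡ map (λ x → f x (g x)) xs
  zipWith-map f g [] = refl
  zipWith-map f g (x ∷ xs) = cong (f x (g x) ∷_) (zipWith-map f g xs)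

  read-spec : ∀ a {v i x} t → i < 2 ^ P → Inv x → (∀ u → t u ≤ m) →
    read a (enc codec (v , i , x , map t (queries (pass v i x)))) ≡
    return (enc codec (v , i , x , map (bumps a t) (queries (pass v i x))))
  read-spec [] t i< inv t≤ = refl
  read-spec (u ∷ a) {v} {i} {x} t i< inv t≤ =
    trans (cong (λ c → read a (enc codec (updateConfig u c))) (dec-enc codec {v , i , x , map t (queries (pass v i x))} (fit-config {v} {i} {x} t i< inv t≤)))
    (trans (cong (λ cs → read a (enc codec (v , i , x , cs))) (zipWith-map (bump u) t (queries (pass v i x))))
      (read-spec a {v} {i} {x} (λ w → bump u w (t w)) i< inv (λ w → bump-≤ u w (t w) (t≤ w))))

  module _ (a : List (Update n)) (𝒞 : List (Subset n)) (defines : Defines a 𝒞) (len : length 𝒞 ≤ m) where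

    bumps-≤ : ∀ w → bumps a (λ _ → 0) w ≤ m
    bumps-≤ w = subst (_≤ m) (sym (bumps-counts a 𝒞 defines len w)) (ℕ.≤-trans (count≤length w 𝒞) len)

    runPasses-spec : ∀ p v i x → i + p < 2 ^ P → Inv x →
      Σ[ s ∈ Vec Bool (bits codec) ] runPasses p a (enc codec (start v i x)) ≡ return s ×
        outConfig (dec codec s) ≡ out v (iterate 𝒞 (pass v) i p x)
    runPasses-spec zero v i x i< inv = _ , refl ,
      cong outConfig (dec-enc codec {start v i x} (fit-config {v} {i} {x} (λ _ → 0) (subst (_< 2 ^ P) (ℕ.+-identityʳ i) i<) inv (λ _ → z≤n)))
    runPasses-spec (suc p) v i x i< inv = proj₁ rest , trans onePass (proj₁ (proj₂ rest)) , proj₂ (proj₂ rest)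
      where
      i<′ : i < 2 ^ P
      i<′ = ℕ.≤-<-trans (ℕ.m≤m+n i (suc p)) i<
      rest = runPasses-spec p v (suc i) (eval (pass v i x) 𝒞) (subst (_< 2 ^ P) (ℕ.+-suc i p) i<) (inv-pass v i x _ inv)
      onePass : runPasses (suc p) a (enc codec (start v i x)) ≡ runPasses p a (enc codec (start v (suc i) (eval (pass v i x) 𝒞)))
      onePass rewrite read-spec a {v} {i} {x} (λ _ → 0) i<′ inv (λ _ → z≤n) =
        cong (runPasses p a ∘ enc codec) (trans (cong endConfig (dec-enc codec {v , i , x , map (bumps a (λ _ → 0)) (queries (pass v i x))} (fit-config {v} {i} {x} (bumps a (λ _ → 0)) i<′ inv bumps-≤)))
          (cong (λ cs → start v (suc i) (decode (pass v i x) cs)) (List.map-cong (bumps-counts a 𝒞 defines len) (queries (pass v i x)))))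

    run-spec : ∀ (f : O → ℚ) → E (f ∘ outConfig ∘ dec codec) (run a) ≡ E (λ v → f (out v (iterate 𝒞 (pass v) 0 P x₀))) (uniform ρ)
    run-spec f = trans (E->>= (f ∘ outConfig ∘ dec codec) (uniform ρ >>= _) (runPasses P a))
      (trans (E->>= (λ s → E (f ∘ outConfig ∘ dec codec) (runPasses P a s)) (uniform ρ) _) (E-cong (uniform ρ) pointwise))
      where
      pointwise : ∀ v → E (f ∘ outConfig ∘ dec codec) (runPasses P a (enc codec (start v 0 x₀))) ≡ f (out v (iterate 𝒞 (pass v) 0 P x₀))
      pointwise v with runPasses-spec P v 0 x₀ (n<2^n P) inv₀
      ... | s , eq , o = trans (cong (E (f ∘ outConfig ∘ dec codec)) eq) (cong f o)

-- Set sizes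

∪-─-⊆ : ∀ {n} {C₀ C : Subset n} S → C₀ Sub.⊆ C → C ∪ (S ─ C₀) ≡ C ∪ S
∪-─-⊆ {C₀ = []} {[]} [] C₀⊆C = refl
∪-─-⊆ {C₀ = false ∷ C₀} {c ∷ C} (s ∷ S) C₀⊆C = cong (_ ∷_) (∪-─-⊆ S (Sub.drop-∷-⊆ C₀⊆C))
∪-─-⊆ {C₀ = true ∷ C₀} {true ∷ C} (s ∷ S) C₀⊆C = cong (_ ∷_) (∪-─-⊆ S (Sub.drop-∷-⊆ C₀⊆C))
∪-─-⊆ {C₀ = true ∷ C₀} {false ∷ C} (s ∷ S) C₀⊆C = case C₀⊆C Vec.here of λ ()

─-─-⊆ : ∀ {n} {C₀ C : Subset n} S → C₀ Sub.⊆ C → S ─ C₀ ─ C ≡ S ─ C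
─-─-⊆ {C₀ = C₀} {C} S C₀⊆C = trans (Sub.p─q─r≡p─q∪r S C₀ C)
  (cong (S ─_) (Sub.⊆-antisym (λ x∈ → case Sub.x∈p∪q⁻ C₀ C x∈ of λ { (inj₁ x∈C₀) → C₀⊆C x∈C₀ ; (inj₂ x∈C) → x∈C })
                              (Sub.q⊆p∪q C₀ C)))

∣∪∣ : ∀ {n} (C S : Subset n) → ∣ C ∪ S ∣ ≡ ∣ C ∣ + ∣ S ─ C ∣
∣∪∣ [] [] = refl
∣∪∣ (true ∷ C) (true ∷ S) = cong suc (∣∪∣ C S)
∣∪∣ (true ∷ C) (false ∷ S) = cong suc (∣∪∣ C S)
∣∪∣ (false ∷ C) (true ∷ S) = trans (cong suc (∣∪∣ C S)) (sym (ℕ.+-suc ∣ C ∣ ∣ S ─ C ∣))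
∣∪∣ (false ∷ C) (false ∷ S) = ∣∪∣ C S

∣─∣-antitone : ∀ {n} {C C′ : Subset n} S → C Sub.⊆ C′ → ∣ S ─ C′ ∣ ≤ ∣ S ─ C ∣
∣─∣-antitone {C = []} {[]} [] C⊆ = z≤n
∣─∣-antitone {C = true ∷ C} {true ∷ C′} (s ∷ S) C⊆ = ∣─∣-antitone S (Sub.drop-∷-⊆ C⊆)
∣─∣-antitone {C = true ∷ C} {false ∷ C′} (s ∷ S) C⊆ = case C⊆ Vec.here of λ ()
∣─∣-antitone {C = false ∷ C} {false ∷ C′} (true ∷ S) C⊆ = s≤s (∣─∣-antitone S (Sub.drop-∷-⊆ C⊆))
∣─∣-antitone {C = false ∷ C} {false ∷ C′} (false ∷ S) C⊆ = ∣─∣-antitone S (Sub.drop-∷-⊆ C⊆)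
∣─∣-antitone {C = false ∷ C} {true ∷ C′} (true ∷ S) C⊆ = ℕ.m≤n⇒m≤1+n (∣─∣-antitone S (Sub.drop-∷-⊆ C⊆))
∣─∣-antitone {C = false ∷ C} {true ∷ C′} (false ∷ S) C⊆ = ∣─∣-antitone S (Sub.drop-∷-⊆ C⊆)

sparse : ∀ n → ℕ → List (Subset n)
sparse zero t = [] ∷ []
sparse (suc n) zero = map (false ∷_) (sparse n zero)
sparse (suc n) (suc t) = map (false ∷_) (sparse n (suc t)) ++ map (true ∷_) (sparse n t)

∈-sparse : ∀ {n t} (T : Subset n) → ∣ T ∣ ≤ t → T ∈ sparse n t
∈-sparse [] _ = here refl
∈-sparse {t = zero} (false ∷ T) h = Mem.∈-map⁺ (false ∷_) (∈-sparse T h)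
∈-sparse {t = suc t} (false ∷ T) h = Mem.∈-++⁺ˡ (Mem.∈-map⁺ (false ∷_) (∈-sparse T h))
∈-sparse {t = suc t} (true ∷ T) (s≤s h) = Mem.∈-++⁺ʳ (map (false ∷_) (sparse _ (suc t))) (Mem.∈-map⁺ (true ∷_) (∈-sparse T h))

length-sparse : ∀ n t → length (sparse n t) ≤ suc n ^ t
length-sparse zero t = ℕ.≤-reflexive (sym (ℕ.^-zeroˡ t))
length-sparse (suc n) zero = ℕ.≤-trans (ℕ.≤-reflexive (List.length-map (false ∷_) (sparse n zero))) (length-sparse n zero)
length-sparse (suc n) (suc t) = begin
  length (sparse (suc n) (suc t)) ≡⟨ List.length-++ (map (false ∷_) (sparse n (suc t))) ⟩
  length (map (false ∷_) (sparse n (suc t))) + length (map (true ∷_) (sparse n t))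
    ≡⟨ cong₂ _+_ (List.length-map (false ∷_) (sparse n (suc t))) (List.length-map (true ∷_) (sparse n t)) ⟩
  length (sparse n (suc t)) + length (sparse n t) ≤⟨ ℕ.+-mono-≤ (length-sparse n (suc t)) (length-sparse n t) ⟩
  suc n * suc n ^ t + suc n ^ t ≡⟨ lemma (suc n) (suc n ^ t) ⟩
  suc (suc n) * suc n ^ t ≤⟨ ℕ.*-monoʳ-≤ (suc (suc n)) (ℕ.^-monoˡ-≤ t (ℕ.n≤1+n (suc n))) ⟩
  suc (suc n) * suc (suc n) ^ t ∎
  where
  open ℕ.≤-Reasoning
  lemma : ∀ a b → a * b + b ≡ (1 + a) * b
  lemma = solve-∀

allVecs : ∀ w → List (Vec Bool w)
allVecs zero = [] ∷ []
allVecs (suc w) = map (true ∷_) (allVecs w) ++ map (false ∷_) (allVecs w)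

∈-allVecs : ∀ {w} (v : Vec Bool w) → v ∈ allVecs w
∈-allVecs [] = here refl
∈-allVecs (true ∷ v) = Mem.∈-++⁺ˡ (Mem.∈-map⁺ (true ∷_) (∈-allVecs v))
∈-allVecs (false ∷ v) = Mem.∈-++⁺ʳ (map (true ∷_) (allVecs _)) (Mem.∈-map⁺ (false ∷_) (∈-allVecs v))

length-allVecs : ∀ w → length (allVecs w) ≡ 2 ^ w
length-allVecs zero = refl
length-allVecs (suc w) = trans (List.length-++ (map (true ∷_) (allVecs w)))
  (cong₂ _+_ (trans (List.length-map (true ∷_) (allVecs w)) (length-allVecs w))
    (trans (List.length-map (false ∷_) (allVecs w)) (trans (length-allVecs w) (sym (ℕ.+-identityʳ (2 ^ w))))))

length-cartesianProductWith : ∀ {A B C : Set} (f : A → B → C) xs ys → length (List.cartesianProductWith f xs ys) ≡ length xs * length ys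
length-cartesianProductWith f [] ys = refl
length-cartesianProductWith f (x ∷ xs) ys = trans (List.length-++ (map (f x) ys))
  (cong₂ _+_ (List.length-map (f x) ys) (length-cartesianProductWith f xs ys))

length-cartesianProduct : ∀ {A B : Set} (xs : List A) (ys : List B) → length (List.cartesianProduct xs ys) ≡ length xs * length ys
length-cartesianProduct = length-cartesianProductWith _,_

count-cong : ∀ {A : Set} {f g : A → Bool} xs → (∀ x → x ∈ xs → f x ≡ g x) → count f xs ≡ count g xs
count-cong [] h = refl
count-cong (x ∷ xs) h = cong₂ (λ b k → toℕ b + k) (h x (here refl)) (count-cong xs (λ y → h y ∘ there))

count-const-∧ : ∀ {A : Set} (f : A → Bool) b xs → count (λ x → f x ∧ b) xs ≡ (if b then count f xs else 0)
count-const-∧ f true xs = count-cong xs (λ x _ → Bool.∧-identityʳ (f x))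
count-const-∧ f false [] = refl
count-const-∧ f false (x ∷ xs) = cong₂ (λ b k → toℕ b + k) (Bool.∧-zeroʳ (f x)) (count-const-∧ f false xs)

⟶true : ∀ {b} → T b → b ≡ true
⟶true {true} _ = refl

module Sampling {n} (w m cap : ℕ) (name : Subset n → Vec Bool w) where

  State : Set
  State = Subset n × List (Vec Bool w)

  InClass : ℕ → Subset n → Subset n → Set
  InClass θ C₀ S = θ ≤ ∣ S ─ C₀ ∣ × ∣ S ─ C₀ ∣ < 2 * θ

  inClass? : ∀ θ C₀ S → Dec (InClass θ C₀ S)
  inClass? θ C₀ S = (θ ℕ.≤? ∣ S ─ C₀ ∣) ×-dec (∣ S ─ C₀ ∣ ℕ.<? 2 * θ)

  item : Subset n → Subset n → Subset (w + n)
  item C₀ S = name S Vec.++ (S ─ C₀)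

  Candidate : Set
  Candidate = ℕ × Vec Bool w × Subset n

  grow : ℕ → Candidate → State → State
  grow θ (_ , ν , R) (C , L) with (θ ℕ.≤? ∣ R ─ C ∣) ×-dec (length L ℕ.<? cap)
  ... | yes _ = C ∪ R , ν ∷ L
  ... | no _ = C , L

  data Grows (θ : ℕ) : State → State → Set where
    unchanged : ∀ {σ} → Grows θ σ σ
    grown : ∀ {C L} R ν → θ ≤ ∣ R ─ C ∣ → length L < cap → Grows θ (C , L) (C ∪ R , ν ∷ L)

  grow-grows : ∀ θ c σ → Grows θ σ (grow θ c σ)
  grow-grows θ (_ , ν , R) (C , L) with (θ ℕ.≤? ∣ R ─ C ∣) ×-dec (length L ℕ.<? cap)
  ... | yes (θ≤ , len<) = grown R ν θ≤ len<
  ... | no _ = unchanged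

  grow-yes : ∀ {θ μ ν R C L} → θ ≤ ∣ R ─ C ∣ → length L < cap → grow θ (μ , ν , R) (C , L) ≡ (C ∪ R , ν ∷ L)
  grow-yes {θ} {μ} {ν} {R} {C} {L} θ≤ len< with (θ ℕ.≤? ∣ R ─ C ∣) ×-dec (length L ℕ.<? cap)
  ... | yes _ = refl
  ... | no ¬p = contradiction (θ≤ , len<) ¬p

  Grows-⊆ : ∀ {θ σ σ′} → Grows θ σ σ′ → proj₁ σ Sub.⊆ proj₁ σ′
  Grows-⊆ unchanged x∈ = x∈
  Grows-⊆ (grown {C} R ν _ _) x∈ = Sub.p⊆p∪q R x∈

  candidates : ℕ → List Candidate
  candidates θ = List.cartesianProduct (map suc (List.upTo m)) (List.cartesianProduct (allVecs w) (sparse n (2 * θ ⊓ n)))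

  length-candidates : ∀ θ → length (candidates θ) ≤ m * (2 ^ w * suc n ^ (2 * θ ⊓ n))
  length-candidates θ = begin
    length (candidates θ) ≡⟨ length-cartesianProduct (map suc (List.upTo m)) _ ⟩
    length (map suc (List.upTo m)) * length (List.cartesianProduct (allVecs w) (sparse n t))
      ≡⟨ cong₂ _*_ (trans (List.length-map suc (List.upTo m)) (List.length-upTo m))
           (trans (length-cartesianProduct (allVecs w) (sparse n t)) (cong (_* length (sparse n t)) (length-allVecs w))) ⟩
    m * (2 ^ w * length (sparse n t)) ≤⟨ ℕ.*-monoʳ-≤ m (ℕ.*-monoʳ-≤ (2 ^ w) (length-sparse n t)) ⟩
    m * (2 ^ w * suc n ^ t) ∎
    where
    open ℕ.≤-Reasoning
    t = 2 * θ ⊓ n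

  ∈-candidates : ∀ {θ μ ν R} → μ < m → ∣ R ∣ < 2 * θ → (suc μ , ν , R) ∈ candidates θ
  ∈-candidates {ν = ν} {R} μ< R< = Mem.∈-cartesianProduct⁺ (Mem.∈-map⁺ suc (Mem.∈-upTo⁺ μ<))
    (Mem.∈-cartesianProduct⁺ (∈-allVecs ν) (∈-sparse R (ℕ.⊓-glb (ℕ.<⇒≤ R<) (Sub.∣p∣≤n R))))

  candidate-positive : ∀ {θ μ ν R} → (μ , ν , R) ∈ candidates θ → 0 < μ
  candidate-positive {θ} c∈ with Mem.∈-map⁻ suc (proj₁ (Mem.∈-cartesianProduct⁻ (map suc (List.upTo m)) _ c∈))
  ... | _ , _ , refl = s≤s z≤n

  data Pick (𝒞 : List (Subset n)) (τ : ℕ) : State → State → Set where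
    pick : ∀ {C L} S → S ∈ 𝒞 → τ ≤ ∣ S ─ C ∣ → length L < cap → Pick 𝒞 τ (C , L) (C ∪ S , name S ∷ L)

  module Sampler (θ lev r : ℕ) where

    Seed : Set
    Seed = Vec (Table n) lev × Vec (Table (w + n)) r

    drawSeed : Rand Seed
    drawSeed = drawVec (randomTable n) lev >>= λ fs → drawVec (randomTable (w + n)) r >>= λ φs → return (fs , φs)

    module _ (C₀ : Subset n) where

      Active : Vec (Table n) lev → Subset n → Set
      Active fs S = InClass θ C₀ S × T (S inAll fs)

      abstract
        active? : ∀ fs S → Dec (Active fs S)
        active? fs S = inClass? θ C₀ S ×-dec Bool.T? (S inAll fs)

      query : Vec (Table n) lev → Table (w + n) → Subset n → Bool
      query fs φ S = does (active? fs S) ∧ (φ at item C₀ S)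

      expected : Candidate → Table (w + n) → ℕ
      expected (μ , ν , R) φ = if φ at (ν Vec.++ R) then μ else 0

      Matches : Vec (Table (w + n)) r → List ℕ → Candidate → Set
      Matches φs cs c = cs ≡ map (expected c) (Vec.toList φs)

      matching? : ∀ φs cs → Dec (Any (Matches φs cs) (candidates θ))
      matching? φs cs = Any.any? (λ c → List.≡-dec ℕ._≟_ cs (map (expected c) (Vec.toList φs))) (candidates θ)

      respond : Vec (Table (w + n)) r → List ℕ → State → State
      respond φs cs σ with matching? φs cs
      ... | yes match = grow θ (Any.lookup match) σ
      ... | no _ = σ

      respond-grows : ∀ φs cs σ → Grows θ σ (respond φs cs σ)
      respond-grows φs cs σ with matching? φs cs
      ... | yes match = grow-grows θ (Any.lookup match) σ
      ... | no _ = unchanged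

      sampler : Seed → Sketch n (State → State)
      sampler (fs , φs) = record { queries = map (query fs) (Vec.toList φs) ; decode = respond φs }

      size-sampler : ∀ s → size (sampler s) ≡ r
      size-sampler (fs , φs) = trans (List.length-map (query fs) (Vec.toList φs)) (Vec.length-toList φs)

      module _ (𝒞 : List (Subset n)) where

        Present : Vec (Table n) lev → Vec Bool w → Subset n → Set
        Present fs ν R = Any (λ S → Active fs S × item C₀ S ≡ ν Vec.++ R) 𝒞

        present? : ∀ fs ν R → Dec (Present fs ν R)
        present? fs ν R = Any.any? (λ S → active? fs S ×-dec Vec.≡-dec Bool._≟_ (item C₀ S) (ν Vec.++ R)) 𝒞

        answers : Vec (Table n) lev → Vec (Table (w + n)) r → List ℕ
        answers fs φs = map (λ φ → count (query fs φ) 𝒞) (Vec.toList φs)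

        Faithful : Seed → Set
        Faithful (fs , φs) = ∀ c → c ∈ candidates θ →
          ¬ Present fs (proj₁ (proj₂ c)) (proj₂ (proj₂ c)) → ¬ Matches φs (answers fs φs) c

        fail-candidate : ∀ fs {μ ν R} → 0 < μ → ¬ Present fs ν R →
          Fail (drawVec (randomTable (w + n)) r) (λ φs → ¬ Matches φs (answers fs φs) (μ , ν , R)) (½^ r)
        fail-candidate fs {μ} {ν} {R} 0<μ ¬present =
          fail-tables (ν Vec.++ R) (λ φ → count (query fs φ) 𝒞) (expected (μ , ν , R)) differ r
          where
          z = ν Vec.++ R
          irrelevant : ∀ φ → count (query fs (set z true φ)) 𝒞 ≡ count (query fs (set z false φ)) 𝒞
          irrelevant φ = count-cong 𝒞 pointwise
            where
            pointwise : ∀ S → S ∈ 𝒞 → query fs (set z true φ) S ≡ query fs (set z false φ) S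
            pointwise S S∈ with active? fs S
            ... | no _ = refl
            ... | yes active = trans (set-at-≢ true φ z≢) (sym (set-at-≢ false φ z≢))
              where
              z≢ : z ≢ item C₀ S
              z≢ eq = ¬present (Mem.lose S∈ (active , sym eq))
          differ : ∀ φ → count (query fs (set z true φ)) 𝒞 ≡ expected (μ , ν , R) (set z true φ) →
            count (query fs (set z false φ)) 𝒞 ≢ expected (μ , ν , R) (set z false φ)
          differ φ eq₁ eq₀ rewrite set-at z true φ | set-at z false φ =
            ℕ.<-irrefl (trans (sym eq₀) (trans (sym (irrelevant φ)) eq₁)) 0<μ

        fail-faithful : ∀ a {e} → length (candidates θ) ≤ 2 ^ e → r ≡ e + a → Fail drawSeed Faithful (½^ a)
        fail-faithful a {e} len≤ refl = fail-weaken drawSeed (λ _ h → h) (ℚ.≤-reflexive (ℚ.+-identityˡ (½^ a)))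
          (fail-bind (drawVec (randomTable n) lev) _ (fail-sure {P = λ _ → ⊤} _ ℚ.≤-refl (λ _ → tt)) (0≤½^ a) (λ fs _ →
            fail-map (drawVec (randomTable (w + n)) r) (fs ,_) (fail-weaken _ (λ _ h → h) bound
              (fail-∀∈ (drawVec (randomTable (w + n)) r) (candidates θ) (one fs)))))
          where
          bound : fromℕ (length (candidates θ)) ℚ.* ½^ r ℚ.≤ ½^ a
          bound = subst (λ p → fromℕ (length (candidates θ)) ℚ.* p ℚ.≤ ½^ a) (sym (½^-+ e a)) (*½^-≤ {length (candidates θ)} {e} (½^ a) (0≤½^ a) len≤)
          one : ∀ fs c → c ∈ candidates θ → Fail (drawVec (randomTable (w + n)) r)
            (λ φs → ¬ Present fs (proj₁ (proj₂ c)) (proj₂ (proj₂ c)) → ¬ Matches φs (answers fs φs) c) (½^ r)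
          one fs (μ , ν , R) c∈ with present? fs ν R
          ... | yes present = fail-sure _ (0≤½^ r) (λ φs ¬present → contradiction present ¬present)
          ... | no ¬present = fail-weaken {P = λ φs → ¬ Matches φs (answers fs φs) (μ , ν , R)} _ (λ φs h _ → h) ℚ.≤-refl (fail-candidate fs {μ} {ν} {R} (candidate-positive {θ} c∈) ¬present)

        eval-sampler : ∀ fs φs σ → eval (sampler (fs , φs)) 𝒞 σ ≡ respond φs (answers fs φs) σ
        eval-sampler fs φs σ = cong (λ cs → respond φs cs σ) (sym (List.map-∘ (Vec.toList φs)))

        eval-grows : ∀ s σ → Grows θ σ (eval (sampler s) 𝒞 σ)
        eval-grows (fs , φs) σ = respond-grows φs _ σ

        faithful-step : ∀ s {C L} → Faithful s → C₀ Sub.⊆ C →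
          eval (sampler s) 𝒞 (C , L) ≡ (C , L) ⊎ Pick 𝒞 θ (C , L) (eval (sampler s) 𝒞 (C , L))
        faithful-step (fs , φs) {C} {L} faithful C₀⊆C rewrite eval-sampler fs φs (C , L) with matching? φs (answers fs φs)
        ... | no _ = inj₁ refl
        ... | yes match = found (Any.lookup match) (Mem.∈-lookup (Any.index match)) (AnyP.lookup-result match)
          where
          found : ∀ c → c ∈ candidates θ → Matches φs (answers fs φs) c → grow θ c (C , L) ≡ (C , L) ⊎ Pick 𝒞 θ (C , L) (grow θ c (C , L))
          found (μ , ν , R) c∈ matches with present? fs ν R
          ... | no ¬present = contradiction matches (faithful (μ , ν , R) c∈ ¬present)
          ... | yes present with Mem.find present
          ... | S , S∈ , _ , eq with Vec.++-injective (name S) ν eq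
          ... | refl , refl with (θ ℕ.≤? ∣ S ─ C₀ ─ C ∣) ×-dec (length L ℕ.<? cap)
          ... | no _ = inj₁ refl
          ... | yes (θ≤ , len<) = inj₂ (subst (λ C′ → Pick 𝒞 θ (C , L) (C′ , name S ∷ L)) (sym (∪-─-⊆ S C₀⊆C))
                (pick S S∈ (subst (λ R → θ ≤ ∣ R ∣) (─-─-⊆ S C₀⊆C) θ≤) len<))

        Isolated : Vec (Table n) lev → Subset n → Set
        Isolated fs S = Active fs S × S ∈ 𝒞 × (∀ {S′} → S′ ∈ 𝒞 → Active fs S′ → S′ ≡ S)

        answers-isolated : ∀ {fs S} φs → Isolated fs S →
          Matches φs (answers fs φs) (count (does ∘ active? fs) 𝒞 , name S , S ─ C₀)
        answers-isolated {fs} {S} φs (_ , _ , only) = List.map-cong pointwise (Vec.toList φs)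
          where
          pointwise : ∀ φ → count (query fs φ) 𝒞 ≡ (if φ at item C₀ S then count (does ∘ active? fs) 𝒞 else 0)
          pointwise φ = trans (count-cong 𝒞 same) (count-const-∧ (does ∘ active? fs) (φ at item C₀ S) 𝒞)
            where
            same : ∀ S′ → S′ ∈ 𝒞 → query fs φ S′ ≡ does (active? fs S′) ∧ (φ at item C₀ S)
            same S′ S′∈ with active? fs S′
            ... | no _ = refl
            ... | yes active = cong (λ X → φ at item C₀ X) (only S′∈ active)

        isolated-grows : ∀ fs φs {C L S} → length 𝒞 ≤ m → Faithful (fs , φs) → C₀ Sub.⊆ C → Isolated fs S → θ ≤ ∣ S ─ C ∣ → length L < cap →
          eval (sampler (fs , φs)) 𝒞 (C , L) ≢ (C , L)
        isolated-grows fs φs {C} {L} {S} len≤ faithful C₀⊆C isolated@(active , S∈ , only) θ≤ len< eq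
          rewrite eval-sampler fs φs (C , L) with matching? φs (answers fs φs)
        ... | no ¬match = ¬match (Mem.lose (own (count (does ∘ active? fs) 𝒞) positive (ℕ.≤-trans (count≤length _ 𝒞) len≤)) (answers-isolated φs isolated))
          where
          positive : 0 < count (does ∘ active? fs) 𝒞
          positive = count-positive S∈ (Dec.dec-true (active? fs S) active)
            where
            count-positive : ∀ {f : Subset n → Bool} {xs S} → S ∈ xs → f S ≡ true → 0 < count f xs
            count-positive {f} (here refl) t rewrite t = s≤s z≤n
            count-positive {f} {x ∷ xs} (there S∈) t = ℕ.≤-trans (count-positive S∈ t) (ℕ.m≤n+m _ (toℕ (f x)))
          own : ∀ μ → 0 < μ → μ ≤ m → (μ , name S , S ─ C₀) ∈ candidates θ
          own (suc μ) _ μ< = ∈-candidates {θ} μ< (proj₂ (proj₁ active))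
        ... | yes match = found (Any.lookup match) (Mem.∈-lookup (Any.index match)) (AnyP.lookup-result match) eq
          where
          found : ∀ c → c ∈ candidates θ → Matches φs (answers fs φs) c → grow θ c (C , L) ≢ (C , L)
          found (μ , ν , R) c∈ matches with present? fs ν R
          ... | no ¬present = contradiction matches (faithful (μ , ν , R) c∈ ¬present)
          ... | yes present with Mem.find present
          ... | S′ , S′∈ , active′ , eq′ with only S′∈ active′
          ... | refl with Vec.++-injective (name S) ν eq′
          ... | refl , refl = λ eq″ → case trans (sym (grow-yes {θ} {μ} (subst (λ R → θ ≤ ∣ R ∣) (sym (─-─-⊆ S C₀⊆C)) θ≤) len<)) eq″ of longer
            where
            longer : ∀ {ν : Vec Bool w} {L} {C C′ : Subset n} → _≡_ {A = State} (C′ , ν ∷ L) (C , L) → ⊥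
            longer eq = ℕ.1+n≢n (cong (length ∘ proj₂) eq)

length-filter-⊆ : ∀ {A : Set} {P Q : A → Set} (P? : ∀ x → Dec (P x)) (Q? : ∀ x → Dec (Q x)) xs →
  (∀ {x} → P x → Q x) → length (filter P? xs) ≤ length (filter Q? xs)
length-filter-⊆ P? Q? [] P⇒Q = z≤n
length-filter-⊆ P? Q? (x ∷ xs) P⇒Q with P? x | Q? x
... | yes p | yes q = s≤s (length-filter-⊆ P? Q? xs P⇒Q)
... | yes p | no ¬q = contradiction (P⇒Q p) ¬q
... | no ¬p | yes q = ℕ.m≤n⇒m≤1+n (length-filter-⊆ P? Q? xs P⇒Q)
... | no ¬p | no ¬q = length-filter-⊆ P? Q? xs P⇒Q

count-filter-⊆ : ∀ {A : Set} {P Q : A → Set} (P? : ∀ x → Dec (P x)) (Q? : ∀ x → Dec (Q x)) (f : A → Bool) xs →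
  (∀ {x} → P x → Q x) → count f (filter P? xs) ≤ count f (filter Q? xs)
count-filter-⊆ P? Q? f [] P⇒Q = z≤n
count-filter-⊆ P? Q? f (x ∷ xs) P⇒Q with P? x | Q? x
... | yes p | yes q = ℕ.+-monoʳ-≤ (toℕ (f x)) (count-filter-⊆ P? Q? f xs P⇒Q)
... | yes p | no ¬q = contradiction (P⇒Q p) ¬q
... | no ¬p | yes q = ℕ.≤-trans (count-filter-⊆ P? Q? f xs P⇒Q) (ℕ.m≤n+m _ (toℕ (f x)))
... | no ¬p | no ¬q = count-filter-⊆ P? Q? f xs P⇒Q

0<count⇒∃ : ∀ {A : Set} {f : A → Bool} {xs} → 0 < count f xs → ∃[ x ] x ∈ xs × T (f x)
0<count⇒∃ {f = f} {x ∷ xs} h with f x in eq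
... | true = x , here refl , subst T (sym eq) tt
... | false with 0<count⇒∃ {xs = xs} h
... | y , y∈ , fy = y , there y∈ , fy

∈⇒0<count : ∀ {A : Set} {f : A → Bool} {x xs} → x ∈ xs → T (f x) → 0 < count f xs
∈⇒0<count {f = f} {x} (here refl) fx rewrite ⟶true fx = s≤s z≤n
∈⇒0<count {f = f} {xs = y ∷ xs} (there x∈) fx = ℕ.≤-trans (∈⇒0<count x∈ fx) (ℕ.m≤n+m _ (toℕ (f y)))

count≤1⇒≡ : ∀ {A : Set} {f : A → Bool} {x y xs} → Unique xs → count f xs ≤ 1 → x ∈ xs → T (f x) → y ∈ xs → T (f y) → x ≡ y
count≤1⇒≡ u h (here refl) fx (here refl) fy = refl
count≤1⇒≡ {f = f} u h (here refl) fx (there y∈) fy rewrite ⟶true fx =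
  contradiction (∈⇒0<count y∈ fy) (ℕ.≤⇒≯ (ℕ.s≤s⁻¹ h))
count≤1⇒≡ {f = f} u h (there x∈) fx (here refl) fy rewrite ⟶true fy =
  contradiction (∈⇒0<count x∈ fx) (ℕ.≤⇒≯ (ℕ.s≤s⁻¹ h))
count≤1⇒≡ {f = f} {xs = z ∷ xs} (_ ∷ u) h (there x∈) fx (there y∈) fy =
  count≤1⇒≡ u (ℕ.≤-trans (ℕ.m≤n+m _ (toℕ (f z))) h) x∈ fx y∈ fy

sumℚ-𝟙 : ∀ {A : Set} (f : A → Bool) xs → sumℚ (𝟙 ∘ f) xs ≡ fromℕ (count f xs)
sumℚ-𝟙 f [] = refl
sumℚ-𝟙 f (x ∷ xs) with f x
... | true = trans (cong (1ℚ ℚ.+_) (sumℚ-𝟙 f xs)) (sym (fromℕ-suc (count f xs)))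
... | false = trans (ℚ.+-identityˡ _) (sumℚ-𝟙 f xs)

sumℚ-unique : ∀ {A : Set} {f : A → ℚ} {a b} x xs → Unique xs → 0ℚ ℚ.≤ a → f x ℚ.≤ a ℚ.+ b →
  (∀ y → x ≢ y → f y ℚ.≤ b) → (∀ y → Dec (x ≡ y)) → sumℚ f xs ℚ.≤ a ℚ.+ fromℕ (length xs) ℚ.* b
sumℚ-unique {f = f} {a} {b} x xs unique 0≤a fx≤ f≤ x≟ = go xs unique
  where
  without : ∀ ys → All (x ≢_) ys → sumℚ f ys ℚ.≤ fromℕ (length ys) ℚ.* b
  without [] [] = ℚ.≤-reflexive (sym (ℚ.*-zeroˡ b))
  without (y ∷ ys) (x≢y ∷ x≢) = ℚ.≤-trans (ℚ.+-mono-≤ (f≤ y x≢y) (without ys x≢)) (ℚ.≤-reflexive (sym (fromℕ-suc-* (length ys) b)))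
  go : ∀ ys → Unique ys → sumℚ f ys ℚ.≤ a ℚ.+ fromℕ (length ys) ℚ.* b
  go [] [] = ≤-by-slack a 0≤a (trans (cong (a ℚ.+_) (ℚ.*-zeroˡ b)) (ℚ.+-comm a 0ℚ))
  go (y ∷ ys) (y≢ ∷ u) with x≟ y
  ... | yes refl = ℚ.≤-trans (ℚ.+-mono-≤ fx≤ (without ys y≢))
    (ℚ.≤-reflexive (trans (ℚ.+-assoc a b _) (cong (a ℚ.+_) (sym (fromℕ-suc-* (length ys) b)))))
  ... | no x≢y = ℚ.≤-trans (ℚ.+-mono-≤ (f≤ y x≢y) (go ys u))
    (ℚ.≤-reflexive (trans (lemma a b (fromℕ (length ys) ℚ.* b)) (cong (a ℚ.+_) (sym (fromℕ-suc-* (length ys) b)))))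
    where
    lemma : ∀ a b c → b ℚ.+ (a ℚ.+ c) ≡ a ℚ.+ (b ℚ.+ c)
    lemma = Ring.solve-∀ ℚ-ring

*½^≤ : ∀ {k r} → k ≤ 2 ^ r → fromℕ k ℚ.* ½^ r ℚ.≤ 1ℚ
*½^≤ {k} {r} k≤ = subst (λ p → fromℕ k ℚ.* p ℚ.≤ 1ℚ) (ℚ.*-identityʳ (½^ r)) (*½^-≤ {k} {r} 1ℚ 0≤1ℚ k≤)

≤*½^ : ∀ {k r} → 2 ^ r ≤ k → 1ℚ ℚ.≤ fromℕ k ℚ.* ½^ r
≤*½^ {k} {r} ≤k = subst (ℚ._≤ fromℕ k ℚ.* ½^ r) (trans (ℚ.*-comm (fromℕ (2 ^ r)) (½^ r)) (½^*2^ r))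
  (ℚ.*-monoʳ-≤-nonNeg (½^ r) {{ℚ.nonNegative (0≤½^ r)}} (fromℕ-mono ≤k))

31/32 : ℚ
31/32 = + 31 ℚ./ 32

-- With X and Y the numbers of sets of V and of U that are kept by the random filter, the filter
-- isolates a set of U if X = Y = 1, and Y (2 - X) ≤ 0 if it does not.
fail-isolate : ∀ {n} (U V : List (Subset n)) → Unique V → (∀ {S} → S ∈ U → S ∈ V) → (∀ f → count f U ≤ count f V) →
  ∀ lev → 2 * length V ≤ 2 ^ lev → 2 ^ lev ≤ 4 * length V → length V ≤ 4 * length U →
  Fail (drawVec (randomTable n) lev)
    (λ fs → ∃[ S ] S ∈ U × T (S inAll fs) × (∀ {S′} → S′ ∈ V → T (S′ inAll fs) → S′ ≡ S)) 31/32
fail-isolate {n} U V unique U⊆V cU≤cV lev 2N≤ ≤4N N≤4u = fail-weaken Z (λ _ h → h) Ec≤ (fail-E Z c 0≤c isolates)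
  where
  Z = drawVec (randomTable n) lev
  p = ½^ lev
  x y : Vec (Table n) lev → ℕ
  x fs = count (_inAll fs) V
  y fs = count (_inAll fs) U
  X Y c : Vec (Table n) lev → ℚ
  X fs = sumℚ (λ S → 𝟙 (S inAll fs)) V
  Y fs = sumℚ (λ S → 𝟙 (S inAll fs)) U
  c fs = (1ℚ ℚ.+ sumℚ (λ S → sumℚ (λ S′ → 𝟙 (S inAll fs) ℚ.* 𝟙 (S′ inAll fs)) V) U) ℚ.+ (ℚ.- 1ℚ) ℚ.* (Y fs ℚ.+ Y fs)
  c≡ : ∀ fs → c fs ≡ fromℕ (1 + y fs * x fs) ℚ.- fromℕ (y fs + y fs)
  c≡ fs = trans (cong₂ (λ a b → (1ℚ ℚ.+ a) ℚ.+ (ℚ.- 1ℚ) ℚ.* (b ℚ.+ b)) product (sumℚ-𝟙 (_inAll fs) U)) (trans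
    (lemma (fromℕ (y fs)) (fromℕ (x fs)))
    (cong₂ ℚ._-_ (sym (trans (fromℕ-suc (y fs * x fs)) (cong (1ℚ ℚ.+_) (fromℕ-* (y fs) (x fs))))) (sym (fromℕ-+ (y fs) (y fs)))))
    where
    lemma : ∀ a b → (1ℚ ℚ.+ a ℚ.* b) ℚ.+ (ℚ.- 1ℚ) ℚ.* (a ℚ.+ a) ≡ (1ℚ ℚ.+ a ℚ.* b) ℚ.- (a ℚ.+ a)
    lemma = Ring.solve-∀ ℚ-ring
    product : sumℚ (λ S → sumℚ (λ S′ → 𝟙 (S inAll fs) ℚ.* 𝟙 (S′ inAll fs)) V) U ≡ fromℕ (y fs) ℚ.* fromℕ (x fs)
    product = begin
      sumℚ (λ S → sumℚ (λ S′ → 𝟙 (S inAll fs) ℚ.* 𝟙 (S′ inAll fs)) V) U ≡⟨ sumℚ-cong U (λ S → trans (sumℚ-* (𝟙 (S inAll fs)) _ V) (ℚ.*-comm (𝟙 (S inAll fs)) (X fs))) ⟩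
      sumℚ (λ S → X fs ℚ.* 𝟙 (S inAll fs)) U ≡⟨ sumℚ-* (X fs) _ U ⟩
      X fs ℚ.* Y fs ≡⟨ cong₂ ℚ._*_ (sumℚ-𝟙 (_inAll fs) V) (sumℚ-𝟙 (_inAll fs) U) ⟩
      fromℕ (x fs) ℚ.* fromℕ (y fs) ≡⟨ ℚ.*-comm (fromℕ (x fs)) (fromℕ (y fs)) ⟩
      fromℕ (y fs) ℚ.* fromℕ (x fs) ∎
      where open ≡-Reasoning
  twice : ∀ a b → 2 ≤ b → a + a ≤ a * b
  twice a b 2≤b = ℕ.≤-trans (ℕ.≤-reflexive (lemma a)) (ℕ.*-monoʳ-≤ a 2≤b)
    where
    lemma : ∀ a → a + a ≡ a * 2
    lemma = solve-∀
  cases : ∀ a b → a ≤ b → a + a ≤ a * b ⊎ (b ≡ 1 × a ≡ 1)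
  cases zero b _ = inj₁ z≤n
  cases (suc a) zero ()
  cases (suc zero) (suc zero) _ = inj₂ (refl , refl)
  cases (suc (suc a)) (suc zero) (s≤s ())
  cases (suc a) (suc (suc b)) _ = inj₁ (twice (suc a) (suc (suc b)) (s≤s (s≤s z≤n)))
  0≤c : ∀ fs → 0ℚ ℚ.≤ c fs
  0≤c fs = subst (0ℚ ℚ.≤_) (sym (c≡ fs)) (slack (fromℕ-mono {y fs + y fs} {1 + y fs * x fs} (bound (cases (y fs) (x fs) (cU≤cV (_inAll fs))))))
    where
    bound : _ → y fs + y fs ≤ 1 + y fs * x fs
    bound (inj₁ h) = ℕ.m≤n⇒m≤1+n h
    bound (inj₂ (x≡1 , y≡1)) rewrite x≡1 | y≡1 = s≤s (s≤s z≤n)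
  isolates : ∀ fs → (∃[ S ] S ∈ U × T (S inAll fs) × (∀ {S′} → S′ ∈ V → T (S′ inAll fs) → S′ ≡ S)) ⊎ 1ℚ ℚ.≤ c fs
  isolates fs with cases (y fs) (x fs) (cU≤cV (_inAll fs))
  ... | inj₁ h = inj₂ (≤-by-slack (fromℕ (y fs * x fs) ℚ.- fromℕ (y fs + y fs)) (slack (fromℕ-mono h))
      (trans (c≡ fs) (trans (cong (ℚ._- fromℕ (y fs + y fs)) (fromℕ-suc (y fs * x fs))) (ℚ.+-assoc 1ℚ (fromℕ (y fs * x fs)) (ℚ.- fromℕ (y fs + y fs))))))
  ... | inj₂ (x≡1 , y≡1) with 0<count⇒∃ {xs = U} (ℕ.≤-reflexive (sym y≡1))
  ... | S , S∈ , fS = inj₁ (S , S∈ , fS , λ S′∈ fS′ → count≤1⇒≡ {xs = V} unique (ℕ.≤-reflexive x≡1) S′∈ fS′ (U⊆V S∈) fS)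
  N u : ℚ
  N = fromℕ (length V)
  u = fromℕ (length U)
  EY : E Y Z ≡ u ℚ.* p
  EY = trans (E-sumℚ (λ S fs → 𝟙 (S inAll fs)) U Z) (trans (sumℚ-cong U (λ S → E-inAll S lev)) (sumℚ-const p U))
  Eprod : E (λ fs → sumℚ (λ S → sumℚ (λ S′ → 𝟙 (S inAll fs) ℚ.* 𝟙 (S′ inAll fs)) V) U) Z ℚ.≤ u ℚ.* (p ℚ.+ N ℚ.* (p ℚ.* p))
  Eprod = begin
    E (λ fs → sumℚ (λ S → sumℚ (λ S′ → 𝟙 (S inAll fs) ℚ.* 𝟙 (S′ inAll fs)) V) U) Z
      ≡⟨ E-sumℚ (λ S fs → sumℚ (λ S′ → 𝟙 (S inAll fs) ℚ.* 𝟙 (S′ inAll fs)) V) U Z ⟩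
    sumℚ (λ S → E (λ fs → sumℚ (λ S′ → 𝟙 (S inAll fs) ℚ.* 𝟙 (S′ inAll fs)) V) Z) U
      ≡⟨ sumℚ-cong U (λ S → E-sumℚ (λ S′ fs → 𝟙 (S inAll fs) ℚ.* 𝟙 (S′ inAll fs)) V Z) ⟩
    sumℚ (λ S → sumℚ (λ S′ → E (λ fs → 𝟙 (S inAll fs) ℚ.* 𝟙 (S′ inAll fs)) Z) V) U
      ≤⟨ sumℚ-mono U (λ S → sumℚ-unique {a = p} {b = p ℚ.* p} S V unique (0≤½^ lev) (diagonal S)
           (λ S′ S≢S′ → ℚ.≤-reflexive (E-inAll² S≢S′ lev)) (S ≟ˢ_)) ⟩
    sumℚ (λ S → p ℚ.+ N ℚ.* (p ℚ.* p)) U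
      ≡⟨ sumℚ-const (p ℚ.+ N ℚ.* (p ℚ.* p)) U ⟩
    u ℚ.* (p ℚ.+ N ℚ.* (p ℚ.* p)) ∎
    where
    open ℚ.≤-Reasoning
    diagonal : ∀ S → E (λ fs → 𝟙 (S inAll fs) ℚ.* 𝟙 (S inAll fs)) Z ℚ.≤ p ℚ.+ p ℚ.* p
    diagonal S = ≤-by-slack (p ℚ.* p) (0≤*ℚ (0≤½^ lev) (0≤½^ lev))
      (cong (ℚ._+ p ℚ.* p) (sym (trans (E-cong Z (λ fs → idem (S inAll fs))) (E-inAll S lev))))
      where
      idem : ∀ b → 𝟙 b ℚ.* 𝟙 b ≡ 𝟙 b
      idem true = refl
      idem false = refl
  b≤ : N ℚ.* p ℚ.≤ 1ℚ ℚ.- ½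
  b≤ = begin
    N ℚ.* p ≡⟨ sym (ℚ.*-identityˡ (N ℚ.* p)) ⟩
    ½ ℚ.* fromℕ 2 ℚ.* (N ℚ.* p) ≡⟨ lemma ½ (fromℕ 2) N p ⟩
    ½ ℚ.* (fromℕ 2 ℚ.* N ℚ.* p) ≡⟨ cong (λ z → ½ ℚ.* (z ℚ.* p)) (sym (fromℕ-* 2 (length V))) ⟩
    ½ ℚ.* (fromℕ (2 * length V) ℚ.* p) ≤⟨ *-monoˡℚ ½ 0≤½ (*½^≤ {2 * length V} {lev} 2N≤) ⟩
    ½ ℚ.* 1ℚ ≡⟨⟩
    1ℚ ℚ.- ½ ∎
    where
    open ℚ.≤-Reasoning
    lemma : ∀ a b c d → a ℚ.* b ℚ.* (c ℚ.* d) ≡ a ℚ.* (b ℚ.* c ℚ.* d)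
    lemma = Ring.solve-∀ ℚ-ring
  a≥ : + 1 ℚ./ 16 ℚ.≤ u ℚ.* p
  a≥ = begin
    + 1 ℚ./ 16 ≡⟨⟩
    + 1 ℚ./ 16 ℚ.* 1ℚ ≤⟨ *-monoˡℚ (+ 1 ℚ./ 16) (ℚ.≤ᵇ⇒≤ {0ℚ} {+ 1 ℚ./ 16} tt) (≤*½^ {16 * length U} {lev} large) ⟩
    + 1 ℚ./ 16 ℚ.* (fromℕ (16 * length U) ℚ.* p) ≡⟨ cong (λ z → + 1 ℚ./ 16 ℚ.* (z ℚ.* p)) (fromℕ-* 16 (length U)) ⟩
    + 1 ℚ./ 16 ℚ.* (fromℕ 16 ℚ.* u ℚ.* p) ≡⟨ lemma (+ 1 ℚ./ 16) (fromℕ 16) u p ⟩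
    + 1 ℚ./ 16 ℚ.* fromℕ 16 ℚ.* (u ℚ.* p) ≡⟨ ℚ.*-identityˡ (u ℚ.* p) ⟩
    u ℚ.* p ∎
    where
    open ℚ.≤-Reasoning
    lemma : ∀ a b c d → a ℚ.* (b ℚ.* c ℚ.* d) ≡ a ℚ.* b ℚ.* (c ℚ.* d)
    lemma = Ring.solve-∀ ℚ-ring
    large : 2 ^ lev ≤ 16 * length U
    large = ℕ.≤-trans ≤4N (ℕ.≤-trans (ℕ.*-monoʳ-≤ 4 N≤4u) (ℕ.≤-reflexive (sym (ℕ.*-assoc 4 4 (length U)))))
  Ec≤ : E c Z ℚ.≤ 31/32
  Ec≤ = begin
    E c Z ≡⟨ E-+ _ _ Z ⟩
    E (λ fs → 1ℚ ℚ.+ sumℚ (λ S → sumℚ (λ S′ → 𝟙 (S inAll fs) ℚ.* 𝟙 (S′ inAll fs)) V) U) Z ℚ.+ E (λ fs → (ℚ.- 1ℚ) ℚ.* (Y fs ℚ.+ Y fs)) Z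
      ≡⟨ cong₂ ℚ._+_ (trans (E-+ _ _ Z) (cong (ℚ._+ Π) (E-const 1ℚ Z)))
           (trans (E-* (ℚ.- 1ℚ) (λ fs → Y fs ℚ.+ Y fs) Z) (cong ((ℚ.- 1ℚ) ℚ.*_) (trans (E-+ Y Y Z) (cong₂ ℚ._+_ EY EY)))) ⟩
    (1ℚ ℚ.+ Π) ℚ.+ (ℚ.- 1ℚ) ℚ.* (u ℚ.* p ℚ.+ u ℚ.* p)
      ≤⟨ ℚ.+-monoˡ-≤ _ (ℚ.+-monoʳ-≤ 1ℚ Eprod) ⟩
    (1ℚ ℚ.+ u ℚ.* (p ℚ.+ N ℚ.* (p ℚ.* p))) ℚ.+ (ℚ.- 1ℚ) ℚ.* (u ℚ.* p ℚ.+ u ℚ.* p)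
      ≤⟨ ≤-by-slack ((u ℚ.* p ℚ.- s) ℚ.* (1ℚ ℚ.- N ℚ.* p) ℚ.+ s ℚ.* ((1ℚ ℚ.- ½) ℚ.- N ℚ.* p))
           (0≤+ℚ (0≤*ℚ (slack a≥) (slack (ℚ.≤-trans b≤ (ℚ.≤ᵇ⇒≤ {1ℚ ℚ.- ½} {1ℚ} tt)))) (0≤*ℚ (ℚ.≤ᵇ⇒≤ {0ℚ} {s} tt) (slack b≤))) (lemma u p N s ½) ⟩
    1ℚ ℚ.- s ℚ.* ½ ≡⟨⟩
    31/32 ∎
    where
    open ℚ.≤-Reasoning
    s = + 1 ℚ./ 16
    Π = E (λ fs → sumℚ (λ S → sumℚ (λ S′ → 𝟙 (S inAll fs) ℚ.* 𝟙 (S′ inAll fs)) V) U) Z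
    lemma : ∀ u p N s h → 1ℚ ℚ.- s ℚ.* h ≡ ((1ℚ ℚ.+ u ℚ.* (p ℚ.+ N ℚ.* (p ℚ.* p))) ℚ.+ (ℚ.- 1ℚ) ℚ.* (u ℚ.* p ℚ.+ u ℚ.* p)) ℚ.+
      ((u ℚ.* p ℚ.- s) ℚ.* (1ℚ ℚ.- N ℚ.* p) ℚ.+ s ℚ.* ((1ℚ ℚ.- h) ℚ.- N ℚ.* p))
    lemma = Ring.solve-∀ ℚ-ring

infixr 8 _^ℚ_
_^ℚ_ : ℚ → ℕ → ℚ
x ^ℚ zero = 1ℚ
x ^ℚ suc k = x ℚ.* x ^ℚ k

0≤^ℚ : ∀ {x} k → 0ℚ ℚ.≤ x → 0ℚ ℚ.≤ x ^ℚ k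
0≤^ℚ zero 0≤x = 0≤1ℚ
0≤^ℚ (suc k) 0≤x = 0≤*ℚ 0≤x (0≤^ℚ k 0≤x)

^ℚ-+ : ∀ x j k → x ^ℚ (j + k) ≡ x ^ℚ j ℚ.* x ^ℚ k
^ℚ-+ x zero k = sym (ℚ.*-identityˡ _)
^ℚ-+ x (suc j) k = trans (cong (x ℚ.*_) (^ℚ-+ x j k)) (sym (ℚ.*-assoc x (x ^ℚ j) (x ^ℚ k)))

bernoulli : ∀ x → 0ℚ ℚ.≤ x → x ℚ.≤ 1ℚ → ∀ k → (1ℚ ℚ.- x) ^ℚ k ℚ.* (1ℚ ℚ.+ fromℕ k ℚ.* x) ℚ.≤ 1ℚ
bernoulli x 0≤x x≤1 zero = ℚ.≤-reflexive (trans (ℚ.*-identityˡ _) (trans (cong (1ℚ ℚ.+_) (ℚ.*-zeroˡ x)) (ℚ.+-identityʳ 1ℚ)))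
bernoulli x 0≤x x≤1 (suc k) = begin
  (1ℚ ℚ.- x) ℚ.* y ℚ.* (1ℚ ℚ.+ fromℕ (suc k) ℚ.* x) ≡⟨ cong (λ z → (1ℚ ℚ.- x) ℚ.* y ℚ.* (1ℚ ℚ.+ z ℚ.* x)) (fromℕ-suc k) ⟩
  (1ℚ ℚ.- x) ℚ.* y ℚ.* (1ℚ ℚ.+ (1ℚ ℚ.+ fromℕ k) ℚ.* x) ≤⟨ ≤-by-slack (y ℚ.* ((1ℚ ℚ.+ fromℕ k) ℚ.* (x ℚ.* x)))
      (0≤*ℚ (0≤^ℚ k (slack x≤1)) (0≤*ℚ (0≤+ℚ 0≤1ℚ (0≤fromℕ k)) (0≤*ℚ 0≤x 0≤x))) (lemma x y (fromℕ k)) ⟩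
  y ℚ.* (1ℚ ℚ.+ fromℕ k ℚ.* x) ≤⟨ bernoulli x 0≤x x≤1 k ⟩
  1ℚ ∎
  where
  open ℚ.≤-Reasoning
  y = (1ℚ ℚ.- x) ^ℚ k
  lemma : ∀ x y k → y ℚ.* (1ℚ ℚ.+ k ℚ.* x) ≡ (1ℚ ℚ.- x) ℚ.* y ℚ.* (1ℚ ℚ.+ (1ℚ ℚ.+ k) ℚ.* x) ℚ.+ y ℚ.* ((1ℚ ℚ.+ k) ℚ.* (x ℚ.* x))
  lemma = Ring.solve-∀ ℚ-ring

η : ℚ
η = + 63 ℚ./ 64

0≤η : 0ℚ ℚ.≤ η
0≤η = ℚ.≤ᵇ⇒≤ {0ℚ} {η} tt

η^64≤½ : η ^ℚ 64 ℚ.≤ ½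
η^64≤½ = begin
  η ^ℚ 64 ≡⟨ sym (½*[p+p]≡p (η ^ℚ 64)) ⟩
  ½ ℚ.* (η ^ℚ 64 ℚ.+ η ^ℚ 64) ≡⟨ cong (½ ℚ.*_) (lemma (η ^ℚ 64)) ⟩
  ½ ℚ.* (η ^ℚ 64 ℚ.* (1ℚ ℚ.+ 1ℚ)) ≤⟨ *-monoˡℚ ½ 0≤½ (bernoulli (+ 1 ℚ./ 64) (ℚ.≤ᵇ⇒≤ {0ℚ} {+ 1 ℚ./ 64} tt) (ℚ.≤ᵇ⇒≤ {+ 1 ℚ./ 64} {1ℚ} tt) 64) ⟩
  ½ ∎
  where
  open ℚ.≤-Reasoning
  lemma : ∀ x → x ℚ.+ x ≡ x ℚ.* (1ℚ ℚ.+ 1ℚ)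
  lemma = Ring.solve-∀ ℚ-ring

η^[64*j]≤½^j : ∀ j → η ^ℚ (j * 64) ℚ.≤ ½^ j
η^[64*j]≤½^j zero = ℚ.≤-refl
η^[64*j]≤½^j (suc j) = ℚ.≤-trans (ℚ.≤-reflexive (^ℚ-+ η 64 (j * 64)))
  (*-mono-≤ℚ (0≤^ℚ 64 0≤η) (0≤^ℚ (j * 64) 0≤η) η^64≤½ (η^[64*j]≤½^j j))

module Blocks {n} (w m cap : ℕ) (name : Subset n → Vec Bool w) (𝒞 : List (Subset n)) (len≤m : length 𝒞 ≤ m) where

  open Sampling w m cap name

  𝒟 : List (Subset n)
  𝒟 = deduplicate _≟ˢ_ 𝒞

  𝒟! : Unique 𝒟
  𝒟! = Unique.deduplicate-! _≟ˢ_ 𝒞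

  ∈𝒟⇒∈𝒞 : ∀ {S} → S ∈ 𝒟 → S ∈ 𝒞
  ∈𝒟⇒∈𝒞 = Mem.∈-deduplicate⁻ _≟ˢ_ 𝒞

  ∈𝒞⇒∈𝒟 : ∀ {S} → S ∈ 𝒞 → S ∈ 𝒟
  ∈𝒞⇒∈𝒟 = Mem.∈-deduplicate⁺ _≟ˢ_

  survives? : ∀ θ C₀ C S → Dec (InClass θ C₀ S × θ ≤ ∣ S ─ C ∣)
  survives? θ C₀ C S = inClass? θ C₀ S ×-dec (θ ℕ.≤? ∣ S ─ C ∣)

  class : ℕ → Subset n → List (Subset n)
  class θ C₀ = filter (inClass? θ C₀) 𝒟

  survivors : ℕ → Subset n → Subset n → List (Subset n)
  survivors θ C₀ C = filter (survives? θ C₀ C) 𝒟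

  Pruned : ℕ → Subset n → State → Set
  Pruned θ C₀ (C , L) = cap ≤ length L ⊎ 4 * length (survivors θ C₀ C) ≤ length (class θ C₀)

  _⊑_ : State → State → Set
  (C , L) ⊑ (C′ , L′) = (C Sub.⊆ C′) × length L ≤ length L′

  ⊑-trans : ∀ {σ σ′ σ″} → σ ⊑ σ′ → σ′ ⊑ σ″ → σ ⊑ σ″
  ⊑-trans (C⊆ , L≤) (C⊆′ , L≤′) = (λ x∈ → C⊆′ (C⊆ x∈)) , ℕ.≤-trans L≤ L≤′

  Grows-⊑ : ∀ {θ σ σ′} → Grows θ σ σ′ → σ ⊑ σ′
  Grows-⊑ unchanged = (λ x∈ → x∈) , ℕ.≤-refl
  Grows-⊑ (grown {C} R ν _ _) = Sub.p⊆p∪q R , ℕ.n≤1+n _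

  Pick-⊑ : ∀ {τ σ σ′} → Pick 𝒞 τ σ σ′ → σ ⊑ σ′
  Pick-⊑ (pick S _ _ _) = Sub.p⊆p∪q S , ℕ.n≤1+n _

  Picks-⊑ : ∀ {τ σ σ′} → Star (Pick 𝒞 τ) σ σ′ → σ ⊑ σ′
  Picks-⊑ none = (λ x∈ → x∈) , ℕ.≤-refl
  Picks-⊑ {σ = σ} {σ′} (_◅_ {j = σ″} p ps) = ⊑-trans {σ} {σ″} {σ′} (Pick-⊑ p) (Picks-⊑ ps)

  Pick-weaken : ∀ {τ θ σ σ′} → τ ≤ θ → Pick 𝒞 θ σ σ′ → Pick 𝒞 τ σ σ′
  Pick-weaken τ≤θ (pick S S∈ θ≤ len<) = pick S S∈ (ℕ.≤-trans τ≤θ θ≤) len<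

  Pruned-mono : ∀ {θ C₀ σ σ′} → σ ⊑ σ′ → Pruned θ C₀ σ → Pruned θ C₀ σ′
  Pruned-mono (C⊆ , L≤) (inj₁ full) = inj₁ (ℕ.≤-trans full L≤)
  Pruned-mono {θ} {C₀} {C , _} {C′ , _} (C⊆ , L≤) (inj₂ few) = inj₂ (ℕ.≤-trans (ℕ.*-monoʳ-≤ 4
    (length-filter-⊆ (survives? θ C₀ C′) (survives? θ C₀ C) 𝒟 (λ {S} (c , θ≤) → c , ℕ.≤-trans θ≤ (∣─∣-antitone S C⊆)))) few)

  module Block (θ lev r : ℕ) .{{_ : NonZero θ}} (C₀ : Subset n) where

    open Sampler θ lev r

    step : Seed → State → State
    step s = eval (sampler C₀ s) 𝒞

    runBlock : ∀ {k} → Vec Seed k → State → State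
    runBlock [] σ = σ
    runBlock (s ∷ ω) σ = runBlock ω (step s σ)

    runBlock-⊑ : ∀ {k} (ω : Vec Seed k) σ → σ ⊑ runBlock ω σ
    runBlock-⊑ [] σ = (λ x∈ → x∈) , ℕ.≤-refl
    runBlock-⊑ (s ∷ ω) σ = ⊑-trans {σ} {step s σ} {runBlock ω (step s σ)} (Grows-⊑ (eval-grows C₀ 𝒞 s σ)) (runBlock-⊑ ω (step s σ))

    room : State → ℕ
    room (C , _) = (n ∸ ∣ C ∣) ℕ./ θ

    room-grown : ∀ {C R} → θ ≤ ∣ R ─ C ∣ → suc ((n ∸ ∣ C ∪ R ∣) ℕ./ θ) ≤ (n ∸ ∣ C ∣) ℕ./ θ
    room-grown {C} {R} θ≤ = begin
      suc ((n ∸ ∣ C ∪ R ∣) ℕ./ θ) ≡⟨ cong (λ k → suc ((n ∸ k) ℕ./ θ)) (∣∪∣ C R) ⟩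
      suc ((n ∸ (∣ C ∣ + ∣ R ─ C ∣)) ℕ./ θ) ≤⟨ s≤s (ℕ./-monoˡ-≤ θ (ℕ.∸-monoʳ-≤ n (ℕ.+-monoʳ-≤ ∣ C ∣ θ≤))) ⟩
      suc ((n ∸ (∣ C ∣ + θ)) ℕ./ θ) ≡⟨ cong (λ k → suc (k ℕ./ θ)) (sym (ℕ.∸-+-assoc n ∣ C ∣ θ)) ⟩
      suc ((n ∸ ∣ C ∣ ∸ θ) ℕ./ θ) ≡⟨ sym (ℕ.m/n≡1+[m∸n]/n fits) ⟩
      (n ∸ ∣ C ∣) ℕ./ θ ∎
      where
      open ℕ.≤-Reasoning
      fits : θ ≤ n ∸ ∣ C ∣
      fits = ℕ.≤-trans θ≤ (ℕ.≤-trans (ℕ.≤-reflexive (sym (ℕ.m+n∸m≡n ∣ C ∣ ∣ R ─ C ∣)))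
        (ℕ.∸-monoˡ-≤ ∣ C ∣ (ℕ.≤-trans (ℕ.≤-reflexive (sym (∣∪∣ C R))) (Sub.∣p∣≤n (C ∪ R)))))

    Hit : Subset n → Seed → Set
    Hit C (fs , φs) = ∃[ S ] Isolated C₀ 𝒞 fs S × θ ≤ ∣ S ─ C ∣

    fail-hit : ∀ C → 2 * length (class θ C₀) ≤ 2 ^ lev → 2 ^ lev ≤ 4 * length (class θ C₀) →
      length (class θ C₀) ≤ 4 * length (survivors θ C₀ C) → Fail drawSeed (Hit C) 31/32
    fail-hit C 2N≤ ≤4N N≤4u = fail-weaken drawSeed (λ _ h → h) (ℚ.≤-reflexive (ℚ.+-identityʳ 31/32))
      (fail-bind (drawVec (randomTable n) lev) _ isolate ℚ.≤-refl (λ fs (S , S∈U , fS , only) →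
        fail-map (drawVec (randomTable (w + n)) r) (fs ,_) (fail-sure _ ℚ.≤-refl (λ φs → hit {fs} {φs} S S∈U fS only))))
      where
      U = survivors θ C₀ C
      V = class θ C₀
      U⊆V : ∀ {S} → S ∈ U → S ∈ V
      U⊆V S∈ with Mem.∈-filter⁻ (survives? θ C₀ C) {xs = 𝒟} S∈
      ... | S∈𝒟 , c , _ = Mem.∈-filter⁺ (inClass? θ C₀) S∈𝒟 c
      isolate = fail-isolate U V (UniqueP.filter⁺ (inClass? θ C₀) 𝒟!) U⊆V
        (λ f → count-filter-⊆ (survives? θ C₀ C) (inClass? θ C₀) f 𝒟 proj₁) lev 2N≤ ≤4N N≤4u
      hit : ∀ {fs φs} S → S ∈ U → T (S inAll fs) → (∀ {S′} → S′ ∈ V → T (S′ inAll fs) → S′ ≡ S) → Hit C (fs , φs)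
      hit S S∈U fS only with Mem.∈-filter⁻ (survives? θ C₀ C) {xs = 𝒟} S∈U
      ... | S∈𝒟 , c , θ≤ = S , ((c , fS) , ∈𝒟⇒∈𝒞 S∈𝒟 ,
        λ S′∈ (c′ , fS′) → only (Mem.∈-filter⁺ (inClass? θ C₀) (∈𝒞⇒∈𝒟 S′∈) c′) fS′) , θ≤

    bound : ℕ → ℕ → ℚ
    bound l k = 2ℚ^ l ℚ.* η ^ℚ k

    0≤bound : ∀ l k → 0ℚ ℚ.≤ bound l k
    0≤bound l k = 0≤*ℚ (0≤fromℕ (2 ^ l)) (0≤^ℚ k 0≤η)

    bound-mono : ∀ {l l′} k → l ≤ l′ → bound l k ℚ.≤ bound l′ k
    bound-mono {l} {l′} k l≤ = ℚ.*-monoʳ-≤-nonNeg (η ^ℚ k) {{ℚ.nonNegative (0≤^ℚ k 0≤η)}} (fromℕ-mono {2 ^ l} {2 ^ l′} (ℕ.^-monoʳ-≤ 2 l≤))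

    bound-half : ∀ {l l′} k → suc l ≤ l′ → bound l k ℚ.≤ ½ ℚ.* bound l′ k
    bound-half {l} {l′} k l< = ℚ.≤-trans (ℚ.≤-reflexive eq) (*-monoˡℚ ½ 0≤½ (bound-mono k l<))
      where
      lemma : ∀ a b c d → a ℚ.* b ℚ.* (c ℚ.* d) ≡ a ℚ.* ((b ℚ.* c) ℚ.* d)
      lemma = Ring.solve-∀ ℚ-ring
      eq : bound l k ≡ ½ ℚ.* bound (suc l) k
      eq = trans (sym (ℚ.*-identityˡ (bound l k))) (trans (lemma ½ (fromℕ 2) (2ℚ^ l) (η ^ℚ k)) (cong (λ z → ½ ℚ.* (z ℚ.* η ^ℚ k)) (sym (fromℕ-* 2 (2 ^ l)))))

    -- As long as a quarter of the class survives, every sampler makes a pick with probability 1/32,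
    -- so that the expectation of 2 ^ room shrinks by the factor η.
    fail-tail : 2 * length (class θ C₀) ≤ 2 ^ lev → 2 ^ lev ≤ 4 * length (class θ C₀) → ∀ k σ → C₀ Sub.⊆ proj₁ σ →
      Fail (drawVec drawSeed k) (λ ω → VecAll.All (Faithful C₀ 𝒞) ω → Pruned θ C₀ (runBlock ω σ)) (bound (room σ) k)
    fail-tail 2N≤ ≤4N zero σ C₀⊆ = failure (ℚ.≤-trans (fromℕ-mono {1} (ℕ.m^n>0 2 (room σ))) (ℚ.≤-reflexive (sym (ℚ.*-identityʳ (2ℚ^ (room σ))))))
    fail-tail 2N≤ ≤4N (suc k) σ@(C , L) C₀⊆ with cap ℕ.≤? length L | 4 * length (survivors θ C₀ C) ℕ.≤? length (class θ C₀)
    ... | yes full | _ = fail-sure _ (0≤bound (room σ) (suc k)) (λ ω _ → Pruned-mono {θ} {C₀} {σ} {runBlock ω σ} (runBlock-⊑ ω σ) (inj₁ full))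
    ... | no _ | yes few = fail-sure _ (0≤bound (room σ) (suc k)) (λ ω _ → Pruned-mono {θ} {C₀} {σ} {runBlock ω σ} (runBlock-⊑ ω σ) (inj₂ few))
    ... | no ¬full | no many = fail-weaken _ (λ _ h → h) (ℚ.≤-reflexive shrink)
      (fail->>= drawSeed _ (fail-hit C 2N≤ ≤4N (ℕ.<⇒≤ (ℕ.≰⇒> many))) after-hit after half≤)
      where
      b = bound (room σ) k
      lemma : ∀ h p b → h ℚ.* b ℚ.+ p ℚ.* (b ℚ.- h ℚ.* b) ≡ (h ℚ.+ p ℚ.* (1ℚ ℚ.- h)) ℚ.* b
      lemma = Ring.solve-∀ ℚ-ring
      lemma′ : ∀ e a c → e ℚ.* (a ℚ.* c) ≡ a ℚ.* (e ℚ.* c)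
      lemma′ = Ring.solve-∀ ℚ-ring
      shrink : ½ ℚ.* b ℚ.+ 31/32 ℚ.* (b ℚ.- ½ ℚ.* b) ≡ bound (room σ) (suc k)
      shrink = trans (lemma ½ 31/32 b) (lemma′ η (2ℚ^ (room σ)) (η ^ℚ k))
      half≤ : ½ ℚ.* b ℚ.≤ b
      half≤ = ≤-by-slack (½ ℚ.* b) (0≤*ℚ 0≤½ (0≤bound (room σ) k)) (trans (sym (½*[p+p]≡p b)) (ℚ.*-distribˡ-+ ½ b b))
      rest : ∀ s {δ} → bound (room (step s σ)) k ℚ.≤ δ →
        Fail (drawVec drawSeed k >>= λ ω → return (s ∷ ω)) (λ ω → VecAll.All (Faithful C₀ 𝒞) ω → Pruned θ C₀ (runBlock ω σ)) δ
      rest s ≤δ = fail-map (drawVec drawSeed k) (s ∷_) (fail-weaken _ (λ { ω h (_ VecAll.∷ faithful) → h faithful }) ≤δ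
        (fail-tail 2N≤ ≤4N k (step s σ) (λ x∈ → Grows-⊆ (eval-grows C₀ 𝒞 s σ) (C₀⊆ x∈))))
      after : ∀ s → Fail (drawVec drawSeed k >>= λ ω → return (s ∷ ω)) (λ ω → VecAll.All (Faithful C₀ 𝒞) ω → Pruned θ C₀ (runBlock ω σ)) b
      after s = rest s (bound-mono k (ℕ./-monoˡ-≤ θ (ℕ.∸-monoʳ-≤ n (Sub.p⊆q⇒∣p∣≤∣q∣ (Grows-⊆ (eval-grows C₀ 𝒞 s σ))))))
      after-hit : ∀ s → Hit C s → Fail (drawVec drawSeed k >>= λ ω → return (s ∷ ω)) (λ ω → VecAll.All (Faithful C₀ 𝒞) ω → Pruned θ C₀ (runBlock ω σ)) (½ ℚ.* b)
      after-hit s@(fs , φs) (S , isolated , θ≤) = by-growth (step s σ) refl (eval-grows C₀ 𝒞 s σ)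
        where
        by-growth : ∀ σ′ → step s σ ≡ σ′ → Grows θ σ σ′ → Fail (drawVec drawSeed k >>= λ ω → return (s ∷ ω)) (λ ω → VecAll.All (Faithful C₀ 𝒞) ω → Pruned θ C₀ (runBlock ω σ)) (½ ℚ.* b)
        by-growth σ′ eq unchanged = fail-map (drawVec drawSeed k) (s ∷_) (fail-sure _ (0≤*ℚ 0≤½ (0≤bound (room σ) k))
          (λ { ω (faithful VecAll.∷ _) → contradiction eq (isolated-grows C₀ 𝒞 fs φs len≤m faithful C₀⊆ isolated θ≤ (ℕ.≰⇒> ¬full)) }))
        by-growth σ′ eq (grown R ν θ≤R len<) = rest s (bound-half k (subst (λ σ″ → suc (room σ″) ≤ room σ) (sym eq) (room-grown {C} {R} θ≤R)))

    fail-block : ∀ a {e} σ → C₀ Sub.⊆ proj₁ σ → length (candidates θ) ≤ 2 ^ e → ∀ a′ → r ≡ e + a′ → let k = (n ℕ./ θ + a) * 64 in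
      Fail (drawVec drawSeed k)
        (λ ω → VecAll.All (Faithful C₀ 𝒞) ω × (2 * length (class θ C₀) ≤ 2 ^ lev → 2 ^ lev ≤ 4 * length (class θ C₀) → Pruned θ C₀ (runBlock ω σ)))
        (fromℕ k ℚ.* ½^ a′ ℚ.+ ½^ a)
    fail-block a {e} σ C₀⊆ len≤ a′ r≡ = fail-weaken _ (λ ω (faithful , h) → faithful , λ 2N≤ ≤4N → h 2N≤ ≤4N faithful) ℚ.≤-refl
      (fail-× (drawVec drawSeed k) (fail-drawVec-∀ drawSeed (fail-faithful C₀ 𝒞 a′ {e} len≤ r≡) k) pruned)
      where
      j = n ℕ./ θ + a
      k = j * 64
      small : bound (room σ) k ℚ.≤ ½^ a
      small = begin
        2ℚ^ (room σ) ℚ.* η ^ℚ k ≤⟨ *-mono-≤ℚ (0≤fromℕ (2 ^ room σ)) (0≤^ℚ k 0≤η) (fromℕ-mono {2 ^ room σ} {2 ^ (n ℕ./ θ)} (ℕ.^-monoʳ-≤ 2 (ℕ./-monoˡ-≤ θ (ℕ.m∸n≤m n ∣ proj₁ σ ∣)))) (η^[64*j]≤½^j j) ⟩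
        2ℚ^ (n ℕ./ θ) ℚ.* ½^ (n ℕ./ θ + a) ≡⟨ cong (2ℚ^ (n ℕ./ θ) ℚ.*_) (½^-+ (n ℕ./ θ) a) ⟩
        2ℚ^ (n ℕ./ θ) ℚ.* (½^ (n ℕ./ θ) ℚ.* ½^ a) ≤⟨ *½^-≤ {2 ^ (n ℕ./ θ)} {n ℕ./ θ} (½^ a) (0≤½^ a) ℕ.≤-refl ⟩
        ½^ a ∎
        where open ℚ.≤-Reasoning
      pruned : Fail (drawVec drawSeed k) (λ ω → 2 * length (class θ C₀) ≤ 2 ^ lev → 2 ^ lev ≤ 4 * length (class θ C₀) →
        VecAll.All (Faithful C₀ 𝒞) ω → Pruned θ C₀ (runBlock ω σ)) (½^ a)
      pruned with 2 * length (class θ C₀) ℕ.≤? 2 ^ lev | 2 ^ lev ℕ.≤? 4 * length (class θ C₀)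
      ... | no ¬p | _ = fail-sure _ (0≤½^ a) (λ ω p → contradiction p ¬p)
      ... | yes _ | no ¬q = fail-sure _ (0≤½^ a) (λ ω _ q → contradiction q ¬q)
      ... | yes p | yes q = fail-weaken _ (λ ω h _ _ → h) small (fail-tail p q k σ C₀⊆)

    runBlock-picks : ∀ {k} (ω : Vec Seed k) σ → C₀ Sub.⊆ proj₁ σ → VecAll.All (Faithful C₀ 𝒞) ω → Star (Pick 𝒞 θ) σ (runBlock ω σ)
    runBlock-picks [] σ C₀⊆ _ = none
    runBlock-picks (s ∷ ω) σ@(C , L) C₀⊆ (f VecAll.∷ fs) with faithful-step C₀ 𝒞 s f C₀⊆
    ... | inj₁ eq = subst (λ σ′ → Star (Pick 𝒞 θ) σ (runBlock ω σ′)) (sym eq) (runBlock-picks ω σ C₀⊆ fs)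
    ... | inj₂ p = p ◅ runBlock-picks ω (step s σ) (λ x∈ → proj₁ (Pick-⊑ p) (C₀⊆ x∈)) fs

mapˢ : ∀ {n} {X Y : Set} → (X → Y) → Sketch n X → Sketch n Y
mapˢ f s = record { queries = queries s ; decode = f ∘ decode s }

range : ℕ → ℕ → List ℕ
range j zero = []
range j (suc c) = j ∷ range (suc j) c

length-range : ∀ j c → length (range j c) ≡ c
length-range j zero = refl
length-range j (suc c) = cong suc (length-range (suc j) c)

∈-range : ∀ j c {i} → j ≤ i → i < j + c → i ∈ range j c
∈-range j zero j≤i i< = contradiction (ℕ.≤-trans (ℕ.≤-trans i< (ℕ.≤-reflexive (ℕ.+-identityʳ j))) j≤i) (ℕ.<-irrefl refl)
∈-range j (suc c) {i} j≤i i< with j ℕ.≟ i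
... | yes refl = here refl
... | no j≢i = there (∈-range (suc j) c (ℕ.≤∧≢⇒< j≤i j≢i) (subst (i <_) (ℕ.+-suc j c) i<))

foldAll : ∀ {A S : Set} {B : A → Set} → (∀ {x} → B x → S → S) → ∀ {xs} → All B xs → S → S
foldAll act [] σ = σ
foldAll act (b ∷ bs) σ = foldAll act bs (act b σ)

fail-range : ∀ {S : Set} {B : ℕ → Set} {δ} (draw : ∀ j → Rand (B j)) (act : ∀ {j} → B j → S → S) (Inv : ℕ → S → Set) → 0ℚ ℚ.≤ δ →
  (∀ j σ → Inv j σ → Fail (draw j) (λ b → Inv (suc j) (act b σ)) δ) →
  ∀ c j σ → Inv j σ → Fail (drawAll draw (range j c)) (λ ω → Inv (j + c) (foldAll act ω σ)) (fromℕ c ℚ.* δ)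
fail-range {δ = δ} draw act Inv 0≤δ one zero j σ inv =
  success (subst (λ i → Inv i σ) (sym (ℕ.+-identityʳ j)) inv) (ℚ.≤-reflexive (sym (ℚ.*-zeroˡ δ)))
fail-range {δ = δ} draw act Inv 0≤δ one (suc c) j σ inv = fail-weaken _ (λ _ h → h)
  (ℚ.≤-reflexive (sym (fromℕ-suc-* c δ)))
  (fail-bind (draw j) _ (one j σ inv) (0≤*ℚ (0≤fromℕ c) 0≤δ) (λ b inv′ → fail-map _ (b ∷_) (fail-weaken _
    (λ ω → subst (λ i → Inv i (foldAll act ω (act b σ))) (sym (ℕ.+-suc j c))) ℚ.≤-refl
    (fail-range draw act Inv 0≤δ one c (suc j) (act b σ) inv′))))

length-filter-⊎ : ∀ {A : Set} {P Q R : A → Set} (P? : ∀ x → Dec (P x)) (Q? : ∀ x → Dec (Q x)) (R? : ∀ x → Dec (R x)) xs →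
  (∀ {x} → P x → Q x ⊎ R x) → length (filter P? xs) ≤ length (filter Q? xs) + length (filter R? xs)
length-filter-⊎ P? Q? R? [] h = z≤n
length-filter-⊎ P? Q? R? (x ∷ xs) h with P? x | Q? x | R? x
... | yes p | yes q | yes r = s≤s (ℕ.≤-trans (length-filter-⊎ P? Q? R? xs h) (ℕ.+-monoʳ-≤ _ (ℕ.n≤1+n _)))
... | yes p | yes q | no ¬r = s≤s (length-filter-⊎ P? Q? R? xs h)
... | yes p | no ¬q | yes r = ℕ.≤-trans (s≤s (length-filter-⊎ P? Q? R? xs h)) (ℕ.≤-reflexive (sym (ℕ.+-suc _ _)))
... | yes p | no ¬q | no ¬r = case h p of λ { (inj₁ q) → contradiction q ¬q ; (inj₂ r) → contradiction r ¬r }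
... | no ¬p | yes q | yes r = ℕ.≤-trans (length-filter-⊎ P? Q? R? xs h) (ℕ.+-mono-≤ (ℕ.n≤1+n _) (ℕ.n≤1+n _))
... | no ¬p | yes q | no ¬r = ℕ.m≤n⇒m≤1+n (length-filter-⊎ P? Q? R? xs h)
... | no ¬p | no ¬q | yes r = ℕ.≤-trans (length-filter-⊎ P? Q? R? xs h) (ℕ.+-monoʳ-≤ _ (ℕ.n≤1+n _))
... | no ¬p | no ¬q | no ¬r = length-filter-⊎ P? Q? R? xs h

level : ∀ N M → 0 < N → N ≤ 2 ^ M → ∃[ l ] l ≤ M × N ≤ 2 ^ l × 2 ^ l ≤ 2 * N
level N zero 0<N N≤ = 0 , z≤n , N≤ , ℕ.≤-trans 0<N (ℕ.m≤m+n N _)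
level N (suc M) 0<N N≤ with N ℕ.≤? 2 ^ M
... | yes N≤′ = let (l , l≤ , h) = level N M 0<N N≤′ in l , ℕ.m≤n⇒m≤1+n l≤ , h
... | no N≰ = suc M , ℕ.≤-refl , N≤ , ℕ.*-monoʳ-≤ 2 (ℕ.<⇒≤ (ℕ.≰⇒> N≰))

-- m ≤ 2^M and n < 2^lg; blocks and samplers may fail with probabilities ½^a and ½^a′, up to constants.
module Algorithm {n} (w m cap M lg a a′ : ℕ) (name : Subset n → Vec Bool w) where

  open Sampling w m cap name public

  rows : ℕ → ℕ
  rows θ = (M + w + lg * (2 * θ ⊓ n)) + a′

  reps : ∀ θ .{{_ : NonZero θ}} → ℕ
  reps θ = (n ℕ./ θ + a) * 64

  -- The classes of a threshold τ = t + 1 start at τ 2^i.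
  abstract
    Θ : ℕ → ℕ → ℕ
    Θ t i = suc t * 2 ^ i

    Θ≡ : ∀ t i → Θ t i ≡ suc t * 2 ^ i
    Θ≡ t i = refl

  instance
    Θ≢0 : ∀ {t i} → NonZero (Θ t i)
    Θ≢0 {t} {i} = subst NonZero (sym (Θ≡ t i)) (ℕ.m*n≢0 (suc t) (2 ^ i) {{_}} {{ℕ.m^n≢0 2 i}})

  blocks : List (ℕ × ℕ)
  blocks = List.cartesianProduct (range 0 (suc M)) (range 0 (suc M))

  SamplerSeed BlockSeed : ℕ → ℕ × ℕ → Set
  SamplerSeed t (i , l) = Sampler.Seed (Θ t i) (suc l) (rows (Θ t i))
  BlockSeed t (i , l) = Vec (SamplerSeed t (i , l)) (reps (Θ t i))

  PassSeed PhaseSeed : ℕ → Set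
  PassSeed t = All (BlockSeed t) blocks
  PhaseSeed t = All (λ _ → PassSeed t) (range 0 (3 + 3 * M))

  drawBlock : ∀ t d → Rand (BlockSeed t d)
  drawBlock t (i , l) = drawVec (Sampler.drawSeed (Θ t i) (suc l) (rows (Θ t i))) (reps (Θ t i))

  drawPass : ∀ t → Rand (PassSeed t)
  drawPass t = drawAll (drawBlock t) blocks

  drawPhase : ∀ t → Rand (PhaseSeed t)
  drawPhase t = drawAll (λ _ → drawPass t) (range 0 (3 + 3 * M))

  andThen : (State → State) → (State → State) → State → State
  andThen f g σ = g (f σ)

  blockSketch : ∀ t d {k} → Subset n → Vec (SamplerSeed t d) k → Sketch n (State → State)
  blockSketch t d C₀ [] = pureˢ (λ σ → σ)
  blockSketch t (i , l) C₀ (s ∷ ω) = liftˢ andThen (Sampler.sampler (Θ t i) (suc l) (rows (Θ t i)) C₀ s) (blockSketch t (i , l) C₀ ω)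

  blocksSketch : ∀ t {ds} → Subset n → All (BlockSeed t) ds → Sketch n (State → State)
  blocksSketch t C₀ [] = pureˢ (λ σ → σ)
  blocksSketch t C₀ (ω ∷ ωs) = liftˢ andThen (blockSketch t _ C₀ ω) (blocksSketch t C₀ ωs)

  passSketch : ∀ {t} → PassSeed t → State → Sketch n State
  passSketch {t} ω σ = mapˢ (λ f → f σ) (blocksSketch t (proj₁ σ) ω)

  phaseSketches : ∀ {t ks} → All (λ (_ : ℕ) → PassSeed t) ks → List (State → Sketch n State)
  phaseSketches [] = []
  phaseSketches (ω ∷ ωs) = passSketch ω ∷ phaseSketches ωs

  size-blockSketch : ∀ t i l {k} C₀ (ω : Vec (SamplerSeed t (i , l)) k) → size (blockSketch t (i , l) C₀ ω) ≡ k * rows (Θ t i)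
  size-blockSketch t i l C₀ [] = refl
  size-blockSketch t i l C₀ (s ∷ ω) = trans (size-liftˢ andThen (Sampler.sampler _ _ _ C₀ s) (blockSketch t (i , l) C₀ ω))
    (cong₂ _+_ (Sampler.size-sampler (Θ t i) (suc l) (rows (Θ t i)) C₀ s) (size-blockSketch t i l C₀ ω))

  size-passSketch : ∀ W → (∀ t i → reps (Θ t i) * rows (Θ t i) ≤ W) → ∀ {t} (ω : PassSeed t) σ → size (passSketch ω σ) ≤ length blocks * W
  size-passSketch W h {t} ω σ = go ω
    where
    go : ∀ {ds} (ω : All (BlockSeed t) ds) → size (blocksSketch t (proj₁ σ) ω) ≤ length ds * W
    go [] = z≤n
    go {(i , l) ∷ ds} (ω ∷ ωs) = ℕ.≤-trans (ℕ.≤-reflexive (size-liftˢ andThen (blockSketch t (i , l) (proj₁ σ) ω) (blocksSketch t (proj₁ σ) ωs)))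
      (ℕ.+-mono-≤ (ℕ.≤-trans (ℕ.≤-reflexive (size-blockSketch t i l (proj₁ σ) ω)) (h t i)) (go ωs))

  Short : State → Set
  Short (C , L) = length L ≤ ∣ C ∣

  short-grows : ∀ {θ σ σ′} → 0 < θ → Grows θ σ σ′ → Short σ → Short σ′
  short-grows 0<θ unchanged short = short
  short-grows 0<θ (grown {C} R ν θ≤ _) short = ℕ.≤-trans (ℕ.+-mono-≤ (ℕ.≤-trans 0<θ θ≤) short)
    (ℕ.≤-reflexive (trans (ℕ.+-comm ∣ R ─ C ∣ ∣ C ∣) (sym (∣∪∣ C R))))

  short-block : ∀ t i l {k} C₀ (ω : Vec (SamplerSeed t (i , l)) k) cs σ → Short σ → Short (decode (blockSketch t (i , l) C₀ ω) cs σ)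
  short-block t i l C₀ [] cs σ short = short
  short-block t i l C₀ (s@(fs , φs) ∷ ω) cs σ short = short-block t i l C₀ ω (drop (size first) cs) _
    (short-grows (ℕ.>-nonZero⁻¹ (Θ t i)) (Sampler.respond-grows (Θ t i) (suc l) (rows (Θ t i)) C₀ φs (take (size first) cs) σ) short)
    where
    first = Sampler.sampler (Θ t i) (suc l) (rows (Θ t i)) C₀ s

  short-pass : ∀ {t} (ω : PassSeed t) σ cs → Short σ → Short (decode (passSketch ω σ) cs)
  short-pass {t} ω (C₀ , L) cs short = go ω cs (C₀ , L) short
    where
    go : ∀ {ds} (ω : All (BlockSeed t) ds) cs σ → Short σ → Short (decode (blocksSketch t C₀ ω) cs σ)
    go [] cs σ short = short
    go {(i , l) ∷ ds} (ω ∷ ωs) cs σ short = go ωs (drop (size first) cs) _ (short-block t i l C₀ ω (take (size first) cs) σ short)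
      where
      first = blockSketch t (i , l) C₀ ω

  module Analysis (𝒞 : List (Subset n)) (len≤m : length 𝒞 ≤ m) (m≤2^M : m ≤ 2 ^ M) (n<2^lg : suc n ≤ 2 ^ lg) where

    open Blocks w m cap name 𝒞 len≤m public

    act : ∀ {t} → PassSeed t → State → State
    act ω σ = eval (passSketch ω σ) 𝒞

    actPhase : ∀ {t} → PhaseSeed t → State → State
    actPhase = foldAll act

    eval-blockSketch : ∀ t i l {k} C₀ (ω : Vec (SamplerSeed t (i , l)) k) σ →
      eval (blockSketch t (i , l) C₀ ω) 𝒞 σ ≡ Block.runBlock (Θ t i) (suc l) (rows (Θ t i)) C₀ ω σ
    eval-blockSketch t i l C₀ [] σ = refl
    eval-blockSketch t i l C₀ (s ∷ ω) σ = trans (cong (λ f → f σ) (eval-liftˢ andThen (Sampler.sampler _ _ _ C₀ s) (blockSketch t (i , l) C₀ ω) 𝒞))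
      (eval-blockSketch t i l C₀ ω _)

    few-candidates : ∀ θ → length (candidates θ) ≤ 2 ^ (M + w + lg * (2 * θ ⊓ n))
    few-candidates θ = begin
      length (candidates θ) ≤⟨ length-candidates θ ⟩
      m * (2 ^ w * suc n ^ t) ≤⟨ ℕ.*-mono-≤ m≤2^M (ℕ.*-monoʳ-≤ (2 ^ w) (ℕ.^-monoˡ-≤ t n<2^lg)) ⟩
      2 ^ M * (2 ^ w * (2 ^ lg) ^ t) ≡⟨ cong (λ k → 2 ^ M * (2 ^ w * k)) (ℕ.^-*-assoc 2 lg t) ⟩
      2 ^ M * (2 ^ w * 2 ^ (lg * t)) ≡⟨ sym (ℕ.*-assoc (2 ^ M) (2 ^ w) _) ⟩
      2 ^ M * 2 ^ w * 2 ^ (lg * t) ≡⟨ cong (_* 2 ^ (lg * t)) (sym (ℕ.^-distribˡ-+-* 2 M w)) ⟩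
      2 ^ (M + w) * 2 ^ (lg * t) ≡⟨ sym (ℕ.^-distribˡ-+-* 2 (M + w) (lg * t)) ⟩
      2 ^ (M + w + lg * t) ∎
      where
      open ℕ.≤-Reasoning
      t = 2 * θ ⊓ n

    BlockPrunes : ℕ → Subset n → ℕ × ℕ → State → Set
    BlockPrunes t C₀ (i , l) σ = 2 * length (class (Θ t i) C₀) ≤ 2 ^ suc l → 2 ^ suc l ≤ 4 * length (class (Θ t i) C₀) → Pruned (Θ t i) C₀ σ

    τ≤Θ : ∀ t i → suc t ≤ Θ t i
    τ≤Θ t i = subst (suc t ≤_) (sym (Θ≡ t i)) (ℕ.≤-trans (ℕ.≤-reflexive (sym (ℕ.*-identityʳ (suc t)))) (ℕ.*-monoʳ-≤ (suc t) (ℕ.m^n>0 2 i)))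

    weakenPicks : ∀ {τ θ σ σ′} → τ ≤ θ → Star (Pick 𝒞 θ) σ σ′ → Star (Pick 𝒞 τ) σ σ′
    weakenPicks τ≤θ none = none
    weakenPicks τ≤θ (p ◅ ps) = Pick-weaken τ≤θ p ◅ weakenPicks τ≤θ ps

    atLeast : ℕ → ℕ → Subset n → ℕ
    atLeast t i C = length (filter (λ S → Θ t i ℕ.≤? ∣ S ─ C ∣) 𝒟)

    Full : State → Set
    Full (_ , L) = cap ≤ length L

    length-𝒟 : ∀ {P : Subset n → Set} (P? : ∀ S → Dec (P S)) → length (filter P? 𝒟) ≤ m
    length-𝒟 P? = ℕ.≤-trans (List.length-filter P? 𝒟) (ℕ.≤-trans (List.length-deduplicate _≟ˢ_ 𝒞) len≤m)

    Θ-suc : ∀ t i → Θ t (suc i) ≡ 2 * Θ t i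
    Θ-suc t i = trans (Θ≡ t (suc i)) (trans (lemma (suc t) (2 ^ i)) (cong (2 *_) (sym (Θ≡ t i))))
      where
      lemma : ∀ x y → x * (2 * y) ≡ 2 * (x * y)
      lemma = solve-∀

    pruning : ∀ {t σ₀ σ i} → σ₀ ⊑ σ → (∀ d → d ∈ blocks → BlockPrunes t (proj₁ σ₀) d σ) → i ≤ M →
      Full σ ⊎ 4 * atLeast t i (proj₁ σ) ≤ atLeast t i (proj₁ σ₀) + 4 * atLeast t (suc i) (proj₁ σ₀)
    pruning {t} {σ₀@(C₀ , _)} {σ@(C , _)} {i} σ₀⊑σ prunes i≤M with class-pruned
      where
      class-pruned : Pruned (Θ t i) C₀ σ
      class-pruned with length (class (Θ t i) C₀) in eq
      ... | zero = inj₂ (ℕ.≤-trans (ℕ.*-monoʳ-≤ 4 (ℕ.≤-trans (length-filter-⊆ (survives? (Θ t i) C₀ C) (inClass? (Θ t i) C₀) 𝒟 proj₁) (ℕ.≤-reflexive eq))) z≤n)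
      ... | suc N with level (suc N) M (s≤s z≤n) (ℕ.≤-trans (subst (_≤ m) eq (length-𝒟 (inClass? (Θ t i) C₀))) m≤2^M)
      ... | l , l≤M , N≤ , ≤2N = subst (λ k → cap ≤ length (proj₂ σ) ⊎ 4 * length (survivors (Θ t i) C₀ C) ≤ k) eq
        (prunes (i , l) (Mem.∈-cartesianProduct⁺ (∈-range 0 (suc M) z≤n (s≤s i≤M)) (∈-range 0 (suc M) z≤n (s≤s l≤M)))
          (subst (λ k → 2 * k ≤ 2 ^ suc l) (sym eq) (ℕ.*-monoʳ-≤ 2 N≤))
          (subst (λ k → 2 ^ suc l ≤ 4 * k) (sym eq) (ℕ.≤-trans (ℕ.*-monoʳ-≤ 2 ≤2N) (ℕ.≤-reflexive (sym (ℕ.*-assoc 2 2 (suc N)))))))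
    ... | inj₁ full = inj₁ full
    ... | inj₂ few = inj₂ (begin
      4 * atLeast t i C ≤⟨ ℕ.*-monoʳ-≤ 4 split ⟩
      4 * (length (survivors (Θ t i) C₀ C) + atLeast t (suc i) C₀) ≡⟨ ℕ.*-distribˡ-+ 4 (length (survivors (Θ t i) C₀ C)) _ ⟩
      4 * length (survivors (Θ t i) C₀ C) + 4 * atLeast t (suc i) C₀ ≤⟨ ℕ.+-monoˡ-≤ _ few ⟩
      length (class (Θ t i) C₀) + 4 * atLeast t (suc i) C₀ ≤⟨ ℕ.+-monoˡ-≤ _ (length-filter-⊆ (inClass? (Θ t i) C₀) (λ S → Θ t i ℕ.≤? ∣ S ─ C₀ ∣) 𝒟 proj₁) ⟩
      atLeast t i C₀ + 4 * atLeast t (suc i) C₀ ∎)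
      where
      open ℕ.≤-Reasoning
      split : atLeast t i C ≤ length (survivors (Θ t i) C₀ C) + atLeast t (suc i) C₀
      split = length-filter-⊎ (λ S → Θ t i ℕ.≤? ∣ S ─ C ∣) (survives? (Θ t i) C₀ C) (λ S → Θ t (suc i) ℕ.≤? ∣ S ─ C₀ ∣) 𝒟 (λ {S} → by-size {S})
        where
        by-size : ∀ {S} → Θ t i ≤ ∣ S ─ C ∣ → (InClass (Θ t i) C₀ S × Θ t i ≤ ∣ S ─ C ∣) ⊎ Θ t (suc i) ≤ ∣ S ─ C₀ ∣
        by-size {S} θ≤ with 2 * Θ t i ℕ.≤? ∣ S ─ C₀ ∣
        ... | yes 2θ≤ = inj₂ (ℕ.≤-trans (ℕ.≤-reflexive (Θ-suc t i)) 2θ≤)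
        ... | no 2θ≰ = inj₁ ((ℕ.≤-trans θ≤ (∣─∣-antitone S (proj₁ σ₀⊑σ)) , ℕ.≰⇒> 2θ≰) , θ≤)

    -- Every pass halves the weighted counts, whatever moves down from the next higher class.
    Shrunk : ℕ → ℕ → State → Set
    Shrunk t k (C , _) = ∀ i → i ≤ suc M → 2 ^ k * atLeast t i C ≤ m * 4 ^ (suc M ∸ i)

    Small : ℕ → State → Set
    Small t (C , _) = ∀ S → S ∈ 𝒞 → ∣ S ─ C ∣ < Θ t (suc M)

    Small-mono : ∀ {t σ σ′} → σ ⊑ σ′ → Small t σ → Small t σ′
    Small-mono (C⊆ , _) small S S∈ = ℕ.≤-<-trans (∣─∣-antitone S C⊆) (small S S∈)

    none-atLeast : ∀ {t i C} → (∀ S → S ∈ 𝒞 → ∣ S ─ C ∣ < Θ t i) → atLeast t i C ≡ 0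
    none-atLeast {t} {i} {C} small = cong length (List.filter-none (λ S → Θ t i ℕ.≤? ∣ S ─ C ∣)
      (All.tabulate (λ S∈ → ℕ.<⇒≱ (small _ (∈𝒟⇒∈𝒞 S∈)))))

    shrunk-start : ∀ t σ → Shrunk t 0 σ
    shrunk-start t (C , _) i _ = ℕ.≤-trans (ℕ.≤-reflexive (ℕ.*-identityˡ _)) (ℕ.≤-trans (length-𝒟 (λ S → Θ t i ℕ.≤? ∣ S ─ C ∣))
      (ℕ.≤-trans (ℕ.≤-reflexive (sym (ℕ.*-identityʳ m))) (ℕ.*-monoʳ-≤ m (ℕ.m^n>0 4 (suc M ∸ i)))))

    shrunk-step : ∀ {t k σ₀ σ} → Small t σ₀ → σ₀ ⊑ σ → (∀ d → d ∈ blocks → BlockPrunes t (proj₁ σ₀) d σ) →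
      Shrunk t k σ₀ → Full σ ⊎ Shrunk t (suc k) σ
    shrunk-step {t} {k} {σ₀} {σ} small σ₀⊑σ prunes shrunk with cap ℕ.≤? length (proj₂ σ)
    ... | yes full = inj₁ full
    ... | no ¬full = inj₂ step
      where
      A₀ A : ℕ → ℕ
      A₀ i = atLeast t i (proj₁ σ₀)
      A i = atLeast t i (proj₁ σ)
      step : Shrunk t (suc k) σ
      step i i≤ with i ℕ.≤? M
      ... | no i≰M = subst (λ x → 2 ^ suc k * x ≤ m * 4 ^ (suc M ∸ i)) (sym zeroA) (ℕ.≤-trans (ℕ.≤-reflexive (ℕ.*-zeroʳ (2 ^ suc k))) z≤n)
        where
        zeroA : A i ≡ 0
        zeroA = subst (λ i → A i ≡ 0) (ℕ.≤-antisym (ℕ.≰⇒> i≰M) i≤) (none-atLeast {t} {suc M} (Small-mono {t} {σ₀} {σ} σ₀⊑σ small))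
      ... | yes i≤M with pruning {t} {σ₀} {σ} {i} σ₀⊑σ prunes i≤M
      ... | inj₁ full = contradiction full ¬full
      ... | inj₂ h = ℕ.*-cancelˡ-≤ 4 (begin
        4 * (2 ^ suc k * A i) ≡⟨ lemma₁ (2 ^ k) (A i) ⟩
        2 * (2 ^ k * (4 * A i)) ≤⟨ ℕ.*-monoʳ-≤ 2 (ℕ.*-monoʳ-≤ (2 ^ k) h) ⟩
        2 * (2 ^ k * (A₀ i + 4 * A₀ (suc i))) ≡⟨ lemma₂ (2 ^ k) (A₀ i) (A₀ (suc i)) ⟩
        2 * (2 ^ k * A₀ i) + 8 * (2 ^ k * A₀ (suc i)) ≤⟨ ℕ.+-mono-≤ (ℕ.*-monoʳ-≤ 2 (shrunk i i≤)) (ℕ.*-monoʳ-≤ 8 (shrunk (suc i) (s≤s i≤M))) ⟩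
        2 * (m * 4 ^ (suc M ∸ i)) + 8 * (m * 4 ^ (M ∸ i)) ≡⟨ cong (λ e → 2 * (m * 4 ^ e) + 8 * (m * 4 ^ (M ∸ i))) (ℕ.+-∸-assoc 1 i≤M) ⟩
        2 * (m * (4 * 4 ^ (M ∸ i))) + 8 * (m * 4 ^ (M ∸ i)) ≡⟨ lemma₃ m (4 ^ (M ∸ i)) ⟩
        4 * (m * (4 * 4 ^ (M ∸ i))) ≡⟨ cong (λ e → 4 * (m * 4 ^ e)) (sym (ℕ.+-∸-assoc 1 i≤M)) ⟩
        4 * (m * 4 ^ (suc M ∸ i)) ∎)
        where
        open ℕ.≤-Reasoning
        lemma₁ : ∀ x y → 4 * ((2 * x) * y) ≡ 2 * (x * (4 * y))
        lemma₁ = solve-∀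
        lemma₂ : ∀ x y z → 2 * (x * (y + 4 * z)) ≡ 2 * (x * y) + 8 * (x * z)
        lemma₂ = solve-∀
        lemma₃ : ∀ x y → 2 * (x * (4 * y)) + 8 * (x * y) ≡ 4 * (x * (4 * y))
        lemma₃ = solve-∀

    shrunk-end : ∀ {t σ} → Shrunk t (3 + 3 * M) σ → ∀ S → S ∈ 𝒞 → ∣ S ─ proj₁ σ ∣ ≤ t
    shrunk-end {t} {σ@(C , _)} shrunk S S∈ = ℕ.≮⇒≥ λ t< → contradiction (present t<) (ℕ.≤⇒≯ (ℕ.m<1+n⇒m≤n empty))
      where
      present : t < ∣ S ─ C ∣ → 0 < atLeast t 0 C
      present t< = ∈⇒0<length (Mem.∈-filter⁺ (λ S → Θ t 0 ℕ.≤? ∣ S ─ C ∣) (∈𝒞⇒∈𝒟 S∈) (ℕ.≤-trans (ℕ.≤-reflexive (trans (Θ≡ t 0) (ℕ.*-identityʳ (suc t)))) t<))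
        where
        ∈⇒0<length : ∀ {A : Set} {x : A} {xs} → x ∈ xs → 0 < length xs
        ∈⇒0<length (here _) = s≤s z≤n
        ∈⇒0<length (there _) = s≤s z≤n
      empty : atLeast t 0 C < 1
      empty = ℕ.*-cancelˡ-< (2 ^ (3 + 3 * M)) _ _ (begin-strict
        2 ^ (3 + 3 * M) * atLeast t 0 C ≤⟨ shrunk 0 z≤n ⟩
        m * 4 ^ suc M ≤⟨ ℕ.*-monoˡ-≤ (4 ^ suc M) m≤2^M ⟩
        2 ^ M * 4 ^ suc M ≡⟨ cong (2 ^ M *_) (ℕ.^-*-assoc 2 2 (suc M)) ⟩
        2 ^ M * 2 ^ (2 * suc M) ≡⟨ sym (ℕ.^-distribˡ-+-* 2 M (2 * suc M)) ⟩
        2 ^ (M + 2 * suc M) <⟨ ℕ.^-monoʳ-< 2 (s≤s (s≤s z≤n)) (ℕ.≤-reflexive (exponent M)) ⟩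
        2 ^ (3 + 3 * M) ≡⟨ sym (ℕ.*-identityʳ _) ⟩
        2 ^ (3 + 3 * M) * 1 ∎)
        where
        open ℕ.≤-Reasoning
        exponent : ∀ M → 1 + (M + 2 * (1 + M)) ≡ 3 + 3 * M
        exponent = solve-∀

    module _ (δ : ℚ) (δ-large : ∀ θ .{{_ : NonZero θ}} → fromℕ (reps θ) ℚ.* ½^ a′ ℚ.+ ½^ a ℚ.≤ δ) where

      0≤δ : 0ℚ ℚ.≤ δ
      0≤δ = ℚ.≤-trans (0≤+ℚ (0≤*ℚ (0≤fromℕ (reps 1)) (0≤½^ a′)) (0≤½^ a)) (δ-large 1)

      fail-blocks : ∀ t C₀ ds σ → C₀ Sub.⊆ proj₁ σ → Fail (drawAll (drawBlock t) ds)
        (λ ω → let σ′ = eval (blocksSketch t C₀ ω) 𝒞 σ in Star (Pick 𝒞 (suc t)) σ σ′ × (∀ d → d ∈ ds → BlockPrunes t C₀ d σ′)) (fromℕ (length ds) ℚ.* δ)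
      fail-blocks t C₀ [] σ C₀⊆ = success (none , λ d ()) (ℚ.≤-reflexive (sym (ℚ.*-zeroˡ δ)))
      fail-blocks t C₀ ((i , l) ∷ ds) σ C₀⊆ = fail-weaken _ (λ _ h → h)
        (ℚ.≤-reflexive (sym (fromℕ-suc-* (length ds) δ)))
        (fail-bind (drawBlock t (i , l)) _
          (fail-weaken _ (λ _ h → h) (δ-large (Θ t i)) (fail-block a σ C₀⊆ (few-candidates (Θ t i)) a′ refl))
          (0≤*ℚ (0≤fromℕ (length ds)) 0≤δ) later)
        where
        open Block (Θ t i) (suc l) (rows (Θ t i)) C₀
        later : ∀ (ω : BlockSeed t (i , l)) → _ → Fail (drawAll (drawBlock t) ds >>= λ ωs → return (_∷_ {P = BlockSeed t} {x = i , l} ω ωs)) _ _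
        later ω (faithful , prunes) = fail-map (drawAll (drawBlock t) ds) (ω ∷_)
          (fail-weaken _ combine ℚ.≤-refl (fail-blocks t C₀ ds σ₁ C₀⊆₁))
          where
          σ₁ = runBlock ω σ
          picks = runBlock-picks ω σ C₀⊆ faithful
          C₀⊆₁ : C₀ Sub.⊆ proj₁ σ₁
          C₀⊆₁ x∈ = proj₁ (Picks-⊑ picks) (C₀⊆ x∈)
          combine : ∀ ωs → let σ₂ = eval (blocksSketch t C₀ ωs) 𝒞 σ₁ ; σ′ = eval (blocksSketch t C₀ (_∷_ {x = i , l} ω ωs)) 𝒞 σ in
            Star (Pick 𝒞 (suc t)) σ₁ σ₂ × (∀ d → d ∈ ds → BlockPrunes t C₀ d σ₂) →
            Star (Pick 𝒞 (suc t)) σ σ′ × (∀ d → d ∈ (i , l) ∷ ds → BlockPrunes t C₀ d σ′)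
          combine ωs (picks′ , prunes′) = subst (λ σ′ → Star (Pick 𝒞 (suc t)) σ σ′ × (∀ d → d ∈ (i , l) ∷ ds → BlockPrunes t C₀ d σ′))
            (sym (trans (cong (λ f → f σ) (eval-liftˢ andThen (blockSketch t (i , l) C₀ ω) (blocksSketch t C₀ ωs) 𝒞))
              (cong (eval (blocksSketch t C₀ ωs) 𝒞) (eval-blockSketch t i l C₀ ω σ))))
            (weakenPicks (τ≤Θ t i) picks ◅◅ picks′ ,
             λ { d (here refl) → λ p q → Pruned-mono {Θ t i} {C₀} {σ₁} {eval (blocksSketch t C₀ ωs) 𝒞 σ₁} (Picks-⊑ picks′) (prunes p q) ; d (there d∈) → prunes′ d d∈ })

      δ-pass : ℚ
      δ-pass = fromℕ (length blocks) ℚ.* δ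

      0≤δ-pass : 0ℚ ℚ.≤ δ-pass
      0≤δ-pass = 0≤*ℚ (0≤fromℕ (length blocks)) 0≤δ

      fail-phase : ∀ t σ₀ → Fail (drawPhase t) (λ ω → let σ = actPhase ω σ₀ in
        Star (Pick 𝒞 (suc t)) σ₀ σ × (Small t σ₀ → Full σ ⊎ (∀ S → S ∈ 𝒞 → ∣ S ─ proj₁ σ ∣ ≤ t))) (fromℕ (3 + 3 * M) ℚ.* δ-pass)
      fail-phase t σ₀ = fail-weaken (drawPhase t) (λ ω → finish (actPhase ω σ₀)) ℚ.≤-refl
        (fail-range (λ _ → drawPass t) act Inv 0≤δ-pass onePass (3 + 3 * M) 0 σ₀ (none , λ _ → inj₂ (shrunk-start t σ₀)))
        where
        Inv : ℕ → State → Set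
        Inv k σ = Star (Pick 𝒞 (suc t)) σ₀ σ × (Small t σ₀ → Full σ ⊎ Shrunk t k σ)
        finish : ∀ σ → Inv (3 + 3 * M) σ → Star (Pick 𝒞 (suc t)) σ₀ σ × (Small t σ₀ → Full σ ⊎ (∀ S → S ∈ 𝒞 → ∣ S ─ proj₁ σ ∣ ≤ t))
        finish σ (picks , h) = picks , λ small → case h small of λ { (inj₁ full) → inj₁ full ; (inj₂ shrunk) → inj₂ (shrunk-end {t} {σ} shrunk) }
        onePass : ∀ k σ → Inv k σ → Fail (drawPass t) (λ ω → Inv (suc k) (act ω σ)) δ-pass
        onePass k σ (picks , h) = fail-weaken (drawPass t) (λ ω → step (act ω σ)) ℚ.≤-refl (fail-blocks t (proj₁ σ) blocks σ (λ x∈ → x∈))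
          where
          step : ∀ σ′ → Star (Pick 𝒞 (suc t)) σ σ′ × (∀ d → d ∈ blocks → BlockPrunes t (proj₁ σ) d σ′) → Inv (suc k) σ′
          step σ′ (picks′ , prunes) = picks ◅◅ picks′ , λ small → case h small of λ
            { (inj₁ full) → inj₁ (ℕ.≤-trans full (proj₂ (Picks-⊑ picks′)))
            ; (inj₂ shrunk) → shrunk-step {t} {k} {σ} {σ′} (Small-mono {t} {σ₀} {σ} (Picks-⊑ picks) small) (Picks-⊑ picks′) prunes shrunk }

∣∪─∣≤ : ∀ {n} (S U C : Subset n) → ∣ (S ∪ U) ─ C ∣ ≤ ∣ S ─ C ∣ + ∣ U ─ C ∣
∣∪─∣≤ [] [] [] = z≤n
∣∪─∣≤ (s ∷ S) (u ∷ U) (true ∷ C) = ∣∪─∣≤ S U C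
∣∪─∣≤ (true ∷ S) (true ∷ U) (false ∷ C) = s≤s (ℕ.≤-trans (∣∪─∣≤ S U C) (ℕ.+-monoʳ-≤ _ (ℕ.n≤1+n _)))
∣∪─∣≤ (true ∷ S) (false ∷ U) (false ∷ C) = s≤s (∣∪─∣≤ S U C)
∣∪─∣≤ (false ∷ S) (true ∷ U) (false ∷ C) = ℕ.≤-trans (s≤s (∣∪─∣≤ S U C)) (ℕ.≤-reflexive (sym (ℕ.+-suc _ _)))
∣∪─∣≤ (false ∷ S) (false ∷ U) (false ∷ C) = ∣∪─∣≤ S U C

∣⊥─∣≡0 : ∀ {n} (C : Subset n) → ∣ Sub.⊥ ─ C ∣ ≡ 0
∣⊥─∣≡0 [] = refl
∣⊥─∣≡0 (true ∷ C) = ∣⊥─∣≡0 C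
∣⊥─∣≡0 (false ∷ C) = ∣⊥─∣≡0 C

∣─∣-gap : ∀ {n} (U C : Subset n) → ∣ U ∣ ∸ ∣ C ∣ ≤ ∣ U ─ C ∣
∣─∣-gap U C = ℕ.m≤n+o⇒m∸n≤o ∣ U ∣ ∣ C ∣ (ℕ.≤-trans (Sub.p⊆q⇒∣p∣≤∣q∣ (Sub.q⊆p∪q C U)) (ℕ.≤-reflexive (∣∪∣ C U)))

coverage-gap : ∀ {n} a b (C : Subset n) 𝒯 → (∀ {S} → S ∈ 𝒯 → a * ∣ S ─ C ∣ ≤ b) → a * (coverage 𝒯 ∸ ∣ C ∣) ≤ length 𝒯 * b
coverage-gap a b C 𝒯 small = ℕ.≤-trans (ℕ.*-monoʳ-≤ a (∣─∣-gap (⋃ 𝒯) C)) (go 𝒯 small)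
  where
  go : ∀ 𝒯 → (∀ {S} → S ∈ 𝒯 → a * ∣ S ─ C ∣ ≤ b) → a * ∣ ⋃ 𝒯 ─ C ∣ ≤ length 𝒯 * b
  go [] _ = ℕ.≤-reflexive (trans (cong (a *_) (∣⊥─∣≡0 C)) (ℕ.*-zeroʳ a))
  go (S ∷ 𝒯) small = begin
    a * ∣ (S ∪ ⋃ 𝒯) ─ C ∣ ≤⟨ ℕ.*-monoʳ-≤ a (∣∪─∣≤ S (⋃ 𝒯) C) ⟩
    a * (∣ S ─ C ∣ + ∣ ⋃ 𝒯 ─ C ∣) ≡⟨ ℕ.*-distribˡ-+ a (∣ S ─ C ∣) _ ⟩
    a * ∣ S ─ C ∣ + a * ∣ ⋃ 𝒯 ─ C ∣ ≤⟨ ℕ.+-mono-≤ (small (here refl)) (go 𝒯 (small ∘ there)) ⟩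
    b + length 𝒯 * b ∎
    where open ℕ.≤-Reasoning

p^k[p+k]≤p[1+p]^k : ∀ p k → p ^ k * (p + k) ≤ p * suc p ^ k
p^k[p+k]≤p[1+p]^k p zero = ℕ.≤-reflexive (lemma p)
  where
  lemma : ∀ p → 1 * (p + 0) ≡ p * 1
  lemma = solve-∀
p^k[p+k]≤p[1+p]^k p (suc k) = begin
  p * p ^ k * (p + suc k) ≡⟨ lemma p k (p ^ k) ⟩
  p * (p ^ k * (p + k)) + p * p ^ k ≤⟨ ℕ.+-mono-≤ (ℕ.*-monoʳ-≤ p (p^k[p+k]≤p[1+p]^k p k)) (ℕ.*-monoʳ-≤ p (ℕ.^-monoˡ-≤ k (ℕ.n≤1+n p))) ⟩
  p * (p * suc p ^ k) + p * suc p ^ k ≡⟨ lemma′ p (suc p ^ k) ⟩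
  p * (suc p * suc p ^ k) ∎
  where
  open ℕ.≤-Reasoning
  lemma : ∀ p k x → p * x * (p + (1 + k)) ≡ p * (x * (p + k)) + p * x
  lemma = solve-∀
  lemma′ : ∀ p y → p * (p * y) + p * y ≡ p * ((1 + p) * y)
  lemma′ = solve-∀

2p^q≤q^q : ∀ p .{{_ : NonZero p}} → 2 * p ^ suc p ≤ suc p ^ suc p
2p^q≤q^q p = ℕ.*-cancelˡ-≤ p (begin
  p * (2 * p ^ suc p) ≡⟨ lemma p (p ^ suc p) ⟩
  p ^ suc p * (p + p) ≤⟨ ℕ.*-monoʳ-≤ (p ^ suc p) (ℕ.+-monoʳ-≤ p (ℕ.n≤1+n p)) ⟩
  p ^ suc p * (p + suc p) ≤⟨ p^k[p+k]≤p[1+p]^k p (suc p) ⟩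
  p * suc p ^ suc p ∎)
  where
  open ℕ.≤-Reasoning
  lemma : ∀ p x → p * (2 * x) ≡ x * (p + p)
  lemma = solve-∀

8p^3q≤q^3q : ∀ p .{{_ : NonZero p}} → 8 * p ^ (3 * suc p) ≤ suc p ^ (3 * suc p)
8p^3q≤q^3q p = begin
  8 * p ^ (3 * q) ≡⟨ cong (8 *_) (cube p) ⟩
  8 * (x * (x * (x * 1))) ≡⟨ lemma x ⟩
  2 * x * (2 * x * (2 * x * 1)) ≤⟨ ℕ.*-mono-≤ h (ℕ.*-mono-≤ h (ℕ.*-mono-≤ h (ℕ.≤-refl {1}))) ⟩
  y * (y * (y * 1)) ≡⟨ sym (cube q) ⟩
  q ^ (3 * q) ∎
  where
  open ℕ.≤-Reasoning
  q = suc p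
  x = p ^ q
  y = q ^ q
  h = 2p^q≤q^q p
  cube : ∀ b → b ^ (3 * q) ≡ b ^ q * (b ^ q * (b ^ q * 1))
  cube b = trans (cong (b ^_) (ℕ.*-comm 3 q)) (sym (ℕ.^-*-assoc b q 3))
  lemma : ∀ x → 8 * (x * (x * (x * 1))) ≡ 2 * x * (2 * x * (2 * x * 1))
  lemma = solve-∀

nth : ∀ {A : Set} → A → List A → ℕ → A
nth x [] i = x
nth x (y ∷ ys) zero = y
nth x (y ∷ ys) (suc i) = nth x ys i

iterate-nth : ∀ {n} {A : Set} 𝒞 (d : A → Sketch n A) fs x →
  iterate 𝒞 (nth d fs) 0 (length fs) x ≡ List.foldl (λ x f → eval (f x) 𝒞) x fs
iterate-nth 𝒞 d [] x = refl
iterate-nth 𝒞 d (f ∷ fs) x = trans (iterate-shift 𝒞 (nth d (f ∷ fs)) (nth d fs) 1 0 (length fs) (eval (f x) 𝒞) (λ _ → refl))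
  (iterate-nth 𝒞 d fs (eval (f x) 𝒞))

SoundFor : ∀ {n w} → List (Subset n) → ℕ → (Subset n → Vec Bool w) → Subset n × List (Vec Bool w) → Set
SoundFor 𝒞 cap name (C , L) = length L ≤ cap × length L ≤ ∣ C ∣ × (∀ {x} → x Sub.∈ C → ∃[ S ] S ∈ 𝒞 × name S ∈ L × x Sub.∈ S)

-- Here c is the coverage of a greedy choice: either all cap picks have been made, each with a gain of
-- at least (p/q) (opt - c) / cap for q = p + 1, or no gain above opt / (4 cap) is left.
Guarantee : (p cap opt c : ℕ) → Set
Guarantee p cap opt c = (suc p * cap) ^ cap * (opt ∸ c) ≤ (suc p * cap ∸ p) ^ cap * opt ⊎ 4 * (opt ∸ c) ≤ opt

-- threshold g j + 1 is the least natural number above 2^(g+1) (p/q)^j / cap, where q = p + 1.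
module Guess {n} (w m cap M lg a a′ p : ℕ) (name : Subset n → Vec Bool w) where

  open Algorithm w m cap M lg a a′ name public

  q : ℕ
  q = suc p

  -- cap = 0 would be a division by zero.
  denominator : ℕ → ℕ
  denominator j = pred (cap * q ^ j)

  threshold : ℕ → ℕ → ℕ
  threshold g j = (2 ^ suc g * p ^ j) ℕ./ suc (denominator j)

  phases : List ℕ
  phases = range 0 (suc (3 * q))

  GuessSeed : ℕ → Set
  GuessSeed g = All (λ j → PhaseSeed (threshold g j)) phases

  drawGuess : ∀ g → Rand (GuessSeed g)
  drawGuess g = drawAll (λ j → drawPhase (threshold g j)) phases

  guessSketches : ∀ g {js} → All (λ j → PhaseSeed (threshold g j)) js → List (State → Sketch n State)
  guessSketches g [] = []
  guessSketches g (ω ∷ ωs) = phaseSketches ω ++ guessSketches g ωs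

  σ₀ : State
  σ₀ = Sub.⊥ , []

  length-phaseSketches : ∀ {t ks} (ω : All (λ (_ : ℕ) → PassSeed t) ks) → length (phaseSketches ω) ≡ length ks
  length-phaseSketches [] = refl
  length-phaseSketches (_ ∷ ω) = cong suc (length-phaseSketches ω)

  length-guessSketches : ∀ g {js} (ω : All (λ j → PhaseSeed (threshold g j)) js) → length (guessSketches g ω) ≡ length js * (3 + 3 * M)
  length-guessSketches g [] = refl
  length-guessSketches g (ω ∷ ωs) = trans (List.length-++ (phaseSketches ω))
    (cong₂ _+_ (trans (length-phaseSketches ω) (length-range 0 (3 + 3 * M))) (length-guessSketches g ωs))

  size-guessSketches : ∀ W → (∀ t i → reps (Θ t i) * rows (Θ t i) ≤ W) → ∀ g {js} (ω : All (λ j → PhaseSeed (threshold g j)) js) →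
    All (λ f → ∀ σ → size (f σ) ≤ length blocks * W) (guessSketches g ω)
  size-guessSketches W h g [] = []
  size-guessSketches W h g (ω ∷ ωs) = AllP.++⁺ (one ω) (size-guessSketches W h g ωs)
    where
    one : ∀ {t ks} (ω : All (λ (_ : ℕ) → PassSeed t) ks) → All (λ f → ∀ σ → size (f σ) ≤ length blocks * W) (phaseSketches ω)
    one [] = []
    one (ω ∷ ωs) = size-passSketch W h ω ∷ one ωs

  short-guess : ∀ g {js} (ω : All (λ j → PhaseSeed (threshold g j)) js) →
    All (λ f → ∀ σ cs → Short σ → Short (decode (f σ) cs)) (guessSketches g ω)
  short-guess g [] = []
  short-guess g (ω ∷ ωs) = AllP.++⁺ (one ω) (short-guess g ωs)
    where
    one : ∀ {t ks} (ω : All (λ (_ : ℕ) → PassSeed t) ks) → All (λ f → ∀ σ cs → Short σ → Short (decode (f σ) cs)) (phaseSketches ω)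
    one [] = []
    one (ω ∷ ωs) = short-pass ω ∷ one ωs

  module GuessAnalysis (𝒞 : List (Subset n)) (len≤m : length 𝒞 ≤ m) (m≤2^M : m ≤ 2 ^ M) (n<2^lg : suc n ≤ 2 ^ lg)
    (δ : ℚ) (δ-large : ∀ θ .{{_ : NonZero θ}} → fromℕ (reps θ) ℚ.* ½^ a′ ℚ.+ ½^ a ℚ.≤ δ) where

    open Analysis 𝒞 len≤m m≤2^M n<2^lg public

    actGuess : ∀ g {js} → All (λ j → PhaseSeed (threshold g j)) js → State → State
    actGuess g = foldAll actPhase

    foldl-guessSketches : ∀ g {js} (ω : All (λ j → PhaseSeed (threshold g j)) js) σ →
      List.foldl (λ σ f → eval (f σ) 𝒞) σ (guessSketches g ω) ≡ actGuess g ω σ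
    foldl-guessSketches g [] σ = refl
    foldl-guessSketches g (ω ∷ ωs) σ = trans (List.foldl-++ (λ σ f → eval (f σ) 𝒞) σ (phaseSketches ω) (guessSketches g ωs))
      (trans (cong (λ σ → List.foldl (λ σ f → eval (f σ) 𝒞) σ (guessSketches g ωs)) (phase ω σ)) (foldl-guessSketches g ωs (actPhase ω σ)))
      where
      phase : ∀ {t ks} (ω : All (λ (_ : ℕ) → PassSeed t) ks) σ → List.foldl (λ σ f → eval (f σ) 𝒞) σ (phaseSketches ω) ≡ foldAll act ω σ
      phase [] σ = refl
      phase (ω ∷ ωs) σ = phase ωs (act ω σ)

    Sound : State → Set
    Sound = SoundFor 𝒞 cap name

    sound-start : Sound σ₀
    sound-start = z≤n , z≤n , λ x∈ → contradiction x∈ Sub.∉⊥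

    sound-pick : ∀ {t σ σ′} → Pick 𝒞 (suc t) σ σ′ → Sound σ → Sound σ′
    sound-pick (pick {C} {L} S S∈ τ≤ len<) (_ , ≤C , covered) = len< ,
      ℕ.≤-trans (ℕ.≤-trans (s≤s ≤C) (ℕ.≤-reflexive (ℕ.+-comm 1 ∣ C ∣))) (ℕ.≤-trans (ℕ.+-monoʳ-≤ ∣ C ∣ (ℕ.≤-trans (s≤s z≤n) τ≤)) (ℕ.≤-reflexive (sym (∣∪∣ C S)))) ,
      λ x∈ → case Sub.x∈p∪q⁻ C S x∈ of λ
        { (inj₁ x∈C) → let (S′ , S′∈ , ν∈ , x∈S′) = covered x∈C in S′ , S′∈ , there ν∈ , x∈S′
        ; (inj₂ x∈S) → S , S∈ , here refl , x∈S }

    sound-picks : ∀ {t σ σ′} → Star (Pick 𝒞 (suc t)) σ σ′ → Sound σ → Sound σ′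
    sound-picks none sound = sound
    sound-picks (p ◅ ps) sound = sound-picks ps (sound-pick p sound)

    δ-phase : ℚ
    δ-phase = fromℕ (3 + 3 * M) ℚ.* δ-pass δ δ-large

    0≤δ-phase : 0ℚ ℚ.≤ δ-phase
    0≤δ-phase = 0≤*ℚ (0≤fromℕ (3 + 3 * M)) (0≤δ-pass δ δ-large)

    fail-sound : ∀ g → Fail (drawGuess g) (λ ω → Sound (actGuess g ω σ₀)) (fromℕ (suc (3 * q)) ℚ.* δ-phase)
    fail-sound g = fail-range (λ j → drawPhase (threshold g j)) actPhase (λ _ → Sound) 0≤δ-phase
      (λ j σ sound → fail-weaken (drawPhase (threshold g j)) (λ ω (picks , _) → sound-picks picks sound) ℚ.≤-refl
        (fail-phase δ δ-large (threshold g j) σ)) (suc (3 * q)) 0 σ₀ sound-start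

    module Right (0<p : 0 < p) (0<cap : 0 < cap) (cap≤m : cap ≤ m) (𝒯 : List (Subset n)) (𝒯⊆𝒞 : ∀ {S} → S ∈ 𝒯 → S ∈ 𝒞) (len𝒯 : length 𝒯 ≤ cap)
      (single : ∀ {S} → S ∈ 𝒞 → ∣ S ∣ ≤ coverage 𝒯) (g : ℕ) (2^g≤opt : 2 ^ g ≤ coverage 𝒯) (opt<2^1+g : coverage 𝒯 < 2 ^ suc g) where

      opt = coverage 𝒯

      instance
        cap≢0 : NonZero cap
        cap≢0 = ℕ.>-nonZero 0<cap
        p≢0 : NonZero p
        p≢0 = ℕ.>-nonZero 0<p

      denominator≡ : ∀ j → suc (denominator j) ≡ cap * q ^ j
      denominator≡ j = ℕ.suc-pred (cap * q ^ j) {{ℕ.m*n≢0 cap (q ^ j) {{cap≢0}} {{ℕ.m^n≢0 q j}}}}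

      threshold≤ : ∀ {j x} → x ≤ threshold g j → x * (cap * q ^ j) ≤ 2 ^ suc g * p ^ j
      threshold≤ {j} {x} x≤ = subst (λ d → x * d ≤ 2 ^ suc g * p ^ j) (denominator≡ j)
        (ℕ.≤-trans (ℕ.*-monoˡ-≤ (suc (denominator j)) x≤) (ℕ.m/n*n≤m (2 ^ suc g * p ^ j) (suc (denominator j))))

      <threshold : ∀ j → 2 ^ suc g * p ^ j < suc (threshold g j) * (cap * q ^ j)
      <threshold j = subst (λ d → X < suc (threshold g j) * d) (denominator≡ j)
        (ℕ.≤-trans (s≤s (ℕ.≤-reflexive (ℕ.m≡m%n+[m/n]*n X d))) (ℕ.+-monoˡ-≤ (X ℕ./ d * d) (ℕ.m%n<n X d)))
        where
        X = 2 ^ suc g * p ^ j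
        d = suc (denominator j)

      Greedy : State → Set
      Greedy (C , L) = (q * cap) ^ length L * (opt ∸ ∣ C ∣) ≤ (q * cap ∸ p) ^ length L * opt

      Gap : ℕ → State → Set
      Gap j (C , _) = p * (opt ∸ ∣ C ∣) ≤ cap * (q * suc (threshold g j))

      gap-mono : ∀ {j σ σ′} → σ ⊑ σ′ → Gap j σ → Gap j σ′
      gap-mono (C⊆ , _) gap = ℕ.≤-trans (ℕ.*-monoʳ-≤ p (ℕ.∸-monoʳ-≤ opt (Sub.p⊆q⇒∣p∣≤∣q∣ C⊆))) gap

      greedy-pick : ∀ {j σ σ′} → Gap j σ → Pick 𝒞 (suc (threshold g j)) σ σ′ → Greedy σ → Greedy σ′
      greedy-pick {j} gap (pick {C} {L} S S∈ τ≤ _) greedy = begin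
        B * B ^ l * (opt ∸ ∣ C ∪ S ∣) ≡⟨ lemma B (B ^ l) (opt ∸ ∣ C ∪ S ∣) ⟩
        B ^ l * (B * (opt ∸ ∣ C ∪ S ∣)) ≤⟨ ℕ.*-monoʳ-≤ (B ^ l) gain ⟩
        B ^ l * ((B ∸ p) * D) ≡⟨ lemma′ (B ^ l) (B ∸ p) D ⟩
        (B ∸ p) * (B ^ l * D) ≤⟨ ℕ.*-monoʳ-≤ (B ∸ p) greedy ⟩
        (B ∸ p) * ((B ∸ p) ^ l * opt) ≡⟨ sym (ℕ.*-assoc (B ∸ p) ((B ∸ p) ^ l) opt) ⟩
        (B ∸ p) * (B ∸ p) ^ l * opt ∎
        where
        open ℕ.≤-Reasoning
        B = q * cap
        l = length L
        D = opt ∸ ∣ C ∣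
        x = ∣ S ─ C ∣
        lemma : ∀ a b c → a * b * c ≡ b * (a * c)
        lemma = solve-∀
        lemma′ : ∀ a b c → a * (b * c) ≡ b * (a * c)
        lemma′ = solve-∀
        lemma″ : ∀ a b c → a * (b * c) ≡ b * a * c
        lemma″ = solve-∀
        gain : B * (opt ∸ ∣ C ∪ S ∣) ≤ (B ∸ p) * D
        gain = begin
          B * (opt ∸ ∣ C ∪ S ∣) ≡⟨ cong (λ k → B * (opt ∸ k)) (∣∪∣ C S) ⟩
          B * (opt ∸ (∣ C ∣ + x)) ≡⟨ cong (B *_) (sym (ℕ.∸-+-assoc opt ∣ C ∣ x)) ⟩
          B * (D ∸ x) ≡⟨ ℕ.*-distribˡ-∸ B D x ⟩
          B * D ∸ B * x ≤⟨ ℕ.∸-monoʳ-≤ (B * D) (ℕ.≤-trans gap (ℕ.≤-trans (ℕ.*-monoʳ-≤ cap (ℕ.*-monoʳ-≤ q τ≤)) (ℕ.≤-reflexive (lemma″ cap q x)))) ⟩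
          B * D ∸ p * D ≡⟨ sym (ℕ.*-distribʳ-∸ D B p) ⟩
          (B ∸ p) * D ∎

      greedy-picks : ∀ {j σ σ′} → Gap j σ → Star (Pick 𝒞 (suc (threshold g j))) σ σ′ → Greedy σ → Greedy σ′
      greedy-picks gap none greedy = greedy
      greedy-picks {j} {σ} gap (_◅_ {j = σ″} p ps) greedy = greedy-picks {j} (gap-mono {j} {σ} {σ″} (Pick-⊑ p) gap) ps (greedy-pick {j} gap p greedy)

      full-stuck : ∀ {τ σ σ′} → Full σ → Star (Pick 𝒞 τ) σ σ′ → σ ≡ σ′
      full-stuck full none = refl
      full-stuck full (pick _ _ _ len< ◅ _) = contradiction len< (ℕ.≤⇒≯ full)

      Entry : ℕ → State → Set
      Entry zero σ = σ ≡ σ₀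
      Entry (suc j) (C , _) = ∀ S → S ∈ 𝒞 → ∣ S ─ C ∣ ≤ threshold g j

      opt<τ₀ : opt < suc (threshold g 0) * cap
      opt<τ₀ = begin-strict
        opt <⟨ opt<2^1+g ⟩
        2 ^ suc g ≡⟨ sym (ℕ.*-identityʳ (2 ^ suc g)) ⟩
        2 ^ suc g * 1 <⟨ <threshold 0 ⟩
        suc (threshold g 0) * (cap * 1) ≡⟨ cong (suc (threshold g 0) *_) (ℕ.*-identityʳ cap) ⟩
        suc (threshold g 0) * cap ∎
        where open ℕ.≤-Reasoning

      next : ∀ {j x} → x ≤ threshold g j → p * x < q * suc (threshold g (suc j))
      next {j} {x} x≤ = ℕ.*-cancelʳ-< (cap * q ^ j) _ _ (begin-strict
        p * x * (cap * q ^ j) ≡⟨ ℕ.*-assoc p x (cap * q ^ j) ⟩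
        p * (x * (cap * q ^ j)) ≤⟨ ℕ.*-monoʳ-≤ p (threshold≤ {j} x≤) ⟩
        p * (2 ^ suc g * p ^ j) ≡⟨ lemma₁ p (2 ^ suc g) (p ^ j) ⟩
        2 ^ suc g * p ^ suc j <⟨ <threshold (suc j) ⟩
        suc t′ * (cap * q ^ suc j) ≡⟨ lemma₂ (suc t′) cap q (q ^ j) ⟩
        q * suc t′ * (cap * q ^ j) ∎)
        where
        open ℕ.≤-Reasoning
        t′ = threshold g (suc j)
        lemma₁ : ∀ a b c → a * (b * c) ≡ b * (a * c)
        lemma₁ = solve-∀
        lemma₂ : ∀ a b c d → a * (b * (c * d)) ≡ c * a * (b * d)
        lemma₂ = solve-∀

      entry-small : ∀ j σ → Entry j σ → Small (threshold g j) σ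
      entry-small zero σ refl S S∈ = subst (∣ S ─ Sub.⊥ ∣ <_) (sym (Θ≡ (threshold g 0) (suc M))) (begin-strict
        ∣ S ─ Sub.⊥ ∣ ≤⟨ ℕ.≤-trans (Sub.∣p─q∣≤∣p∣ S Sub.⊥) (single S∈) ⟩
        opt <⟨ opt<τ₀ ⟩
        suc (threshold g 0) * cap ≤⟨ ℕ.*-monoʳ-≤ (suc (threshold g 0)) (ℕ.≤-trans cap≤m (ℕ.≤-trans m≤2^M (ℕ.^-monoʳ-≤ 2 (ℕ.n≤1+n M)))) ⟩
        suc (threshold g 0) * 2 ^ suc M ∎)
        where open ℕ.≤-Reasoning
      entry-small (suc j) (C , _) small S S∈ = subst (∣ S ─ C ∣ <_) (sym (Θ≡ t′ (suc M))) (ℕ.*-cancelˡ-< p _ _ (begin-strict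
        p * ∣ S ─ C ∣ <⟨ next {j} (small S S∈) ⟩
        q * suc t′ ≤⟨ ℕ.*-monoˡ-≤ (suc t′) (ℕ.≤-trans (ℕ.+-monoˡ-≤ p 0<p) (ℕ.≤-reflexive (cong (_+_ p) (sym (ℕ.+-identityʳ p))))) ⟩
        2 * p * suc t′ ≡⟨ lemma p (suc t′) ⟩
        p * (suc t′ * 2) ≤⟨ ℕ.*-monoʳ-≤ p (ℕ.*-monoʳ-≤ (suc t′) (ℕ.*-monoʳ-≤ 2 (ℕ.m^n>0 2 M))) ⟩
        p * (suc t′ * 2 ^ suc M) ∎))
        where
        open ℕ.≤-Reasoning
        t′ = threshold g (suc j)
        lemma : ∀ p t → 2 * p * t ≡ p * (t * 2)
        lemma = solve-∀

      entry-gap : ∀ j σ → Entry j σ → Gap j σ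
      entry-gap zero σ refl = begin
        p * (opt ∸ ∣ Sub.⊥ {n} ∣) ≤⟨ ℕ.*-mono-≤ (ℕ.n≤1+n p) (ℕ.m∸n≤m opt ∣ Sub.⊥ {n} ∣) ⟩
        q * opt ≤⟨ ℕ.*-monoʳ-≤ q (ℕ.<⇒≤ opt<τ₀) ⟩
        q * (suc (threshold g 0) * cap) ≡⟨ lemma q (suc (threshold g 0)) cap ⟩
        cap * (q * suc (threshold g 0)) ∎
        where
        open ℕ.≤-Reasoning
        lemma : ∀ a b c → a * (b * c) ≡ c * (a * b)
        lemma = solve-∀
      entry-gap (suc j) (C , _) small = ℕ.≤-trans (coverage-gap p (q * suc (threshold g (suc j))) C 𝒯 (λ {S} S∈ → ℕ.<⇒≤ (next {j} (small S (𝒯⊆𝒞 S∈)))))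
        (ℕ.*-monoˡ-≤ _ len𝒯)

      Inv : ℕ → State → Set
      Inv j σ = Sound σ × Greedy σ × (Full σ ⊎ Entry j σ)

      guarantee : ∀ σ → Inv (suc (3 * q)) σ → Guarantee p cap opt ∣ proj₁ σ ∣
      guarantee (C , L) ((len≤ , _) , greedy , inj₁ full) = inj₁ (subst (λ l → (q * cap) ^ l * (opt ∸ ∣ C ∣) ≤ (q * cap ∸ p) ^ l * opt) (ℕ.≤-antisym len≤ full) greedy)
      guarantee (C , L) (_ , _ , inj₂ small) = inj₂ (ℕ.*-cancelˡ-≤ cap (begin
        cap * (4 * (opt ∸ ∣ C ∣)) ≡⟨ lemma cap (opt ∸ ∣ C ∣) ⟩
        4 * cap * (opt ∸ ∣ C ∣) ≤⟨ coverage-gap (4 * cap) opt C 𝒯 (λ {S} S∈ → bound (small S (𝒯⊆𝒞 S∈))) ⟩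
        length 𝒯 * opt ≤⟨ ℕ.*-monoˡ-≤ opt len𝒯 ⟩
        cap * opt ∎))
        where
        open ℕ.≤-Reasoning
        lemma : ∀ c d → c * (4 * d) ≡ 4 * c * d
        lemma = solve-∀
        bound : ∀ {x} → x ≤ threshold g (3 * q) → 4 * cap * x ≤ opt
        bound {x} x≤ = ℕ.*-cancelˡ-≤ 2 (ℕ.≤-trans (ℕ.*-cancelʳ-≤ (2 * (4 * cap * x)) (2 ^ suc g) (q ^ (3 * q)) {{ℕ.m^n≢0 q (3 * q)}} (begin
          2 * (4 * cap * x) * q ^ (3 * q) ≡⟨ lemma₁ cap x (q ^ (3 * q)) ⟩
          8 * (x * (cap * q ^ (3 * q))) ≤⟨ ℕ.*-monoʳ-≤ 8 (threshold≤ {3 * q} x≤) ⟩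
          8 * (2 ^ suc g * p ^ (3 * q)) ≡⟨ lemma₂ (2 ^ suc g) (p ^ (3 * q)) ⟩
          2 ^ suc g * (8 * p ^ (3 * q)) ≤⟨ ℕ.*-monoʳ-≤ (2 ^ suc g) (8p^3q≤q^3q p) ⟩
          2 ^ suc g * q ^ (3 * q) ∎)) (ℕ.*-monoʳ-≤ 2 2^g≤opt))
          where
          lemma₁ : ∀ c x y → 2 * (4 * c * x) * y ≡ 8 * (x * (c * y))
          lemma₁ = solve-∀
          lemma₂ : ∀ a b → 8 * (a * b) ≡ a * (8 * b)
          lemma₂ = solve-∀

      fail-right : Fail (drawGuess g) (λ ω → Sound (actGuess g ω σ₀) × Guarantee p cap opt ∣ proj₁ (actGuess g ω σ₀) ∣) (fromℕ (suc (3 * q)) ℚ.* δ-phase)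
      fail-right = fail-weaken (drawGuess g) (λ ω inv → proj₁ inv , guarantee _ inv) ℚ.≤-refl
        (fail-range (λ j → drawPhase (threshold g j)) actPhase Inv 0≤δ-phase onePhase (suc (3 * q)) 0 σ₀ (sound-start , start , inj₂ refl))
        where
        start : Greedy σ₀
        start = ℕ.*-monoʳ-≤ 1 (ℕ.m∸n≤m opt ∣ Sub.⊥ {n} ∣)
        onePhase : ∀ j σ → Inv j σ → Fail (drawPhase (threshold g j)) (λ ω → Inv (suc j) (actPhase ω σ)) δ-phase
        onePhase j σ (sound , greedy , progress) = fail-weaken (drawPhase (threshold g j)) (λ ω → step (actPhase ω σ) progress) ℚ.≤-refl (fail-phase δ δ-large (threshold g j) σ)
          where
          step : ∀ σ′ → Full σ ⊎ Entry j σ →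
            Star (Pick 𝒞 (suc (threshold g j))) σ σ′ × (Small (threshold g j) σ → Full σ′ ⊎ (∀ S → S ∈ 𝒞 → ∣ S ─ proj₁ σ′ ∣ ≤ threshold g j)) → Inv (suc j) σ′
          step σ′ (inj₁ full) (picks , _) = subst (Inv (suc j)) (full-stuck full picks) (sound , greedy , inj₁ full)
          step σ′ (inj₂ entry) (picks , pruned) = sound-picks picks sound , greedy-picks {j} (entry-gap j σ entry) picks greedy , pruned (entry-small j σ entry)

recip : ∀ k .{{_ : NonZero k}} → ℚ
recip k = + 1 ℚ./ k

0≤recip : ∀ k .{{_ : NonZero k}} → 0ℚ ℚ.≤ recip k
0≤recip k = ℚ.<⇒≤ (ℚ.positive⁻¹ (recip k) {{ℚ.normalize-pos 1 k}})

fromℕ*recip : ∀ k .{{_ : NonZero k}} → fromℕ k ℚ.* recip k ≡ 1ℚ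
fromℕ*recip (suc k) = begin
  fromℕ (suc k) ℚ.* recip (suc k) ≡⟨ cong₂ ℚ._*_ (fromℕ-mk (suc k)) (ℚ.normalize-coprime {1} {k} (Coprime.1-coprimeTo (suc k))) ⟩
  x ℚ.* ℚ.1/ x ≡⟨ ℚ.*-inverseʳ x ⟩
  1ℚ ∎
  where
  open ≡-Reasoning
  x = ℚ.mkℚ (+ suc k) 0 (Coprime.sym (Coprime.1-coprimeTo (suc k)))

^ℚ-* : ∀ x y k → (x ℚ.* y) ^ℚ k ≡ x ^ℚ k ℚ.* y ^ℚ k
^ℚ-* x y zero = refl
^ℚ-* x y (suc k) = trans (cong (x ℚ.* y ℚ.*_) (^ℚ-* x y k)) (lemma x y (x ^ℚ k) (y ^ℚ k))
  where
  lemma : ∀ a b c d → a ℚ.* b ℚ.* (c ℚ.* d) ≡ a ℚ.* c ℚ.* (b ℚ.* d)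
  lemma = Ring.solve-∀ ℚ-ring

1^ℚ : ∀ k → 1ℚ ^ℚ k ≡ 1ℚ
1^ℚ zero = refl
1^ℚ (suc k) = trans (ℚ.*-identityˡ _) (1^ℚ k)

fromℕ-^ : ∀ b k → fromℕ (b ^ k) ≡ fromℕ b ^ℚ k
fromℕ-^ b zero = refl
fromℕ-^ b (suc k) = trans (fromℕ-* b (b ^ k)) (cong (fromℕ b ℚ.*_) (fromℕ-^ b k))

suc*1/suc! : ∀ k → fromℕ (suc k) ℚ.* 1/ (suc k) ! ≡ 1/ k !
suc*1/suc! k = begin
  s ℚ.* c′ ≡⟨ sym (ℚ.*-identityʳ _) ⟩
  s ℚ.* c′ ℚ.* 1ℚ ≡⟨ cong (s ℚ.* c′ ℚ.*_) (sym (fromℕ*recip (k !) {{ℕ._!≢0 k}})) ⟩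
  s ℚ.* c′ ℚ.* (fromℕ (k !) ℚ.* c) ≡⟨ lemma s c′ (fromℕ (k !)) c ⟩
  (s ℚ.* fromℕ (k !)) ℚ.* c′ ℚ.* c ≡⟨ cong (λ z → z ℚ.* c′ ℚ.* c) (sym (fromℕ-* (suc k) (k !))) ⟩
  fromℕ (suc k !) ℚ.* c′ ℚ.* c ≡⟨ cong (ℚ._* c) (fromℕ*recip (suc k !) {{ℕ._!≢0 (suc k)}}) ⟩
  1ℚ ℚ.* c ≡⟨ ℚ.*-identityˡ c ⟩
  c ∎
  where
  open ≡-Reasoning
  s = fromℕ (suc k)
  c = 1/ k !
  c′ = 1/ (suc k) !
  lemma : ∀ a b c d → a ℚ.* b ℚ.* (c ℚ.* d) ≡ (a ℚ.* c) ℚ.* b ℚ.* d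
  lemma = Ring.solve-∀ ℚ-ring

0≤1/! : ∀ k → 0ℚ ℚ.≤ 1/ k !
0≤1/! k = 0≤recip (k !) {{ℕ._!≢0 k}}

-- The Taylor polynomials of the exponential function

expo : ℕ → ℚ → ℚ
expo zero x = 1ℚ
expo (suc N) x = expo N x ℚ.+ x ^ℚ suc N ℚ.* 1/ (suc N) !

expo-0 : ∀ N → expo N 0ℚ ≡ 1ℚ
expo-0 zero = refl
expo-0 (suc N) = trans (cong₂ ℚ._+_ (expo-0 N) (trans (cong (ℚ._* 1/ (suc N) !) (ℚ.*-zeroˡ (0ℚ ^ℚ N))) (ℚ.*-zeroˡ (1/ (suc N) !)))) (ℚ.+-identityʳ 1ℚ)

expo-1 : ∀ N → expo (suc N) 1ℚ ≡ e N
expo-1 zero = refl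
expo-1 (suc N) = trans (cong₂ ℚ._+_ (expo-1 N) (trans (cong (ℚ._* 1/ (suc (suc N)) !) (1^ℚ (suc (suc N)))) (ℚ.*-identityˡ _))) (ℚ.+-assoc 1ℚ (e-1 N) (1/ (suc (suc N)) !))

pow-increment : ∀ {x z} → 0ℚ ℚ.≤ x → 0ℚ ℚ.≤ z → ∀ k → (x ℚ.+ z) ^ℚ suc k ℚ.≤ x ^ℚ suc k ℚ.+ z ℚ.* (fromℕ (suc k) ℚ.* (x ℚ.+ z) ^ℚ k)
pow-increment {x} {z} 0≤x 0≤z zero = ℚ.≤-reflexive (lemma x z)
  where
  lemma : ∀ x z → (x ℚ.+ z) ℚ.* 1ℚ ≡ x ℚ.* 1ℚ ℚ.+ z ℚ.* (1ℚ ℚ.* 1ℚ)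
  lemma = Ring.solve-∀ ℚ-ring
pow-increment {x} {z} 0≤x 0≤z (suc k) = begin
  (x ℚ.+ z) ℚ.* y ≡⟨ ℚ.*-distribʳ-+ y x z ⟩
  x ℚ.* y ℚ.+ z ℚ.* y ≤⟨ ℚ.+-monoˡ-≤ (z ℚ.* y) (*-monoˡℚ x 0≤x (pow-increment 0≤x 0≤z k)) ⟩
  x ℚ.* (x ^ℚ suc k ℚ.+ z ℚ.* (c ℚ.* u)) ℚ.+ z ℚ.* y ≤⟨ ≤-by-slack (z ℚ.* (c ℚ.* (z ℚ.* u))) (0≤*ℚ 0≤z (0≤*ℚ (0≤fromℕ (suc k)) (0≤*ℚ 0≤z (0≤^ℚ k (0≤+ℚ 0≤x 0≤z))))) (lemma x z c u (x ^ℚ suc k)) ⟩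
  x ℚ.* x ^ℚ suc k ℚ.+ z ℚ.* ((1ℚ ℚ.+ c) ℚ.* y) ≡⟨ cong (λ d → x ℚ.* x ^ℚ suc k ℚ.+ z ℚ.* (d ℚ.* y)) (sym (fromℕ-suc (suc k))) ⟩
  x ℚ.* x ^ℚ suc k ℚ.+ z ℚ.* (fromℕ (suc (suc k)) ℚ.* y) ∎
  where
  open ℚ.≤-Reasoning
  u = (x ℚ.+ z) ^ℚ k
  y = (x ℚ.+ z) ^ℚ suc k
  c = fromℕ (suc k)
  lemma : ∀ x z c u v → x ℚ.* v ℚ.+ z ℚ.* ((1ℚ ℚ.+ c) ℚ.* ((x ℚ.+ z) ℚ.* u)) ≡
    x ℚ.* (v ℚ.+ z ℚ.* (c ℚ.* u)) ℚ.+ z ℚ.* ((x ℚ.+ z) ℚ.* u) ℚ.+ z ℚ.* (c ℚ.* (z ℚ.* u))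
  lemma = Ring.solve-∀ ℚ-ring

term-increment : ∀ {x z} → 0ℚ ℚ.≤ x → 0ℚ ℚ.≤ z → ∀ k →
  (x ℚ.+ z) ^ℚ suc k ℚ.* 1/ (suc k) ! ℚ.≤ x ^ℚ suc k ℚ.* 1/ (suc k) ! ℚ.+ z ℚ.* ((x ℚ.+ z) ^ℚ k ℚ.* 1/ k !)
term-increment {x} {z} 0≤x 0≤z k = begin
  (x ℚ.+ z) ^ℚ suc k ℚ.* c′ ≤⟨ ℚ.*-monoʳ-≤-nonNeg c′ {{ℚ.nonNegative (0≤1/! (suc k))}} (pow-increment 0≤x 0≤z k) ⟩
  (x ^ℚ suc k ℚ.+ z ℚ.* (fromℕ (suc k) ℚ.* u)) ℚ.* c′ ≡⟨ lemma (x ^ℚ suc k) z (fromℕ (suc k)) u c′ ⟩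
  x ^ℚ suc k ℚ.* c′ ℚ.+ z ℚ.* (u ℚ.* (fromℕ (suc k) ℚ.* c′)) ≡⟨ cong (λ d → x ^ℚ suc k ℚ.* c′ ℚ.+ z ℚ.* (u ℚ.* d)) (suc*1/suc! k) ⟩
  x ^ℚ suc k ℚ.* c′ ℚ.+ z ℚ.* (u ℚ.* 1/ k !) ∎
  where
  open ℚ.≤-Reasoning
  u = (x ℚ.+ z) ^ℚ k
  c′ = 1/ (suc k) !
  lemma : ∀ a z f u c → (a ℚ.+ z ℚ.* (f ℚ.* u)) ℚ.* c ≡ a ℚ.* c ℚ.+ z ℚ.* (u ℚ.* (f ℚ.* c))
  lemma = Ring.solve-∀ ℚ-ring

expo-increment : ∀ {x z} → 0ℚ ℚ.≤ x → 0ℚ ℚ.≤ z → ∀ N → expo (suc N) (x ℚ.+ z) ℚ.≤ expo (suc N) x ℚ.+ z ℚ.* expo N (x ℚ.+ z)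
expo-increment {x} {z} 0≤x 0≤z zero = ℚ.≤-trans (ℚ.+-monoʳ-≤ 1ℚ (term-increment 0≤x 0≤z 0))
  (ℚ.≤-reflexive (sym (ℚ.+-assoc 1ℚ (x ^ℚ 1 ℚ.* 1/ 1 !) (z ℚ.* 1ℚ))))
expo-increment {x} {z} 0≤x 0≤z (suc N) = ℚ.≤-trans (ℚ.+-mono-≤ (expo-increment 0≤x 0≤z N) (term-increment 0≤x 0≤z (suc N)))
  (ℚ.≤-reflexive (lemma (expo (suc N) x) z (expo N (x ℚ.+ z)) (x ^ℚ suc (suc N) ℚ.* 1/ (suc (suc N)) !) ((x ℚ.+ z) ^ℚ suc N ℚ.* 1/ (suc N) !)))
  where
  lemma : ∀ a z b c d → (a ℚ.+ z ℚ.* b) ℚ.+ (c ℚ.+ z ℚ.* d) ≡ (a ℚ.+ c) ℚ.+ z ℚ.* (b ℚ.+ d)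
  lemma = Ring.solve-∀ ℚ-ring

[1-z]expo : ∀ {x z} → 0ℚ ℚ.≤ x → 0ℚ ℚ.≤ z → ∀ N → (1ℚ ℚ.- z) ℚ.* expo (suc N) (x ℚ.+ z) ℚ.≤ expo (suc N) x
[1-z]expo {x} {z} 0≤x 0≤z N = begin
  (1ℚ ℚ.- z) ℚ.* E′ ≡⟨ lemma z E′ ⟩
  E′ ℚ.- z ℚ.* E′ ≤⟨ ℚ.+-monoˡ-≤ (ℚ.- (z ℚ.* E′)) (ℚ.≤-trans (expo-increment 0≤x 0≤z N) (ℚ.+-monoʳ-≤ (expo (suc N) x) (*-monoˡℚ z 0≤z shorter))) ⟩
  expo (suc N) x ℚ.+ z ℚ.* E′ ℚ.- z ℚ.* E′ ≡⟨ lemma′ (expo (suc N) x) (z ℚ.* E′) ⟩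
  expo (suc N) x ∎
  where
  open ℚ.≤-Reasoning
  E′ = expo (suc N) (x ℚ.+ z)
  0≤x+z = 0≤+ℚ 0≤x 0≤z
  shorter : expo N (x ℚ.+ z) ℚ.≤ E′
  shorter = ≤-by-slack _ (0≤*ℚ (0≤^ℚ (suc N) 0≤x+z) (0≤1/! (suc N))) refl
  lemma : ∀ z e → (1ℚ ℚ.- z) ℚ.* e ≡ e ℚ.- z ℚ.* e
  lemma = Ring.solve-∀ ℚ-ring
  lemma′ : ∀ a b → a ℚ.+ b ℚ.- b ≡ a
  lemma′ = Ring.solve-∀ ℚ-ring

[1-z]^k*expo≤1 : ∀ {z} → 0ℚ ℚ.≤ z → z ℚ.≤ 1ℚ → ∀ N k → (1ℚ ℚ.- z) ^ℚ k ℚ.* expo (suc N) (fromℕ k ℚ.* z) ℚ.≤ 1ℚ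
[1-z]^k*expo≤1 {z} 0≤z z≤1 N zero = ℚ.≤-reflexive (trans (ℚ.*-identityˡ _) (trans (cong (expo (suc N)) (ℚ.*-zeroˡ z)) (expo-0 (suc N))))
[1-z]^k*expo≤1 {z} 0≤z z≤1 N (suc k) = begin
  (1ℚ ℚ.- z) ℚ.* y ℚ.* expo (suc N) (fromℕ (suc k) ℚ.* z) ≡⟨ cong (λ x → (1ℚ ℚ.- z) ℚ.* y ℚ.* expo (suc N) x) (trans (cong (ℚ._* z) (fromℕ-suc k)) (lemma z (fromℕ k))) ⟩
  (1ℚ ℚ.- z) ℚ.* y ℚ.* expo (suc N) (fromℕ k ℚ.* z ℚ.+ z) ≡⟨ lemma′ (1ℚ ℚ.- z) y _ ⟩
  y ℚ.* ((1ℚ ℚ.- z) ℚ.* expo (suc N) (fromℕ k ℚ.* z ℚ.+ z)) ≤⟨ *-monoˡℚ y (0≤^ℚ k (slack z≤1)) ([1-z]expo (0≤*ℚ (0≤fromℕ k) 0≤z) 0≤z N) ⟩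
  y ℚ.* expo (suc N) (fromℕ k ℚ.* z) ≤⟨ [1-z]^k*expo≤1 0≤z z≤1 N k ⟩
  1ℚ ∎
  where
  open ℚ.≤-Reasoning
  y = (1ℚ ℚ.- z) ^ℚ k
  lemma : ∀ z k → (1ℚ ℚ.+ k) ℚ.* z ≡ k ℚ.* z ℚ.+ z
  lemma = Ring.solve-∀ ℚ-ring
  lemma′ : ∀ a b c → a ℚ.* b ℚ.* c ≡ b ℚ.* (a ℚ.* c)
  lemma′ = Ring.solve-∀ ℚ-ring

1≤e-1 : ∀ N → 1ℚ ℚ.≤ e-1 N
1≤e-1 zero = ℚ.≤-refl
1≤e-1 (suc N) = ℚ.≤-trans (1≤e-1 N) (≤-by-slack _ (0≤1/! (suc (suc N))) refl)

2/!≤ : ∀ k → 1/ (suc (suc k)) ! ℚ.+ 1/ (suc (suc k)) ! ℚ.≤ 1/ (suc k) !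
2/!≤ k = begin
  c ℚ.+ c ≡⟨ lemma c ⟩
  fromℕ 2 ℚ.* c ≤⟨ ℚ.*-monoʳ-≤-nonNeg c {{ℚ.nonNegative (0≤1/! (suc (suc k)))}} (fromℕ-mono {2} {suc (suc k)} (s≤s (s≤s z≤n))) ⟩
  fromℕ (suc (suc k)) ℚ.* c ≡⟨ suc*1/suc! (suc k) ⟩
  1/ (suc k) ! ∎
  where
  open ℚ.≤-Reasoning
  c = 1/ (suc (suc k)) !
  lemma : ∀ c → c ℚ.+ c ≡ (1ℚ ℚ.+ 1ℚ) ℚ.* c
  lemma = Ring.solve-∀ ℚ-ring

e-1≤3 : ∀ N → e-1 N ℚ.≤ fromℕ 3
e-1≤3 N = ℚ.≤-trans (≤-by-slack _ (0≤1/! (suc N)) refl) (ℚ.≤-trans (go N) (ℚ.≤ᵇ⇒≤ {fromℕ 2} {fromℕ 3} tt))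
  where
  go : ∀ N → e-1 N ℚ.+ 1/ (suc N) ! ℚ.≤ fromℕ 2
  go zero = ℚ.≤-refl
  go (suc N) = ℚ.≤-trans (ℚ.≤-reflexive (ℚ.+-assoc (e-1 N) _ _)) (ℚ.≤-trans (ℚ.+-monoʳ-≤ (e-1 N) (2/!≤ N)) (go N))

module Ratio (N : ℕ) (ε : ℚ) (0≤ε : 0ℚ ℚ.≤ ε) (ε≤1 : ε ℚ.≤ 1ℚ) where

  b : ℚ
  b = e-1 N

  0≤b : 0ℚ ℚ.≤ b
  0≤b = ℚ.≤-trans 0≤1ℚ (1≤e-1 N)

  instance
    b-pos : ℚ.Positive b
    b-pos = e-1-positive N
    b-nonZero : ℚ.NonZero b
    b-nonZero = ℚ.pos⇒nonZero b

  scaled : ∀ {o c} → b ℚ.* o ℚ.≤ (1ℚ ℚ.+ b ℚ.+ ε ℚ.* b) ℚ.* c → o ℚ.≤ (e/[e-1] N ℚ.+ ε) ℚ.* c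
  scaled {o} {c} h = ℚ.*-cancelˡ-≤-pos b (ℚ.≤-trans h (ℚ.≤-reflexive (sym eq)))
    where
    lemma : ∀ b i ε c → b ℚ.* (((1ℚ ℚ.+ b) ℚ.* i ℚ.+ ε) ℚ.* c) ≡ ((1ℚ ℚ.+ b) ℚ.* (b ℚ.* i) ℚ.+ ε ℚ.* b) ℚ.* c
    lemma = Ring.solve-∀ ℚ-ring
    eq : b ℚ.* ((e/[e-1] N ℚ.+ ε) ℚ.* c) ≡ (1ℚ ℚ.+ b ℚ.+ ε ℚ.* b) ℚ.* c
    eq = trans (lemma b (ℚ.1/ b) ε c) (cong (λ x → (x ℚ.+ ε ℚ.* b) ℚ.* c) (trans (cong ((1ℚ ℚ.+ b) ℚ.*_) (ℚ.*-inverseʳ b)) (ℚ.*-identityʳ (1ℚ ℚ.+ b))))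

  ratio₂ : ∀ {o c} → 4 * (o ∸ c) ≤ o → fromℕ o ℚ.≤ (e/[e-1] N ℚ.+ ε) ℚ.* fromℕ c
  ratio₂ {o} {c} h = scaled {fromℕ o} {fromℕ c} (ℚ.*-cancelˡ-≤-pos (fromℕ 3) (begin
    fromℕ 3 ℚ.* (b ℚ.* o′) ≡⟨ lemma₁ (fromℕ 3) b o′ ⟩
    b ℚ.* (fromℕ 3 ℚ.* o′) ≡⟨ cong (b ℚ.*_) (sym (fromℕ-* 3 o)) ⟩
    b ℚ.* fromℕ (3 * o) ≤⟨ *-monoˡℚ b 0≤b (fromℕ-mono 3o≤4c) ⟩
    b ℚ.* fromℕ (4 * c) ≡⟨ cong (b ℚ.*_) (fromℕ-* 4 c) ⟩
    b ℚ.* (fromℕ 4 ℚ.* c′) ≤⟨ ≤-by-slack ((fromℕ 3 ℚ.- b) ℚ.* c′ ℚ.+ fromℕ 3 ℚ.* (ε ℚ.* b ℚ.* c′))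
        (0≤+ℚ (0≤*ℚ (slack (e-1≤3 N)) (0≤fromℕ c)) (0≤*ℚ (0≤fromℕ 3) (0≤*ℚ (0≤*ℚ 0≤ε 0≤b) (0≤fromℕ c)))) (lemma₂ (fromℕ 3) b ε c′) ⟩
    fromℕ 3 ℚ.* ((1ℚ ℚ.+ b ℚ.+ ε ℚ.* b) ℚ.* c′) ∎))
    where
    open ℚ.≤-Reasoning
    o′ = fromℕ o
    c′ = fromℕ c
    3o≤4c : 3 * o ≤ 4 * c
    3o≤4c with ℕ.≤-total o c
    ... | inj₁ o≤c = ℕ.*-mono-≤ (ℕ.n≤1+n 3) o≤c
    ... | inj₂ c≤o = ℕ.+-cancelʳ-≤ o (3 * o) (4 * c) (ℕ.≤-trans (ℕ.≤-reflexive (lemma o)) (ℕ.≤-trans (ℕ.≤-reflexive (cong (4 *_) (sym (ℕ.m+[n∸m]≡n c≤o))))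
        (ℕ.≤-trans (ℕ.≤-reflexive (ℕ.*-distribˡ-+ 4 c (o ∸ c))) (ℕ.+-monoʳ-≤ (4 * c) h))))
      where
      lemma : ∀ o → 3 * o + o ≡ 4 * o
      lemma = solve-∀
    lemma₁ : ∀ a b c → a ℚ.* (b ℚ.* c) ≡ b ℚ.* (a ℚ.* c)
    lemma₁ = Ring.solve-∀ ℚ-ring
    lemma₂ : ∀ t b ε c → t ℚ.* ((1ℚ ℚ.+ b ℚ.+ ε ℚ.* b) ℚ.* c) ≡ b ℚ.* ((1ℚ ℚ.+ t) ℚ.* c) ℚ.+ ((t ℚ.- b) ℚ.* c ℚ.+ t ℚ.* (ε ℚ.* b ℚ.* c))
    lemma₂ = Ring.solve-∀ ℚ-ring

  ratio-from-greedy : ∀ δ {o c} → 0ℚ ℚ.≤ δ → fromℕ 4 ℚ.* δ ℚ.≤ ε → δ ℚ.< 1ℚ → 0ℚ ℚ.≤ o →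
    (1ℚ ℚ.- δ) ℚ.* (1ℚ ℚ.+ b) ℚ.* (o ℚ.- c) ℚ.≤ o → o ℚ.≤ (e/[e-1] N ℚ.+ ε) ℚ.* c
  ratio-from-greedy δ {o} {c} 0≤δ 4δ≤ε δ<1 0≤o h = scaled {o} {c} (ℚ.*-cancelˡ-≤-pos κ (begin
    κ ℚ.* (b ℚ.* o) ≤⟨ ≤-by-slack (excess ℚ.* o) (0≤*ℚ 0≤excess 0≤o) (lemma₁ δ b ε o) ⟩
    α ℚ.* ((κ ℚ.- 1ℚ) ℚ.* o) ≤⟨ *-monoˡℚ α 0≤α (≤-by-slack (o ℚ.- κ ℚ.* (o ℚ.- c)) (slack h) (lemma₂ κ o c)) ⟩
    α ℚ.* (κ ℚ.* c) ≡⟨ lemma₃ α κ c ⟩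
    κ ℚ.* (α ℚ.* c) ∎))
    where
    open ℚ.≤-Reasoning
    κ α excess : ℚ
    κ = (1ℚ ℚ.- δ) ℚ.* (1ℚ ℚ.+ b)
    α = 1ℚ ℚ.+ b ℚ.+ ε ℚ.* b
    excess = ε ℚ.* (b ℚ.* b) ℚ.- δ ℚ.* ((1ℚ ℚ.+ b) ℚ.* (1ℚ ℚ.+ ε ℚ.* b))
    0≤α : 0ℚ ℚ.≤ α
    0≤α = 0≤+ℚ (0≤+ℚ 0≤1ℚ 0≤b) (0≤*ℚ 0≤ε 0≤b)
    instance
      κ-pos : ℚ.Positive κ
      κ-pos = ℚ.pos*pos⇒pos (1ℚ ℚ.- δ) {{ℚ.positive (subst (ℚ._< 1ℚ ℚ.- δ) (ℚ.+-inverseʳ δ) (ℚ.+-monoˡ-< (ℚ.- δ) δ<1))}} (1ℚ ℚ.+ b) {{ℚ.pos+pos⇒pos 1ℚ b}}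
    0≤excess : 0ℚ ℚ.≤ excess
    0≤excess = slack {δ ℚ.* ((1ℚ ℚ.+ b) ℚ.* (1ℚ ℚ.+ ε ℚ.* b))} {ε ℚ.* (b ℚ.* b)} (ℚ.*-cancelˡ-≤-pos (fromℕ 4) (ℚ.≤-trans (ℚ.≤-reflexive (sym (ℚ.*-assoc (fromℕ 4) δ ((1ℚ ℚ.+ b) ℚ.* (1ℚ ℚ.+ ε ℚ.* b))))) (begin
      fromℕ 4 ℚ.* δ ℚ.* ((1ℚ ℚ.+ b) ℚ.* (1ℚ ℚ.+ ε ℚ.* b)) ≤⟨ *-mono-≤ℚ (0≤*ℚ (0≤fromℕ 4) 0≤δ) (0≤*ℚ 0≤1+b (0≤+ℚ 0≤1ℚ (0≤*ℚ 0≤ε 0≤b))) 4δ≤ε (*-monoˡℚ (1ℚ ℚ.+ b) 0≤1+b (ℚ.+-monoʳ-≤ 1ℚ εb≤b)) ⟩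
      ε ℚ.* ((1ℚ ℚ.+ b) ℚ.* (1ℚ ℚ.+ b)) ≤⟨ ≤-by-slack (ε ℚ.* ((b ℚ.- 1ℚ) ℚ.* (b ℚ.+ b ℚ.+ b ℚ.+ 1ℚ))) (0≤*ℚ 0≤ε (0≤*ℚ (slack (1≤e-1 N)) (0≤+ℚ (0≤+ℚ (0≤+ℚ 0≤b 0≤b) 0≤b) 0≤1ℚ))) (lemma₄ ε b) ⟩
      fromℕ 4 ℚ.* (ε ℚ.* (b ℚ.* b)) ∎)))
      where
      0≤1+b = 0≤+ℚ 0≤1ℚ 0≤b
      εb≤b : ε ℚ.* b ℚ.≤ b
      εb≤b = ℚ.≤-trans (ℚ.*-monoʳ-≤-nonNeg b {{ℚ.nonNegative 0≤b}} ε≤1) (ℚ.≤-reflexive (ℚ.*-identityˡ b))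
      lemma₄ : ∀ ε b → (1ℚ ℚ.+ 1ℚ ℚ.+ 1ℚ ℚ.+ 1ℚ) ℚ.* (ε ℚ.* (b ℚ.* b)) ≡ ε ℚ.* ((1ℚ ℚ.+ b) ℚ.* (1ℚ ℚ.+ b)) ℚ.+ ε ℚ.* ((b ℚ.- 1ℚ) ℚ.* (b ℚ.+ b ℚ.+ b ℚ.+ 1ℚ))
      lemma₄ = Ring.solve-∀ ℚ-ring
    lemma₁ : ∀ δ b ε o → (1ℚ ℚ.+ b ℚ.+ ε ℚ.* b) ℚ.* (((1ℚ ℚ.- δ) ℚ.* (1ℚ ℚ.+ b) ℚ.- 1ℚ) ℚ.* o) ≡
      (1ℚ ℚ.- δ) ℚ.* (1ℚ ℚ.+ b) ℚ.* (b ℚ.* o) ℚ.+ (ε ℚ.* (b ℚ.* b) ℚ.- δ ℚ.* ((1ℚ ℚ.+ b) ℚ.* (1ℚ ℚ.+ ε ℚ.* b))) ℚ.* o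
    lemma₁ = Ring.solve-∀ ℚ-ring
    lemma₂ : ∀ κ o c → κ ℚ.* c ≡ (κ ℚ.- 1ℚ) ℚ.* o ℚ.+ (o ℚ.- κ ℚ.* (o ℚ.- c))
    lemma₂ = Ring.solve-∀ ℚ-ring
    lemma₃ : ∀ a b c → a ℚ.* (b ℚ.* c) ≡ b ℚ.* (a ℚ.* c)
    lemma₃ = Ring.solve-∀ ℚ-ring

  ratio₁ : ∀ p cap {o c} .{{_ : NonZero p}} .{{_ : NonZero cap}} → fromℕ 4 ℚ.* recip (suc p) ℚ.≤ ε →
    (suc p * cap) ^ cap * (o ∸ c) ≤ (suc p * cap ∸ p) ^ cap * o → fromℕ o ℚ.≤ (e/[e-1] N ℚ.+ ε) ℚ.* fromℕ c
  ratio₁ p cap {o} {c} small h = ratio-from-greedy δ (0≤recip q) small δ<1 (0≤fromℕ o) (begin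
    (1ℚ ℚ.- δ) ℚ.* (1ℚ ℚ.+ b) ℚ.* (o′ ℚ.- c′) ≤⟨ *-mono-≤ˡ ⟩
    (1ℚ ℚ.- δ) ℚ.* (1ℚ ℚ.+ b) ℚ.* (y ℚ.* o′) ≡⟨ lemma₁ ((1ℚ ℚ.- δ) ℚ.* (1ℚ ℚ.+ b)) y o′ ⟩
    y ℚ.* ((1ℚ ℚ.- δ) ℚ.* (1ℚ ℚ.+ b)) ℚ.* o′ ≤⟨ ℚ.*-monoʳ-≤-nonNeg o′ {{ℚ.nonNegative (0≤fromℕ o)}} decay ⟩
    1ℚ ℚ.* o′ ≡⟨ ℚ.*-identityˡ o′ ⟩
    o′ ∎)
    where
    open ℚ.≤-Reasoning
    q = suc p
    δ β z y o′ c′ : ℚ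
    δ = recip q
    instance
      B≢0 : NonZero (q * cap)
      B≢0 = ℕ.m*n≢0 q cap
    β = recip (q * cap)
    z = fromℕ p ℚ.* β
    y = (1ℚ ℚ.- z) ^ℚ cap
    o′ = fromℕ o
    c′ = fromℕ c
    0≤β = 0≤recip (q * cap)
    p≤B : p ≤ q * cap
    p≤B = ℕ.≤-trans (ℕ.n≤1+n p) (ℕ.≤-trans (ℕ.≤-reflexive (sym (ℕ.*-identityʳ q))) (ℕ.*-monoʳ-≤ q (ℕ.>-nonZero⁻¹ cap)))
    1-z : 1ℚ ℚ.- z ≡ fromℕ (q * cap ∸ p) ℚ.* β
    1-z = begin-equality
      1ℚ ℚ.- z ≡⟨ cong (ℚ._- z) (sym (fromℕ*recip (q * cap))) ⟩
      fromℕ (q * cap) ℚ.* β ℚ.- z ≡⟨ cong (λ k → fromℕ k ℚ.* β ℚ.- z) (sym (ℕ.m∸n+n≡m p≤B)) ⟩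
      fromℕ (q * cap ∸ p + p) ℚ.* β ℚ.- z ≡⟨ cong (λ x → x ℚ.* β ℚ.- z) (fromℕ-+ (q * cap ∸ p) p) ⟩
      (fromℕ (q * cap ∸ p) ℚ.+ fromℕ p) ℚ.* β ℚ.- z ≡⟨ lemma (fromℕ (q * cap ∸ p)) (fromℕ p) β ⟩
      fromℕ (q * cap ∸ p) ℚ.* β ∎
      where
      lemma : ∀ a b c → (a ℚ.+ b) ℚ.* c ℚ.- b ℚ.* c ≡ a ℚ.* c
      lemma = Ring.solve-∀ ℚ-ring
    0≤1-z : 0ℚ ℚ.≤ 1ℚ ℚ.- z
    0≤1-z = subst (0ℚ ℚ.≤_) (sym 1-z) (0≤*ℚ (0≤fromℕ (q * cap ∸ p)) 0≤β)
    z≤1 : z ℚ.≤ 1ℚ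
    z≤1 = ≤-by-slack (1ℚ ℚ.- z) 0≤1-z (lemma z)
      where
      lemma : ∀ z → 1ℚ ≡ z ℚ.+ (1ℚ ℚ.- z)
      lemma = Ring.solve-∀ ℚ-ring
    p*δ : fromℕ p ℚ.* δ ≡ 1ℚ ℚ.- δ
    p*δ = begin-equality
      fromℕ p ℚ.* δ ≡⟨ lemma (fromℕ p) δ ⟩
      (1ℚ ℚ.+ fromℕ p) ℚ.* δ ℚ.- δ ≡⟨ cong (λ x → x ℚ.* δ ℚ.- δ) (sym (fromℕ-suc p)) ⟩
      fromℕ q ℚ.* δ ℚ.- δ ≡⟨ cong (ℚ._- δ) (fromℕ*recip q) ⟩
      1ℚ ℚ.- δ ∎
      where
      lemma : ∀ a d → a ℚ.* d ≡ (1ℚ ℚ.+ a) ℚ.* d ℚ.- d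
      lemma = Ring.solve-∀ ℚ-ring
    cap*β : fromℕ cap ℚ.* β ≡ δ
    cap*β = begin-equality
      fromℕ cap ℚ.* β ≡⟨ sym (ℚ.*-identityˡ _) ⟩
      1ℚ ℚ.* (fromℕ cap ℚ.* β) ≡⟨ cong (ℚ._* (fromℕ cap ℚ.* β)) (sym (fromℕ*recip q)) ⟩
      fromℕ q ℚ.* δ ℚ.* (fromℕ cap ℚ.* β) ≡⟨ lemma (fromℕ q) δ (fromℕ cap) β ⟩
      (fromℕ q ℚ.* fromℕ cap) ℚ.* β ℚ.* δ ≡⟨ cong (λ x → x ℚ.* β ℚ.* δ) (sym (fromℕ-* q cap)) ⟩
      fromℕ (q * cap) ℚ.* β ℚ.* δ ≡⟨ cong (ℚ._* δ) (fromℕ*recip (q * cap)) ⟩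
      1ℚ ℚ.* δ ≡⟨ ℚ.*-identityˡ δ ⟩
      δ ∎
      where
      lemma : ∀ a b c d → a ℚ.* b ℚ.* (c ℚ.* d) ≡ (a ℚ.* c) ℚ.* d ℚ.* b
      lemma = Ring.solve-∀ ℚ-ring
    cap*z : fromℕ cap ℚ.* z ≡ 1ℚ ℚ.- δ
    cap*z = trans (lemma (fromℕ cap) (fromℕ p) β) (trans (cong (fromℕ p ℚ.*_) cap*β) p*δ)
      where
      lemma : ∀ a b c → a ℚ.* (b ℚ.* c) ≡ b ℚ.* (a ℚ.* c)
      lemma = Ring.solve-∀ ℚ-ring
    0≤1-δ : 0ℚ ℚ.≤ 1ℚ ℚ.- δ
    0≤1-δ = subst (0ℚ ℚ.≤_) p*δ (0≤*ℚ (0≤fromℕ p) (0≤recip q))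
    δ<1 : δ ℚ.< 1ℚ
    δ<1 = subst₂ ℚ._<_ (ℚ.+-identityˡ δ) (lemma δ) (ℚ.+-monoˡ-< δ (subst (0ℚ ℚ.<_) p*δ (ℚ.positive⁻¹ _ {{ℚ.pos*pos⇒pos (fromℕ p) {{p-pos}} δ {{ℚ.normalize-pos 1 q}}}})))
      where
      lemma : ∀ d → 1ℚ ℚ.- d ℚ.+ d ≡ 1ℚ
      lemma = Ring.solve-∀ ℚ-ring
      p-pos : ℚ.Positive (fromℕ p)
      p-pos = ℚ.normalize-pos p 1
    decay : y ℚ.* ((1ℚ ℚ.- δ) ℚ.* (1ℚ ℚ.+ b)) ℚ.≤ 1ℚ
    decay = begin
      y ℚ.* ((1ℚ ℚ.- δ) ℚ.* e N) ≡⟨ cong (λ x → y ℚ.* ((1ℚ ℚ.- δ) ℚ.* x)) (trans (sym (expo-1 N)) (cong (expo (suc N)) (lemma δ))) ⟩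
      y ℚ.* ((1ℚ ℚ.- δ) ℚ.* expo (suc N) (1ℚ ℚ.- δ ℚ.+ δ)) ≤⟨ *-monoˡℚ y (0≤^ℚ cap 0≤1-z) ([1-z]expo 0≤1-δ (0≤recip q) N) ⟩
      y ℚ.* expo (suc N) (1ℚ ℚ.- δ) ≡⟨ cong (λ x → y ℚ.* expo (suc N) x) (sym cap*z) ⟩
      y ℚ.* expo (suc N) (fromℕ cap ℚ.* z) ≤⟨ [1-z]^k*expo≤1 (0≤*ℚ (0≤fromℕ p) 0≤β) z≤1 N cap ⟩
      1ℚ ∎
      where
      lemma : ∀ d → 1ℚ ≡ 1ℚ ℚ.- d ℚ.+ d
      lemma = Ring.solve-∀ ℚ-ring
    gap≤ : o′ ℚ.- c′ ℚ.≤ y ℚ.* o′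
    gap≤ = begin
      o′ ℚ.- c′ ≤⟨ ℚ.+-monoˡ-≤ (ℚ.- c′) (fromℕ-mono (ℕ.m≤n+m∸n o c)) ⟩
      fromℕ (c + (o ∸ c)) ℚ.- c′ ≡⟨ trans (cong (ℚ._- c′) (fromℕ-+ c (o ∸ c))) (lemma c′ (fromℕ (o ∸ c))) ⟩
      D ≡⟨ sym (trans (cong (ℚ._* D) (trans (sym (^ℚ-* (fromℕ (q * cap)) β cap)) (trans (cong (_^ℚ cap) (fromℕ*recip (q * cap))) (1^ℚ cap)))) (ℚ.*-identityˡ D)) ⟩
      (fromℕ (q * cap) ^ℚ cap ℚ.* β ^ℚ cap) ℚ.* D ≡⟨ trans (lemma₂ (fromℕ (q * cap) ^ℚ cap) (β ^ℚ cap) D) (cong (β ^ℚ cap ℚ.*_) (trans (cong (ℚ._* D) (sym (fromℕ-^ (q * cap) cap))) (sym (fromℕ-* ((q * cap) ^ cap) (o ∸ c))))) ⟩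
      β ^ℚ cap ℚ.* fromℕ ((q * cap) ^ cap * (o ∸ c)) ≤⟨ *-monoˡℚ (β ^ℚ cap) (0≤^ℚ cap 0≤β) (fromℕ-mono h) ⟩
      β ^ℚ cap ℚ.* fromℕ ((q * cap ∸ p) ^ cap * o) ≡⟨ cong (β ^ℚ cap ℚ.*_) (trans (fromℕ-* ((q * cap ∸ p) ^ cap) o) (cong (ℚ._* o′) (fromℕ-^ (q * cap ∸ p) cap))) ⟩
      β ^ℚ cap ℚ.* (fromℕ (q * cap ∸ p) ^ℚ cap ℚ.* o′) ≡⟨ trans (lemma₃ (β ^ℚ cap) (fromℕ (q * cap ∸ p) ^ℚ cap) o′) (cong (ℚ._* o′) (sym (^ℚ-* (fromℕ (q * cap ∸ p)) β cap))) ⟩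
      (fromℕ (q * cap ∸ p) ℚ.* β) ^ℚ cap ℚ.* o′ ≡⟨ cong (λ x → x ^ℚ cap ℚ.* o′) (sym 1-z) ⟩
      y ℚ.* o′ ∎
      where
      D = fromℕ (o ∸ c)
      lemma : ∀ a b → a ℚ.+ b ℚ.- a ≡ b
      lemma = Ring.solve-∀ ℚ-ring
      lemma₂ : ∀ a b c → (a ℚ.* b) ℚ.* c ≡ b ℚ.* (a ℚ.* c)
      lemma₂ = Ring.solve-∀ ℚ-ring
      lemma₃ : ∀ a b c → a ℚ.* (b ℚ.* c) ≡ (b ℚ.* a) ℚ.* c
      lemma₃ = Ring.solve-∀ ℚ-ring
    *-mono-≤ˡ = *-monoˡℚ ((1ℚ ℚ.- δ) ℚ.* (1ℚ ℚ.+ b)) (0≤*ℚ 0≤1-δ (0≤+ℚ 0≤1ℚ 0≤b)) gap≤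
    lemma₁ : ∀ a b c → a ℚ.* (b ℚ.* c) ≡ b ℚ.* a ℚ.* c
    lemma₁ = Ring.solve-∀ ℚ-ring

-- Optimal choices

∈⋃⁺ : ∀ {n} {x : Fin n} {S 𝒯} → S ∈ 𝒯 → x Sub.∈ S → x Sub.∈ ⋃ 𝒯
∈⋃⁺ {S = S} {_ ∷ 𝒯} (here refl) x∈ = Sub.p⊆p∪q (⋃ 𝒯) x∈
∈⋃⁺ {𝒯 = S′ ∷ 𝒯} (there S∈) x∈ = Sub.q⊆p∪q S′ (⋃ 𝒯) (∈⋃⁺ S∈ x∈)

∈⋃⁻ : ∀ {n} {x : Fin n} 𝒯 → x Sub.∈ ⋃ 𝒯 → ∃[ S ] S ∈ 𝒯 × x Sub.∈ S
∈⋃⁻ [] x∈ = contradiction x∈ Sub.∉⊥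
∈⋃⁻ (S ∷ 𝒯) x∈ with Sub.x∈p∪q⁻ S (⋃ 𝒯) x∈
... | inj₁ x∈S = S , here refl , x∈S
... | inj₂ x∈⋃ = let (S′ , S′∈ , x∈S′) = ∈⋃⁻ 𝒯 x∈⋃ in S′ , there S′∈ , x∈S′

coverage-mono : ∀ {n} {𝒯 𝒯′ : List (Subset n)} → (∀ {S} → S ∈ 𝒯 → S ∈ 𝒯′) → coverage 𝒯 ≤ coverage 𝒯′
coverage-mono {𝒯 = 𝒯} ⊆′ = Sub.p⊆q⇒∣p∣≤∣q∣ (λ x∈ → let (S , S∈ , x∈S) = ∈⋃⁻ 𝒯 x∈ in ∈⋃⁺ (⊆′ S∈) x∈S)

injection-length : ∀ {A B : Set} (f : A → B) {xs ys} → Unique xs → (∀ {x y} → x ∈ xs → y ∈ xs → f x ≡ f y → x ≡ y) →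
  (∀ {x} → x ∈ xs → f x ∈ ys) → length xs ≤ length ys
injection-length f {[]} u inj ⊆ys = z≤n
injection-length f {x ∷ xs} {ys} (x≢ ∷ u) inj ⊆ys with Mem.∈-∃++ (⊆ys (here refl))
... | ys₁ , ys₂ , refl = ℕ.≤-trans (s≤s (injection-length f {xs} {ys₁ ++ ys₂} u (λ x∈ y∈ → inj (there x∈) (there y∈)) rest))
    (ℕ.≤-reflexive (trans (cong suc (List.length-++ ys₁)) (trans (sym (ℕ.+-suc (length ys₁) (length ys₂))) (sym (List.length-++ ys₁)))))
  where
  rest : ∀ {y} → y ∈ xs → f y ∈ ys₁ ++ ys₂
  rest {y} y∈ with Mem.∈-++⁻ ys₁ (⊆ys (there y∈))
  ... | inj₁ h = Mem.∈-++⁺ˡ h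
  ... | inj₂ (here fy≡fx) = contradiction (sym (inj (there y∈) (here refl) fy≡fx)) (All.lookup x≢ y∈)
  ... | inj₂ (there h) = Mem.∈-++⁺ʳ ys₁ h

occ≤1 : ∀ {n} (S : Subset n) {xs} → Unique xs → occ S xs ≤ 1
occ≤1 S [] = z≤n
occ≤1 S {S′ ∷ xs} (S≢ ∷ u) with S ≟ˢ S′
... | no _ = occ≤1 S u
... | yes refl = s≤s (ℕ.≮⇒≥ λ 0<occ → All.lookup S≢ (0<occ⇒∈ {S = S} xs 0<occ) refl)

unique-choice : ∀ {n} {𝒞 𝒯 : List (Subset n)} → Unique 𝒯 → (∀ {S} → S ∈ 𝒯 → S ∈ 𝒞) → ∀ S → occurrences S 𝒯 ≤ occurrences S 𝒞
unique-choice {𝒞 = 𝒞} {𝒯} u ⊆′ S rewrite occurrences≡occ S 𝒯 | occurrences≡occ S 𝒞 with 1 ℕ.≤? occ S 𝒯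
... | yes 0<occ = ℕ.≤-trans (occ≤1 S u) (∈⇒0<occ (⊆′ (0<occ⇒∈ {S = S} 𝒯 0<occ)))
... | no ¬0<occ = ℕ.≤-trans (ℕ.m<1+n⇒m≤n (ℕ.≰⇒> ¬0<occ)) z≤n

sublists : ∀ {A : Set} → List A → List (List A)
sublists [] = [] ∷ []
sublists (x ∷ xs) = map (x ∷_) (sublists xs) ++ sublists xs

filter∈sublists : ∀ {A : Set} {P : A → Set} (P? : ∀ x → Dec (P x)) xs → filter P? xs ∈ sublists xs
filter∈sublists P? [] = here refl
filter∈sublists P? (x ∷ xs) with does (P? x)
... | true = Mem.∈-++⁺ˡ (Mem.∈-map⁺ (x ∷_) (filter∈sublists P? xs))
... | false = Mem.∈-++⁺ʳ (map (x ∷_) (sublists xs)) (filter∈sublists P? xs)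

sublist-∈ : ∀ {A : Set} {xs ys : List A} → ys ∈ sublists xs → ∀ {y} → y ∈ ys → y ∈ xs
sublist-∈ {xs = []} (here refl) y∈ = y∈
sublist-∈ {xs = x ∷ xs} ys∈ y∈ with Mem.∈-++⁻ (map (x ∷_) (sublists xs)) ys∈
... | inj₂ h = there (sublist-∈ h y∈)
... | inj₁ h with Mem.∈-map⁻ (x ∷_) h
... | zs , zs∈ , refl with y∈
... | here refl = here refl
... | there y∈′ = there (sublist-∈ zs∈ y∈′)

sublist-unique : ∀ {A : Set} {xs ys : List A} → Unique xs → ys ∈ sublists xs → Unique ys
sublist-unique {xs = []} u (here refl) = []
sublist-unique {xs = x ∷ xs} (x≢ ∷ u) ys∈ with Mem.∈-++⁻ (map (x ∷_) (sublists xs)) ys∈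
... | inj₂ h = sublist-unique u h
... | inj₁ h with Mem.∈-map⁻ (x ∷_) h
... | zs , zs∈ , refl = All.tabulate (λ z∈ → All.lookup x≢ (sublist-∈ zs∈ z∈)) ∷ sublist-unique u zs∈

maximum : ∀ {A : Set} (f : A → ℕ) {x : A} {xs} → x ∈ xs → ∃[ y ] y ∈ xs × (∀ {z} → z ∈ xs → f z ≤ f y)
maximum f {xs = x ∷ []} x∈ = x , here refl , λ { (here refl) → ℕ.≤-refl }
maximum f {xs = x ∷ x′ ∷ xs} _ with maximum f {xs = x′ ∷ xs} (here refl)
... | y , y∈ , max with ℕ.≤-total (f x) (f y)
... | inj₁ fx≤fy = y , there y∈ , λ { (here refl) → fx≤fy ; (there z∈) → max z∈ }
... | inj₂ fy≤fx = x , here refl , λ { (here refl) → ℕ.≤-refl ; (there z∈) → ℕ.≤-trans (max z∈) fy≤fx }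

record Optimum {n} (𝒞 : List (Subset n)) (k : ℕ) : Set where
  field
    family : List (Subset n)
    unique : Unique family
    ⊆𝒞 : ∀ {S} → S ∈ family → S ∈ 𝒞
    length≤ : length family ≤ k
    isOptimum : IsOptimum 𝒞 k (coverage family)

optimum : ∀ {n} (𝒞 : List (Subset n)) k → Optimum 𝒞 k
optimum {n} 𝒞 k = record
  { family = 𝒯
  ; unique = 𝒯!
  ; ⊆𝒞 = 𝒯⊆𝒞
  ; length≤ = len𝒯
  ; isOptimum = (𝒯 , (len𝒯 , unique-choice 𝒯! 𝒯⊆𝒞) , refl) , maximal
  }
  where
  𝒟 = deduplicate _≟ˢ_ 𝒞
  families = filter (λ 𝒯 → length 𝒯 ℕ.≤? k) (sublists 𝒟)
  empty∈ : ∀ (xs : List (Subset n)) → [] ∈ sublists xs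
  empty∈ [] = here refl
  empty∈ (x ∷ xs) = Mem.∈-++⁺ʳ (map (x ∷_) (sublists xs)) (empty∈ xs)
  best = maximum coverage {xs = families} (Mem.∈-filter⁺ (λ 𝒯 → length 𝒯 ℕ.≤? k) (empty∈ 𝒟) z≤n)
  𝒯 = proj₁ best
  𝒯∈ = Mem.∈-filter⁻ (λ 𝒯 → length 𝒯 ℕ.≤? k) {xs = sublists 𝒟} (proj₁ (proj₂ best))
  len𝒯 = proj₂ 𝒯∈
  𝒯! : Unique 𝒯
  𝒯! = sublist-unique (Unique.deduplicate-! _≟ˢ_ 𝒞) (proj₁ 𝒯∈)
  𝒯⊆𝒞 : ∀ {S} → S ∈ 𝒯 → S ∈ 𝒞
  𝒯⊆𝒞 S∈ = Mem.∈-deduplicate⁻ _≟ˢ_ 𝒞 (sublist-∈ (proj₁ 𝒯∈) S∈)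
  maximal : ∀ 𝒯′ → IsChoice 𝒞 k 𝒯′ → coverage 𝒯′ ≤ coverage 𝒯
  maximal 𝒯′ (len′ , occ≤) = ℕ.≤-trans (coverage-mono keep) (proj₂ (proj₂ best)
      (Mem.∈-filter⁺ (λ 𝒯 → length 𝒯 ℕ.≤? k) (filter∈sublists in𝒯′? 𝒟) (ℕ.≤-trans short len′)))
    where
    in𝒯′? : ∀ S → Dec (S ∈ 𝒯′)
    in𝒯′? S = Any.any? (S ≟ˢ_) 𝒯′
    keep : ∀ {S} → S ∈ 𝒯′ → S ∈ filter in𝒯′? 𝒟
    keep {S} S∈ = Mem.∈-filter⁺ in𝒯′? (Mem.∈-deduplicate⁺ _≟ˢ_ (0<occ⇒∈ {S = S} 𝒞
      (ℕ.≤-trans (∈⇒0<occ S∈) (subst₂ _≤_ (occurrences≡occ S 𝒯′) (occurrences≡occ S 𝒞) (occ≤ S))))) S∈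
    short : length (filter in𝒯′? 𝒟) ≤ length 𝒯′
    short = injection-length (λ S → S) (UniqueP.filter⁺ in𝒯′? (Unique.deduplicate-! _≟ˢ_ 𝒞)) (λ _ _ eq → eq)
      (λ S∈ → proj₂ (Mem.∈-filter⁻ in𝒯′? {xs = 𝒟} S∈))

chosen! : ∀ {n} sel (𝒞 : List (Subset n)) → Unique (chosen sel 𝒞)
chosen! sel 𝒞 = UniqueP.filter⁺ (Bool.T? ∘ sel) (Unique.deduplicate-! _≟ˢ_ 𝒞)

chosen⊆ : ∀ {n} sel (𝒞 : List (Subset n)) {S} → S ∈ chosen sel 𝒞 → S ∈ 𝒞 × T (sel S)
chosen⊆ sel 𝒞 S∈ with Mem.∈-filter⁻ (Bool.T? ∘ sel) {xs = deduplicate _≟ˢ_ 𝒞} S∈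
... | S∈𝒟 , selS = Mem.∈-deduplicate⁻ _≟ˢ_ 𝒞 S∈𝒟 , selS

∈chosen : ∀ {n} sel (𝒞 : List (Subset n)) {S} → S ∈ 𝒞 → T (sel S) → S ∈ chosen sel 𝒞
∈chosen sel 𝒞 S∈ selS = Mem.∈-filter⁺ (Bool.T? ∘ sel) (Mem.∈-deduplicate⁺ _≟ˢ_ S∈) selS

floorLog : ∀ N B → 0 < N → N ≤ 2 ^ B → ∃[ g ] g ≤ B × 2 ^ g ≤ N × N < 2 ^ suc g
floorLog N zero 0<N N≤ = 0 , z≤n , 0<N , s≤s N≤
floorLog N (suc B) 0<N N≤ with N ℕ.≤? 2 ^ B
... | yes N≤′ = let (g , g≤ , h) = floorLog N B 0<N N≤′ in g , ℕ.m≤n⇒m≤1+n g≤ , h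
... | no N≰ with N ℕ.≟ 2 ^ suc B
... | yes refl = suc B , ℕ.≤-refl , ℕ.≤-refl , ℕ.^-monoʳ-< 2 (s≤s (s≤s z≤n)) {suc B} {suc (suc B)} ℕ.≤-refl
... | no N≢ = B , ℕ.n≤1+n B , ℕ.<⇒≤ (ℕ.≰⇒> N≰) , ℕ.≤∧≢⇒< N≤ N≢

n≤2^⌈log₂n⌉ : ∀ n → n ≤ 2 ^ ⌈log₂ n ⌉
n≤2^⌈log₂n⌉ = <-rec _ go
  where
  go : ∀ n → (∀ {k} → k < n → k ≤ 2 ^ ⌈log₂ k ⌉) → n ≤ 2 ^ ⌈log₂ n ⌉
  go zero rec = z≤n
  go (suc zero) rec = ℕ.m^n>0 2 ⌈log₂ 1 ⌉
  go n@(suc (suc n′)) rec = begin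
    n ≡⟨ sym (ℕ.⌊n/2⌋+⌈n/2⌉≡n n) ⟩
    ℕ.⌊ n /2⌋ + h ≤⟨ ℕ.+-monoˡ-≤ h (ℕ.⌊n/2⌋≤⌈n/2⌉ n) ⟩
    h + h ≤⟨ ℕ.+-mono-≤ h≤ h≤ ⟩
    2 ^ (l ∸ 1) + 2 ^ (l ∸ 1) ≡⟨ cong (_+_ (2 ^ (l ∸ 1))) (sym (ℕ.+-identityʳ (2 ^ (l ∸ 1)))) ⟩
    2 ^ suc (l ∸ 1) ≡⟨ cong (2 ^_) (ℕ.m+[n∸m]≡n {1} {l} (⌈log₂⌉-mono-≤ {2} {n} (s≤s (s≤s z≤n)))) ⟩
    2 ^ l ∎
    where
    open ℕ.≤-Reasoning
    h = ℕ.⌈ n /2⌉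
    l = ⌈log₂ n ⌉
    h≤ : h ≤ 2 ^ (l ∸ 1)
    h≤ = subst (λ e → h ≤ 2 ^ e) (⌈log₂⌈n/2⌉⌉≡⌈log₂n⌉∸1 n) (rec (ℕ.⌈n/2⌉<n n′))

listsUpTo : ∀ {A : Set} → List A → ℕ → List (List A)
listsUpTo xs zero = [] ∷ []
listsUpTo xs (suc m) = [] ∷ List.cartesianProductWith _∷_ xs (listsUpTo xs m)

∈-listsUpTo : ∀ {A : Set} {xs : List A} → (∀ x → x ∈ xs) → ∀ m {ys} → length ys ≤ m → ys ∈ listsUpTo xs m
∈-listsUpTo all zero {[]} _ = here refl
∈-listsUpTo all (suc m) {[]} _ = here refl
∈-listsUpTo all (suc m) {y ∷ ys} (s≤s len) = there (Mem.∈-cartesianProductWith⁺ _∷_ (all y) (∈-listsUpTo all m len))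

length-listsUpTo : ∀ {A : Set} (xs : List A) b → length xs ≤ 2 ^ b → ∀ m → length (listsUpTo xs m) ≤ 2 ^ (suc b * m)
length-listsUpTo xs b len zero = ℕ.m^n>0 2 (suc b * 0)
length-listsUpTo xs b len (suc m) = begin
  suc (length (List.cartesianProductWith _∷_ xs (listsUpTo xs m))) ≡⟨ cong suc (length-cartesianProductWith _∷_ xs (listsUpTo xs m)) ⟩
  suc (length xs * length (listsUpTo xs m)) ≤⟨ s≤s (ℕ.*-mono-≤ len (length-listsUpTo xs b len m)) ⟩
  1 + 2 ^ b * 2 ^ (suc b * m) ≡⟨ cong suc (sym (ℕ.^-distribˡ-+-* 2 b (suc b * m))) ⟩
  1 + 2 ^ (b + suc b * m) ≤⟨ ℕ.+-monoˡ-≤ (2 ^ (b + suc b * m)) (ℕ.m^n>0 2 (b + suc b * m)) ⟩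
  2 ^ (b + suc b * m) + 2 ^ (b + suc b * m) ≡⟨ cong (_+_ (2 ^ (b + suc b * m))) (sym (ℕ.+-identityʳ _)) ⟩
  2 ^ suc (b + suc b * m) ≡⟨ cong (2 ^_) (sym (ℕ.*-suc (suc b) m)) ⟩
  2 ^ (suc b * suc m) ∎
  where open ℕ.≤-Reasoning

-- Random names

nameOf : ∀ {n w} → Vec (Table n) w → Subset n → Vec Bool w
nameOf ts S = Vec.map (_at S) ts

InjectiveOn : ∀ {n w} → List (Subset n) → (Subset n → Vec Bool w) → Set
InjectiveOn 𝒞 name = ∀ {S S′} → S ∈ 𝒞 → S′ ∈ 𝒞 → name S ≡ name S′ → S ≡ S′

fail-names : ∀ {n} (𝒞 : List (Subset n)) {m M} → length 𝒞 ≤ m → m ≤ 2 ^ M → ∀ b →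
  Fail (drawVec (randomTable n) (2 * M + b)) (InjectiveOn 𝒞 ∘ nameOf) (½^ b)
fail-names {n} 𝒞 {m} {M} len≤ m≤ b = fail-weaken {Q = InjectiveOn 𝒞 ∘ nameOf} _ (λ ts h {S} {S′} S∈ S′∈ eq → h (S , S′) (Mem.∈-cartesianProduct⁺ S∈ S′∈) eq) small
  (fail-∀∈ (drawVec (randomTable n) w) (List.cartesianProduct 𝒞 𝒞) one)
  where
  w = 2 * M + b
  toℕ-at : ∀ {w} (ts : Vec (Table n) w) S S′ → nameOf ts S ≡ nameOf ts S′ → map (λ φ → toℕ (φ at S)) (Vec.toList ts) ≡ map (λ φ → toℕ (φ at S′)) (Vec.toList ts)
  toℕ-at [] S S′ eq = refl
  toℕ-at (t ∷ ts) S S′ eq = cong₂ _∷_ (cong toℕ (Vec.∷-injectiveˡ eq)) (toℕ-at ts S S′ (Vec.∷-injectiveʳ eq))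
  one : ∀ pair → pair ∈ List.cartesianProduct 𝒞 𝒞 → Fail (drawVec (randomTable n) w)
    (λ ts → nameOf ts (proj₁ pair) ≡ nameOf ts (proj₂ pair) → proj₁ pair ≡ proj₂ pair) (½^ w)
  one (S , S′) _ with S ≟ˢ S′
  ... | yes S≡S′ = fail-sure _ (0≤½^ w) (λ _ _ → S≡S′)
  ... | no S≢S′ = fail-weaken _ (λ ts differs eq → contradiction (toℕ-at ts S S′ eq) differs) ℚ.≤-refl
    (fail-tables S (λ φ → toℕ (φ at S)) (λ φ → toℕ (φ at S′)) differ w)
    where
    differ : ∀ φ → toℕ (set S true φ at S) ≡ toℕ (set S true φ at S′) → toℕ (set S false φ at S) ≢ toℕ (set S false φ at S′)
    differ φ eq₁ eq₀ rewrite set-at S true φ | set-at S false φ | set-at-≢ true φ S≢S′ | set-at-≢ false φ S≢S′ = case trans eq₁ (sym eq₀) of λ ()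
  small : fromℕ (length (List.cartesianProduct 𝒞 𝒞)) ℚ.* ½^ w ℚ.≤ ½^ b
  small = subst (λ p → fromℕ (length (List.cartesianProduct 𝒞 𝒞)) ℚ.* p ℚ.≤ ½^ b) (sym (½^-+ (2 * M) b))
    (*½^-≤ {length (List.cartesianProduct 𝒞 𝒞)} {2 * M} (½^ b) (0≤½^ b) (begin
      length (List.cartesianProduct 𝒞 𝒞) ≡⟨ length-cartesianProduct 𝒞 𝒞 ⟩
      length 𝒞 * length 𝒞 ≤⟨ ℕ.*-mono-≤ (ℕ.≤-trans len≤ m≤) (ℕ.≤-trans len≤ m≤) ⟩
      2 ^ M * 2 ^ M ≡⟨ sym (ℕ.^-distribˡ-+-* 2 M M) ⟩
      2 ^ (M + M) ≡⟨ cong (λ e → 2 ^ (M + e)) (sym (ℕ.+-identityʳ M)) ⟩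
      2 ^ (2 * M) ∎))
    where open ℕ.≤-Reasoning

-- Running several sketches in parallel

parallel : ∀ {n} {A : Set} → List (ℕ → A → Sketch n A) → ℕ → List A → Sketch n (List A)
parallel (f ∷ fs) i (x ∷ xs) = liftˢ _∷_ (f i x) (parallel fs i xs)
parallel _ i _ = pureˢ []

iterate-[] : ∀ {n} {A : Set} 𝒞 i p → iterate {n} 𝒞 (parallel {A = A} []) i p [] ≡ []
iterate-[] 𝒞 i zero = refl
iterate-[] 𝒞 i (suc p) = iterate-[] 𝒞 (suc i) p

iterate-∷ : ∀ {n} {A : Set} 𝒞 (f : ℕ → A → Sketch n A) fs i p x xs →
  iterate 𝒞 (parallel (f ∷ fs)) i p (x ∷ xs) ≡ iterate 𝒞 f i p x ∷ iterate 𝒞 (parallel fs) i p xs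
iterate-∷ 𝒞 f fs i zero x xs = refl
iterate-∷ 𝒞 f fs i (suc p) x xs = trans (cong (iterate 𝒞 (parallel (f ∷ fs)) (suc i) p) (eval-liftˢ _∷_ (f i x) (parallel fs i xs) 𝒞))
  (iterate-∷ 𝒞 f fs (suc i) p (eval (f i x) 𝒞) (eval (parallel fs i xs) 𝒞))

size-parallel : ∀ {n} {A : Set} W (fs : List (ℕ → A → Sketch n A)) → All (λ f → ∀ i x → size (f i x) ≤ W) fs →
  ∀ i xs → size (parallel fs i xs) ≤ length fs * W
size-parallel W [] _ i xs = z≤n
size-parallel W (f ∷ fs) _ i [] = z≤n
size-parallel W (f ∷ fs) (h ∷ hs) i (x ∷ xs) = ℕ.≤-trans (ℕ.≤-reflexive (size-liftˢ {Z = List _} _∷_ (f i x) (parallel fs i xs)))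
  (ℕ.+-mono-≤ (h i x) (size-parallel W fs hs i xs))

parallel-invariant : ∀ {n} {A : Set} (P : A → Set) (fs : List (ℕ → A → Sketch n A)) →
  All (λ f → ∀ i x cs → P x → P (decode (f i x) cs)) fs →
  ∀ i xs cs → All P xs → All P (decode (parallel fs i xs) cs)
parallel-invariant P [] _ i xs cs _ = []
parallel-invariant P (f ∷ fs) _ i [] cs _ = []
parallel-invariant P (f ∷ fs) (h ∷ hs) i (x ∷ xs) cs (px ∷ pxs) =
  h i x (take (size (f i x)) cs) px ∷ parallel-invariant P fs hs i xs (drop (size (f i x)) cs) pxs

length-parallel : ∀ {n} {A : Set} (fs : List (ℕ → A → Sketch n A)) i xs cs → length (decode (parallel fs i xs) cs) ≤ length fs
length-parallel [] i xs cs = z≤n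
length-parallel (f ∷ fs) i [] cs = z≤n
length-parallel (f ∷ fs) i (x ∷ xs) cs = s≤s (length-parallel fs i xs (drop (size (f i x)) cs))

nth-All : ∀ {A : Set} {P : A → Set} {d xs} → P d → All P xs → ∀ i → P (nth d xs i)
nth-All pd [] i = pd
nth-All pd (p ∷ ps) zero = p
nth-All pd (p ∷ ps) (suc i) = nth-All pd ps i

*½^≤recip : ∀ k N r .{{_ : NonZero N}} → k * N ≤ 2 ^ r → fromℕ k ℚ.* ½^ r ℚ.≤ recip N
*½^≤recip k N r h = begin
  fromℕ k ℚ.* ½^ r ≡⟨ sym (ℚ.*-identityʳ _) ⟩
  fromℕ k ℚ.* ½^ r ℚ.* 1ℚ ≡⟨ cong (fromℕ k ℚ.* ½^ r ℚ.*_) (sym (fromℕ*recip N)) ⟩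
  fromℕ k ℚ.* ½^ r ℚ.* (fromℕ N ℚ.* recip N) ≡⟨ lemma (fromℕ k) (½^ r) (fromℕ N) (recip N) ⟩
  (fromℕ k ℚ.* fromℕ N) ℚ.* (½^ r ℚ.* recip N) ≡⟨ cong (ℚ._* (½^ r ℚ.* recip N)) (sym (fromℕ-* k N)) ⟩
  fromℕ (k * N) ℚ.* (½^ r ℚ.* recip N) ≤⟨ *½^-≤ {k * N} {r} (recip N) (0≤recip N) h ⟩
  recip N ∎
  where
  open ℚ.≤-Reasoning
  lemma : ∀ a b c d → a ℚ.* b ℚ.* (c ℚ.* d) ≡ (a ℚ.* c) ℚ.* (b ℚ.* d)
  lemma = Ring.solve-∀ ℚ-ring

prob≡E : ∀ {A : Set} (B : A → Bool) (X : Rand A) → prob B X ≡ E (𝟙 ∘ B) X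
prob≡E B (flip l r) = cong₂ (λ x y → ½ ℚ.* (x ℚ.+ y)) (prob≡E B l) (prob≡E B r)
prob≡E B (return x) with B x
... | true = refl
... | false = refl

optimalCoverage : ∀ {n} → List (Subset n) → ℕ → ℕ
optimalCoverage 𝒞 k = coverage (Optimum.family (optimum 𝒞 k))

GoodSelection : ∀ {n} (k p cap : ℕ) → List (Subset n) → (Subset n → Bool) → Set
GoodSelection k p cap 𝒞 sel = length (chosen sel 𝒞) ≤ k × Guarantee p cap (optimalCoverage 𝒞 k) (coverage (chosen sel 𝒞))

goodSelection? : ∀ {n} k p cap 𝒞 sel → Dec (GoodSelection {n} k p cap 𝒞 sel)
goodSelection? k p cap 𝒞 sel = (length (chosen sel 𝒞) ℕ.≤? k) ×-dec ((_ ℕ.≤? _) ⊎-dec (_ ℕ.≤? _))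

-- The algorithm runs one program for every guess g of the magnitude 2^g of the optimum.
module Assemble {n} (k w ℓ p cap P : ℕ)
  (Seed : Vec (Table n) w → ℕ → Set) (draw : ∀ ts g → Rand (Seed ts g))
  (program : ∀ ts g → Seed ts g → ℕ → Subset n × List (Vec Bool w) → Sketch n (Subset n × List (Vec Bool w))) where

  St : Set
  St = Subset n × List (Vec Bool w)

  guesses : List ℕ
  guesses = range 0 (suc ℓ)

  Ω : Set
  Ω = Σ[ ts ∈ Vec (Table n) w ] All (Seed ts) guesses

  drawΩ : Rand Ω
  drawΩ = drawVec (randomTable n) w >>= λ ts → drawAll (draw ts) guesses >>= λ ωs → return (ts , ωs)

  programs : ∀ ts {gs} → All (Seed ts) gs → List (ℕ → St → Sketch n St)
  programs ts [] = []
  programs ts (_∷_ {x = g} ω ωs) = program ts g ω ∷ programs ts ωs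

  length-programs : ∀ ts {gs} (ωs : All (Seed ts) gs) → length (programs ts ωs) ≡ length gs
  length-programs ts [] = refl
  length-programs ts (_ ∷ ωs) = cong suc (length-programs ts ωs)

  programs-All : ∀ {Q : (ℕ → St → Sketch n St) → Set} → (∀ ts g ω → Q (program ts g ω)) → ∀ ts {gs} (ωs : All (Seed ts) gs) → All Q (programs ts ωs)
  programs-All h ts [] = []
  programs-All h ts (_∷_ {x = g} ω ωs) = h ts g ω ∷ programs-All h ts ωs

  pass : Ω → ℕ → List St → Sketch n (List St)
  pass (ts , ωs) = parallel (programs ts ωs)

  start : St
  start = Sub.⊥ , []

  initial : List St
  initial = map (λ _ → start) guesses

  best : List St → St
  best [] = start
  best (σ ∷ σs) = if ∣ proj₁ (best σs) ∣ ℕ.≤ᵇ ∣ proj₁ σ ∣ then σ else best σs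

  best∈ : ∀ σs → best σs ≡ start ⊎ best σs ∈ σs
  best∈ [] = inj₁ refl
  best∈ (σ ∷ σs) with ∣ proj₁ (best σs) ∣ ℕ.≤ᵇ ∣ proj₁ σ ∣ | best∈ σs
  ... | true | _ = inj₂ (here refl)
  ... | false | inj₁ eq = inj₁ eq
  ... | false | inj₂ b∈ = inj₂ (there b∈)

  best-max : ∀ {σ σs} → σ ∈ σs → ∣ proj₁ σ ∣ ≤ ∣ proj₁ (best σs) ∣
  best-max {σs = σ ∷ σs} σ∈ with ∣ proj₁ (best σs) ∣ ℕ.≤ᵇ ∣ proj₁ σ ∣ in eq | σ∈
  ... | true | here refl = ℕ.≤-refl
  ... | true | there σ∈′ = ℕ.≤-trans (best-max σ∈′) (ℕ.≤ᵇ⇒≤ _ _ (subst T (sym eq) tt))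
  ... | false | here refl = ℕ.<⇒≤ (ℕ.≰⇒> (λ h → subst T eq (ℕ.≤⇒≤ᵇ h)))
  ... | false | there σ∈′ = best-max σ∈′

  named? : ∀ (ts : Vec (Table n) w) (L : List (Vec Bool w)) S → Dec (nameOf ts S ∈ L)
  named? ts L S = Any.any? (nameOf ts S ≟ˢ_) L

  out : Ω → List St → Subset n → Bool
  out (ts , _) σs S = does (named? ts (proj₂ (best σs)) S)

  select : List (Subset n) → Ω → Subset n → Bool
  select 𝒞 ω = out ω (iterate 𝒞 (pass ω) 0 P initial)

  opt : List (Subset n) → ℕ
  opt 𝒞 = optimalCoverage 𝒞 k

  Good : List (Subset n) → (Subset n → Bool) → Set
  Good = GoodSelection k p cap

  module _ (𝒞 : List (Subset n)) where

    open Optimum (optimum 𝒞 k) renaming (family to 𝒯)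

    abstract
      final : ∀ ts g → Seed ts g → St
      final ts g ω = iterate 𝒞 (program ts g ω) 0 P start

      final-def : ∀ ts g ω → iterate 𝒞 (program ts g ω) 0 P start ≡ final ts g ω
      final-def ts g ω = refl

    finals : ∀ ts {gs} → All (Seed ts) gs → List St
    finals ts [] = []
    finals ts (_∷_ {x = g} ω ωs) = final ts g ω ∷ finals ts ωs

    iterate-programs : ∀ ts {gs} (ωs : All (Seed ts) gs) →
      iterate 𝒞 (parallel (programs ts ωs)) 0 P (map (λ _ → start) gs) ≡ finals ts ωs
    iterate-programs ts [] = iterate-[] 𝒞 0 P
    iterate-programs ts (_∷_ {x = g} {xs = gs} ω ωs) = trans (iterate-∷ 𝒞 (program ts g ω) (programs ts ωs) 0 P start (map (λ _ → start) gs))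
      (cong₂ _∷_ (final-def ts g ω) (iterate-programs ts ωs))

    finals-lookup : ∀ ts {gs g} (ωs : All (Seed ts) gs) (g∈ : g ∈ gs) → final ts g (All.lookup ωs g∈) ∈ finals ts ωs
    finals-lookup ts (ω ∷ ωs) (here refl) = here refl
    finals-lookup ts (ω ∷ ωs) (there g∈) = there (finals-lookup ts ωs g∈)

    finals-∀ : ∀ ts {gs} (ωs : All (Seed ts) gs) (Q : St → Set) → (∀ {g} (g∈ : g ∈ gs) → Q (final ts g (All.lookup ωs g∈))) →
      ∀ {σ} → σ ∈ finals ts ωs → Q σ
    finals-∀ ts (ω ∷ ωs) Q h (here refl) = h (here refl)
    finals-∀ ts (ω ∷ ωs) Q h (there σ∈) = finals-∀ ts ωs Q (h ∘ there) σ∈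

    GoodState : Vec (Table n) w → ℕ → St → Set
    GoodState ts g σ = SoundFor 𝒞 cap (nameOf ts) σ × (0 < cap → 2 ^ g ≤ opt 𝒞 → opt 𝒞 < 2 ^ suc g → Guarantee p cap (opt 𝒞) ∣ proj₁ σ ∣)

    guarantee-mono : ∀ {o c c′} → c ≤ c′ → Guarantee p cap o c → Guarantee p cap o c′
    guarantee-mono {o} c≤ (inj₁ h) = inj₁ (ℕ.≤-trans (ℕ.*-monoʳ-≤ ((suc p * cap) ^ cap) (ℕ.∸-monoʳ-≤ o c≤)) h)
    guarantee-mono {o} c≤ (inj₂ h) = inj₂ (ℕ.≤-trans (ℕ.*-monoʳ-≤ 4 (ℕ.∸-monoʳ-≤ o c≤)) h)

    module _ (n≤2^ℓ : n ≤ 2 ^ ℓ) (cap≤k : cap ≤ k) (length𝒯≤cap : length 𝒯 ≤ cap) where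

      good : ∀ ts (ωs : All (Seed ts) guesses) → InjectiveOn 𝒞 (nameOf ts) →
        (∀ {g} (g∈ : g ∈ guesses) → GoodState ts g (final ts g (All.lookup ωs g∈))) → Good 𝒞 (select 𝒞 (ts , ωs))
      good ts ωs injective guessGood = subst (λ σs → Good 𝒞 (out (ts , ωs) σs)) (sym (iterate-programs ts ωs)) (few , guarantee)
        where
        σs = finals ts ωs
        C = proj₁ (best σs)
        L = proj₂ (best σs)
        sel = out (ts , ωs) σs
        sound : SoundFor 𝒞 cap (nameOf ts) (best σs)
        sound = cases (best∈ σs)
          where
          cases : best σs ≡ start ⊎ best σs ∈ σs → SoundFor 𝒞 cap (nameOf ts) (best σs)
          cases (inj₁ eq) = subst (SoundFor 𝒞 cap (nameOf ts)) (sym eq) (z≤n , z≤n , λ x∈ → contradiction x∈ Sub.∉⊥)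
          cases (inj₂ b∈) = finals-∀ ts ωs (SoundFor 𝒞 cap (nameOf ts)) (λ g∈ → proj₁ (guessGood g∈)) b∈
        selected : ∀ {S} → T (sel S) → nameOf ts S ∈ L
        selected {S} h = toWitness {a? = named? ts L S} (subst T (sym (Dec.isYes≗does (named? ts L S))) h)
        selects : ∀ {S} → nameOf ts S ∈ L → T (sel S)
        selects {S} ν∈ = subst T (sym (Dec.dec-true (named? ts L S) ν∈)) tt
        few : length (chosen sel 𝒞) ≤ k
        few = ℕ.≤-trans (injection-length (nameOf ts) (chosen! sel 𝒞)
            (λ S∈ S′∈ → injective (proj₁ (chosen⊆ sel 𝒞 S∈)) (proj₁ (chosen⊆ sel 𝒞 S′∈))) (λ {S} S∈ → selected {S} (proj₂ (chosen⊆ sel 𝒞 S∈))))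
          (ℕ.≤-trans (proj₁ sound) cap≤k)
        covers : ∣ C ∣ ≤ coverage (chosen sel 𝒞)
        covers = Sub.p⊆q⇒∣p∣≤∣q∣ λ x∈ → let (S , S∈ , ν∈ , x∈S) = proj₂ (proj₂ sound) x∈ in ∈⋃⁺ (∈chosen sel 𝒞 S∈ (selects {S} ν∈)) x∈S
        guarantee : Guarantee p cap (opt 𝒞) (coverage (chosen sel 𝒞))
        guarantee = cases (0 ℕ.<? opt 𝒞) (0 ℕ.<? cap)
          where
          no-family : ∀ 𝒯 → length 𝒯 ≤ 0 → coverage {n} 𝒯 ≡ 0
          no-family [] _ = Sub.∣⊥∣≡0 n
          right : 0 < cap → ∃[ g ] g ≤ ℓ × 2 ^ g ≤ opt 𝒞 × opt 𝒞 < 2 ^ suc g → Guarantee p cap (opt 𝒞) (coverage (chosen sel 𝒞))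
          right 0<cap (g , g≤ℓ , 2^g≤ , <2^g) =
            guarantee-mono {opt 𝒞} (ℕ.≤-trans (best-max (finals-lookup ts ωs g∈)) covers) (proj₂ (guessGood g∈) 0<cap 2^g≤ <2^g)
            where
            g∈ : g ∈ guesses
            g∈ = ∈-range 0 (suc ℓ) z≤n (s≤s g≤ℓ)
          cases : Dec (0 < opt 𝒞) → Dec (0 < cap) → Guarantee p cap (opt 𝒞) (coverage (chosen sel 𝒞))
          cases (no ¬0<opt) _ = inj₂ (ℕ.≤-trans (ℕ.*-monoʳ-≤ 4 (ℕ.≤-trans (ℕ.m∸n≤m (opt 𝒞) (coverage (chosen sel 𝒞))) (ℕ.m<1+n⇒m≤n (ℕ.≰⇒> ¬0<opt)))) z≤n)
          cases (yes 0<opt) (no ¬0<cap) = contradiction 0<opt (ℕ.≤⇒≯ (ℕ.≤-reflexive (no-family 𝒯 (ℕ.≤-trans length𝒯≤cap (ℕ.m<1+n⇒m≤n (ℕ.≰⇒> ¬0<cap))))))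
          cases (yes 0<opt) (yes 0<cap) = right 0<cap (floorLog (opt 𝒞) ℓ 0<opt (ℕ.≤-trans (Sub.∣p∣≤n (⋃ 𝒯)) n≤2^ℓ))

      fail-Ω : ∀ {γ β} → Fail (drawVec (randomTable n) w) (InjectiveOn 𝒞 ∘ nameOf) β →
        (∀ ts g → Fail (draw ts g) (λ ω → GoodState ts g (final ts g ω)) γ) →
        fromℕ (suc ℓ) ℚ.* γ ℚ.≤ β → Fail drawΩ (λ ω → Good 𝒞 (select 𝒞 ω)) (β ℚ.+ β)
      fail-Ω {γ} fail-injective fail-guess small = fail-bind (drawVec (randomTable n) w) _ fail-injective (fail-0≤ (drawVec (randomTable n) w) fail-injective) (λ ts injective →
        fail-map (drawAll (draw ts) guesses) (ts ,_)
          (fail-weaken (drawAll (draw ts) guesses) (λ ωs h → good ts ωs injective (λ {g} g∈ → h g∈))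
            (ℚ.≤-trans (ℚ.≤-reflexive (cong (λ i → fromℕ i ℚ.* γ) (length-range 0 (suc ℓ)))) small)
            (fail-drawAll-∀ {P = λ {g} ω → GoodState ts g (final ts g ω)} (draw ts) (fail-guess ts) guesses)))

module Instance {n} (m k M ℓ p ρ a₀ e r W₁ : ℕ) (0<p : 0 < p) (m≤2^M : m ≤ 2 ^ M) (n≤2^ℓ : n ≤ 2 ^ ℓ)
  (reps≤ : ∀ θ .{{_ : NonZero θ}} → (n ℕ./ θ + suc a₀) * 64 ≤ 2 ^ r)
  (rows≤ : ∀ θ .{{_ : NonZero θ}} → (n ℕ./ θ + suc a₀) * 64 * ((M + (2 * M + (2 + ρ)) + suc ℓ * (2 * θ ⊓ n)) + (r + suc a₀)) ≤ W₁)
  (events≤ : suc ℓ * (suc (3 * suc p) * ((3 + 3 * M) * (suc M * suc M))) ≤ 2 ^ e)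
  (a₀≡ : a₀ ≡ e + (2 + ρ)) where

  q a lg b w cap P : ℕ
  q = suc p
  a = suc a₀
  lg = suc ℓ
  b = 2 + ρ
  w = 2 * M + b
  cap = k ⊓ m
  P = suc (3 * q) * (3 + 3 * M)

  module Named (ts : Vec (Table n) w) = Guess w m cap M lg a (r + a) p (nameOf ts)

  program : ∀ ts g → Named.GuessSeed ts g → ℕ → Subset n × List (Vec Bool w) → Sketch n (Subset n × List (Vec Bool w))
  program ts g ω = nth pureˢ (Named.guessSketches ts g ω)

  open Assemble {n} k w ℓ p cap P Named.GuessSeed Named.drawGuess program

  n<2^lg : suc n ≤ 2 ^ lg
  n<2^lg = ℕ.≤-trans (ℕ.+-mono-≤ (ℕ.m^n>0 2 ℓ) n≤2^ℓ) (ℕ.≤-reflexive (cong (_+_ (2 ^ ℓ)) (sym (ℕ.+-identityʳ (2 ^ ℓ)))))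

  δ γ : ℚ
  δ = ½^ a₀
  γ = fromℕ (suc (3 * q)) ℚ.* (fromℕ (3 + 3 * M) ℚ.* (fromℕ (length (List.cartesianProduct (range 0 (suc M)) (range 0 (suc M)))) ℚ.* δ))

  δ-large : ∀ θ .{{_ : NonZero θ}} → fromℕ ((n ℕ./ θ + a) * 64) ℚ.* ½^ (r + a) ℚ.+ ½^ a ℚ.≤ δ
  δ-large θ = ℚ.≤-trans (ℚ.+-monoˡ-≤ (½^ a) (subst (λ x → fromℕ ((n ℕ./ θ + a) * 64) ℚ.* x ℚ.≤ ½^ a) (sym (½^-+ r a)) (*½^-≤ {(n ℕ./ θ + a) * 64} {r} (½^ a) (0≤½^ a) (reps≤ θ))))
    (ℚ.≤-reflexive (trans (sym (ℚ.*-distribˡ-+ ½ δ δ)) (½*[p+p]≡p δ)))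

  γ-small : fromℕ (suc ℓ) ℚ.* γ ℚ.≤ ½^ b
  γ-small = begin
    fromℕ (suc ℓ) ℚ.* (x ℚ.* (y ℚ.* (fromℕ (length (List.cartesianProduct (range 0 (suc M)) (range 0 (suc M)))) ℚ.* δ)))
      ≡⟨ cong (λ j → fromℕ (suc ℓ) ℚ.* (x ℚ.* (y ℚ.* (fromℕ j ℚ.* δ))))
           (trans (length-cartesianProduct (range 0 (suc M)) (range 0 (suc M))) (cong₂ _*_ (length-range 0 (suc M)) (length-range 0 (suc M)))) ⟩
    fromℕ (suc ℓ) ℚ.* (x ℚ.* (y ℚ.* (fromℕ (suc M * suc M) ℚ.* δ))) ≡⟨ lemma (fromℕ (suc ℓ)) x y (fromℕ (suc M * suc M)) δ ⟩
    fromℕ (suc ℓ) ℚ.* (x ℚ.* (y ℚ.* fromℕ (suc M * suc M))) ℚ.* δ ≡⟨ cong (ℚ._* δ) (sym (trans (fromℕ-* (suc ℓ) (suc (3 * q) * ((3 + 3 * M) * (suc M * suc M)))) (cong (fromℕ (suc ℓ) ℚ.*_) (trans (fromℕ-* (suc (3 * q)) ((3 + 3 * M) * (suc M * suc M))) (cong (x ℚ.*_) (fromℕ-* (3 + 3 * M) (suc M * suc M))))))) ⟩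
    fromℕ events ℚ.* δ ≡⟨ cong (fromℕ events ℚ.*_) (trans (cong ½^_ a₀≡) (½^-+ e b)) ⟩
    fromℕ events ℚ.* (½^ e ℚ.* ½^ b) ≤⟨ *½^-≤ {events} {e} (½^ b) (0≤½^ b) events≤ ⟩
    ½^ b ∎
    where
    open ℚ.≤-Reasoning
    events = suc ℓ * (suc (3 * q) * ((3 + 3 * M) * (suc M * suc M)))
    x = fromℕ (suc (3 * q))
    y = fromℕ (3 + 3 * M)
    lemma : ∀ a b c d z → a ℚ.* (b ℚ.* (c ℚ.* (d ℚ.* z))) ≡ a ℚ.* (b ℚ.* (c ℚ.* d)) ℚ.* z
    lemma = Ring.solve-∀ ℚ-ring

  module _ (𝒞 : List (Subset n)) (len≤m : length 𝒞 ≤ m) where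

    open Optimum (optimum 𝒞 k) renaming (family to 𝒯)

    module An (ts : Vec (Table n) w) = Guess.GuessAnalysis w m cap M lg a (r + a) p (nameOf ts) 𝒞 len≤m m≤2^M n<2^lg δ δ-large

    length𝒯≤cap : length 𝒯 ≤ cap
    length𝒯≤cap = ℕ.⊓-glb length≤ (ℕ.≤-trans (injection-length (λ S → S) unique (λ _ _ eq → eq) ⊆𝒞) len≤m)

    single : 0 < cap → ∀ {S} → S ∈ 𝒞 → ∣ S ∣ ≤ opt 𝒞
    single 0<cap {S} S∈ = ℕ.≤-trans (Sub.p⊆q⇒∣p∣≤∣q∣ {p = S} {q = S ∪ Sub.⊥} (Sub.p⊆p∪q Sub.⊥))
      (proj₂ isOptimum (S ∷ []) (ℕ.≤-trans 0<cap (ℕ.m⊓n≤m k m) , unique-choice {𝒞 = 𝒞} {S ∷ []} ([] ∷ []) (λ { (here refl) → S∈ })))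

    final≡ : ∀ ts g (ω : Named.GuessSeed ts g) → final 𝒞 ts g ω ≡ An.actGuess ts g ω start
    final≡ ts g ω = trans (sym (final-def 𝒞 ts g ω)) (trans (cong (λ x → iterate 𝒞 (program ts g ω) 0 x start)
        (sym (trans (Named.length-guessSketches ts g ω) (cong (_* (3 + 3 * M)) (length-range 0 (suc (3 * q)))))))
      (trans (iterate-nth 𝒞 pureˢ (Named.guessSketches ts g ω) start) (An.foldl-guessSketches ts g ω start)))

    Sound : ∀ ts g → Named.GuessSeed ts g → Set
    Sound ts g ω = An.Sound ts (An.actGuess ts g ω start)

    Right : ℕ → Set
    Right g = 0 < cap × 2 ^ g ≤ opt 𝒞 × opt 𝒞 < 2 ^ suc g

    sound-final : ∀ ts g ω → Sound ts g ω → SoundFor 𝒞 cap (nameOf ts) (final 𝒞 ts g ω)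
    sound-final ts g ω = subst (SoundFor 𝒞 cap (nameOf ts)) (sym (final≡ ts g ω))

    good-wrong : ∀ ts g → ¬ Right g → ∀ ω → Sound ts g ω → GoodState 𝒞 ts g (final 𝒞 ts g ω)
    good-wrong ts g ¬right ω sound = sound-final ts g ω sound , λ h₁ h₂ h₃ → contradiction (h₁ , h₂ , h₃) ¬right

    good-right : ∀ ts g ω → Sound ts g ω × Guarantee p cap (opt 𝒞) ∣ proj₁ (An.actGuess ts g ω start) ∣ → GoodState 𝒞 ts g (final 𝒞 ts g ω)
    good-right ts g ω (sound , guarantee) = sound-final ts g ω sound ,
      λ _ _ _ → subst (λ σ → Guarantee p cap (opt 𝒞) ∣ proj₁ σ ∣) (sym (final≡ ts g ω)) guarantee

    fail-sound : ∀ ts g → Fail (Named.drawGuess ts g) (Sound ts g) γ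
    fail-sound ts g = An.fail-sound ts g

    fail-guess : ∀ ts g → Fail (Named.drawGuess ts g) (λ ω → GoodState 𝒞 ts g (final 𝒞 ts g ω)) γ
    fail-guess ts g = cases ((0 ℕ.<? cap) ×-dec (2 ^ g ℕ.≤? opt 𝒞) ×-dec (opt 𝒞 ℕ.<? 2 ^ suc g))
      where
      fail-right : Right g → Fail (Named.drawGuess ts g) (λ ω → Sound ts g ω × Guarantee p cap (opt 𝒞) ∣ proj₁ (An.actGuess ts g ω start) ∣) γ
      fail-right (0<cap , 2^g≤ , <2^g) = An.Right.fail-right ts 0<p 0<cap (ℕ.m⊓n≤n k m) 𝒯 ⊆𝒞 length𝒯≤cap (single 0<cap) g 2^g≤ <2^g
      cases : Dec (Right g) → Fail (Named.drawGuess ts g) (λ ω → GoodState 𝒞 ts g (final 𝒞 ts g ω)) γ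
      cases (yes right) = fail-weaken (Named.drawGuess ts g) (good-right ts g) ℚ.≤-refl (fail-right right)
      cases (no ¬right) = fail-weaken (Named.drawGuess ts g) (good-wrong ts g ¬right) ℚ.≤-refl (fail-sound ts g)

    fail-good : Fail drawΩ (λ ω → Good 𝒞 (select 𝒞 ω)) (½^ suc ρ)
    fail-good = fail-weaken drawΩ (λ _ h → h) (ℚ.≤-reflexive (trans (sym (ℚ.*-distribˡ-+ ½ (½^ suc ρ) (½^ suc ρ))) (½*[p+p]≡p (½^ suc ρ))))
      (fail-Ω 𝒞 n≤2^ℓ (ℕ.m⊓n≤m k m) length𝒯≤cap {γ} (fail-names 𝒞 {m} {M} len≤m m≤2^M b) fail-guess γ-small)

  bad : List (Subset n) → Ω → Bool
  bad 𝒞 ω = (length 𝒞 ℕ.≤ᵇ m) ∧ not (does (goodSelection? k p cap 𝒞 (select 𝒞 ω)))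

  bad≤ : ∀ 𝒞 → E (𝟙 ∘ bad 𝒞) drawΩ ℚ.≤ ½^ suc ρ
  bad≤ 𝒞 = cases (length 𝒞 ℕ.≤? m)
    where
    cases : Dec (length 𝒞 ≤ m) → E (𝟙 ∘ bad 𝒞) drawΩ ℚ.≤ ½^ suc ρ
    cases (yes len≤m) = E-fail drawΩ (bad 𝒞) (λ ω h → trans (cong (λ x → (length 𝒞 ℕ.≤ᵇ m) ∧ not x) (Dec.dec-true (goodSelection? k p cap 𝒞 (select 𝒞 ω)) h)) (Bool.∧-zeroʳ (length 𝒞 ℕ.≤ᵇ m))) (fail-good 𝒞 len≤m)
    cases (no len≰m) = ℚ.≤-trans (ℚ.≤-reflexive (trans (E-cong drawΩ (λ ω → cong (λ x → 𝟙 (x ∧ not (does (goodSelection? k p cap 𝒞 (select 𝒞 ω))))) (Dec.dec-false (length 𝒞 ℕ.≤? m) len≰m))) (E-const 0ℚ drawΩ))) (0≤½^ (suc ρ))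

  configs : List (List (Subset n))
  configs = listsUpTo (allVecs n) m

  abstract
    table : Σ[ t ∈ (Vec Bool ρ → Ω) ] (∀ {𝒞} → 𝒞 ∈ configs → countBits (bad 𝒞 ∘ t) ≤ suc (suc n * m))
    table = Derandomize.derandomize drawΩ bad (½^ suc ρ) (0≤½^ (suc ρ)) bad≤ configs ρ (suc n * m) refl
      (length-listsUpTo (allVecs n) n (ℕ.≤-reflexive (length-allVecs n)) m)

  choice : Vec Bool ρ → Ω
  choice = proj₁ table

  Short : Subset n × List (Vec Bool w) → Set
  Short (C , L) = length L ≤ ∣ C ∣

  Inv : List (Subset n × List (Vec Bool w)) → Set
  Inv σs = length σs ≤ suc ℓ × All Short σs

  statesCodec : Codec (List (Subset n × List (Vec Bool w)))
  statesCodec = listCodec (suc ℓ) (bitsCodec n ×-codec listCodec n (bitsCodec w))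

  inv⇒fit : ∀ {σs} → Inv σs → Fit statesCodec σs
  inv⇒fit (len , short) = len , All.map (λ {(C , L)} L≤C → tt , ℕ.≤-trans L≤C (Sub.∣p∣≤n C) , All.tabulate (λ _ → tt)) short

  inv-initial : Inv initial
  inv-initial = ℕ.≤-reflexive (trans (List.length-map (λ _ → start) guesses) (length-range 0 (suc ℓ))) , AllP.map⁺ {xs = guesses} (All.tabulate (λ _ → z≤n))

  length-programs≡ : ∀ ω → length (programs (proj₁ ω) (proj₂ ω)) ≡ suc ℓ
  length-programs≡ (ts , ωs) = trans (length-programs ts {guesses} ωs) (length-range 0 (suc ℓ))

  inv-pass : ∀ v i σs cs → Inv σs → Inv (decode (pass (choice v) i σs) cs)
  inv-pass v i σs cs (_ , short) =
    ℕ.≤-trans (length-parallel (programs ts ωs) i σs cs) (ℕ.≤-reflexive (length-programs≡ (choice v))) ,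
    parallel-invariant Short (programs ts ωs)
      (programs-All (λ ts g ω i → nth-All {P = λ f → ∀ σ cs → Short σ → Short (decode (f σ) cs)} (λ _ _ h → h) (Named.short-guess ts g ω) i) ts ωs) i σs cs short
    where
    ts = proj₁ (choice v)
    ωs = proj₂ (choice v)

  W : ℕ
  W = suc ℓ * (suc M * suc M * W₁)

  size≤W : ∀ v i σs → size (pass (choice v) i σs) ≤ W
  size≤W v i σs = ℕ.≤-trans (size-parallel (suc M * suc M * W₁) (programs ts ωs)
      (programs-All (λ ts g ω i → nth-All {P = λ f → ∀ σ → size (f σ) ≤ suc M * suc M * W₁} (λ _ → z≤n) (bound ts g ω) i) ts ωs) i σs)
    (ℕ.≤-reflexive (cong (_* (suc M * suc M * W₁)) (length-programs≡ (choice v))))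
    where
    ts = proj₁ (choice v)
    ωs = proj₂ (choice v)
    bound : ∀ ts g (ω : Named.GuessSeed ts g) → All (λ f → ∀ σ → size (f σ) ≤ suc M * suc M * W₁) (Named.guessSketches ts g ω)
    bound ts g ω = subst (λ x → All (λ f → ∀ σ → size (f σ) ≤ x * W₁) (Named.guessSketches ts g ω))
      (trans (length-cartesianProduct (range 0 (suc M)) (range 0 (suc M))) (cong₂ _*_ (length-range 0 (suc M)) (length-range 0 (suc M))))
      (Named.size-guessSketches ts W₁ (λ t i → rows≤ (Named.Θ ts t i) {{Named.Θ≢0 ts {t} {i}}}) g ω)

  open Simulation m (suc M) P W ρ (ℕ.<-≤-trans (s≤s m≤2^M) (ℕ.+-mono-≤ (ℕ.m^n>0 2 M) (ℕ.m≤m+n (2 ^ M) 0)))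
    statesCodec initial (λ v → pass (choice v)) (λ v → out (choice v)) Inv inv⇒fit inv-initial inv-pass size≤W public
    using (algorithm; run-spec)

  open StreamingAlgorithm algorithm using (run; output)

  success-probability : ∀ N .{{_ : NonZero N}} → suc (suc n * m) * N ≤ 2 ^ ρ → ∀ a 𝒞 → Defines a 𝒞 → length 𝒞 ≤ m →
    Pr[ run a ∈ (λ s → GoodSelection k p cap 𝒞 (output s)) ]≥ (1ℚ ℚ.- recip N)
  success-probability N large a 𝒞 defines len≤m = (λ s → isGood (output s)) , (λ s → toGood (output s)) , (begin
    1ℚ ℚ.- recip N ≤⟨ ℚ.+-monoʳ-≤ 1ℚ (ℚ.neg-antimono-≤ few) ⟩
    1ℚ ℚ.- E (𝟙 ∘ bad 𝒞 ∘ choice) (uniform ρ) ≡⟨ lemma (E (𝟙 ∘ bad 𝒞 ∘ choice) (uniform ρ)) ⟩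
    1ℚ ℚ.+ (ℚ.- 1ℚ) ℚ.* E (𝟙 ∘ bad 𝒞 ∘ choice) (uniform ρ) ≡⟨ sym (trans (E-+ (λ _ → 1ℚ) (λ v → (ℚ.- 1ℚ) ℚ.* 𝟙 (bad 𝒞 (choice v))) (uniform ρ)) (cong₂ ℚ._+_ (E-const 1ℚ (uniform ρ)) (E-* (ℚ.- 1ℚ) (𝟙 ∘ bad 𝒞 ∘ choice) (uniform ρ)))) ⟩
    E (λ v → 1ℚ ℚ.+ (ℚ.- 1ℚ) ℚ.* 𝟙 (bad 𝒞 (choice v))) (uniform ρ) ≡⟨ E-cong (uniform ρ) (λ v → complement (isGood (select 𝒞 (choice v)))) ⟩
    E (λ v → 𝟙 (isGood (select 𝒞 (choice v)))) (uniform ρ) ≡⟨ sym (run-spec a 𝒞 defines len≤m (𝟙 ∘ isGood)) ⟩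
    E (λ s → 𝟙 (isGood (output s))) (run a) ≡⟨ sym (prob≡E (λ s → isGood (output s)) (run a)) ⟩
    prob (λ s → isGood (output s)) (run a) ∎)
    where
    open ℚ.≤-Reasoning
    isGood : (Subset n → Bool) → Bool
    isGood sel = does (goodSelection? k p cap 𝒞 sel)
    toGood : ∀ sel → T (isGood sel) → Good 𝒞 sel
    toGood sel h = toWitness {a? = goodSelection? k p cap 𝒞 sel} (subst T (sym (Dec.isYes≗does (goodSelection? k p cap 𝒞 sel))) h)
    lemma : ∀ x → 1ℚ ℚ.- x ≡ 1ℚ ℚ.+ (ℚ.- 1ℚ) ℚ.* x
    lemma = Ring.solve-∀ ℚ-ring
    complement : ∀ g → 1ℚ ℚ.+ (ℚ.- 1ℚ) ℚ.* 𝟙 ((length 𝒞 ℕ.≤ᵇ m) ∧ not g) ≡ 𝟙 g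
    complement g rewrite ⟶true (ℕ.≤⇒≤ᵇ len≤m) with g
    ... | true = refl
    ... | false = refl
    few : E (𝟙 ∘ bad 𝒞 ∘ choice) (uniform ρ) ℚ.≤ recip N
    few = ℚ.≤-trans (ℚ.≤-reflexive (E-countBits ρ (bad 𝒞 ∘ choice)))
      (*½^≤recip (countBits (bad 𝒞 ∘ choice)) N ρ (ℕ.≤-trans (ℕ.*-monoˡ-≤ N (proj₂ table {𝒞} (∈-listsUpTo {xs = allVecs n} ∈-allVecs m len≤m))) large))

-- Quantities bounded by a constant times a power of ℓ, where 1 ≤ M ≤ ℓ

infixl 6 _⊕_
infixl 7 _⊗_

data Expr : Set where
  con : ℕ → Expr
  varM varℓ : Expr
  _⊕_ _⊗_ : Expr → Expr → Expr

⟦_⟧ : Expr → (M ℓ : ℕ) → ℕ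
⟦ con x ⟧ M ℓ = x
⟦ varM ⟧ M ℓ = M
⟦ varℓ ⟧ M ℓ = ℓ
⟦ x ⊕ y ⟧ M ℓ = ⟦ x ⟧ M ℓ + ⟦ y ⟧ M ℓ
⟦ x ⊗ y ⟧ M ℓ = ⟦ x ⟧ M ℓ * ⟦ y ⟧ M ℓ

degree coefficient : Expr → ℕ
degree (con x) = 0
degree varM = 1
degree varℓ = 1
degree (x ⊕ y) = degree x + degree y
degree (x ⊗ y) = degree x + degree y
coefficient (con x) = x
coefficient varM = 1
coefficient varℓ = 1
coefficient (x ⊕ y) = coefficient x + coefficient y
coefficient (x ⊗ y) = coefficient x * coefficient y

expr-bound : ∀ x {M ℓ} → M ≤ ℓ → 0 < ℓ → ⟦ x ⟧ M ℓ ≤ coefficient x * ℓ ^ degree x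
expr-bound (con x) M≤ℓ 0<ℓ = ℕ.≤-reflexive (sym (ℕ.*-identityʳ x))
expr-bound varM {M} {ℓ} M≤ℓ 0<ℓ = ℕ.≤-trans M≤ℓ (ℕ.≤-reflexive (lemma ℓ))
  where
  lemma : ∀ ℓ → ℓ ≡ 1 * (ℓ * 1)
  lemma = solve-∀
expr-bound varℓ {M} {ℓ} M≤ℓ 0<ℓ = ℕ.≤-reflexive (lemma ℓ)
  where
  lemma : ∀ ℓ → ℓ ≡ 1 * (ℓ * 1)
  lemma = solve-∀
expr-bound (x ⊕ y) {M} {ℓ} M≤ℓ 0<ℓ = begin
  ⟦ x ⟧ M ℓ + ⟦ y ⟧ M ℓ ≤⟨ ℕ.+-mono-≤ (expr-bound x M≤ℓ 0<ℓ) (expr-bound y M≤ℓ 0<ℓ) ⟩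
  cx * ℓ ^ dx + cy * ℓ ^ dy ≤⟨ ℕ.+-mono-≤ (ℕ.*-monoʳ-≤ cx (ℕ.^-monoʳ-≤ ℓ {{nz}} (ℕ.m≤m+n dx dy))) (ℕ.*-monoʳ-≤ cy (ℕ.^-monoʳ-≤ ℓ {{nz}} (ℕ.m≤n+m dy dx))) ⟩
  cx * ℓ ^ (dx + dy) + cy * ℓ ^ (dx + dy) ≡⟨ sym (ℕ.*-distribʳ-+ (ℓ ^ (dx + dy)) cx cy) ⟩
  (cx + cy) * ℓ ^ (dx + dy) ∎
  where
  open ℕ.≤-Reasoning
  nz = ℕ.>-nonZero 0<ℓ
  cx = coefficient x
  cy = coefficient y
  dx = degree x
  dy = degree y
expr-bound (x ⊗ y) {M} {ℓ} M≤ℓ 0<ℓ = begin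
  ⟦ x ⟧ M ℓ * ⟦ y ⟧ M ℓ ≤⟨ ℕ.*-mono-≤ (expr-bound x M≤ℓ 0<ℓ) (expr-bound y M≤ℓ 0<ℓ) ⟩
  cx * ℓ ^ dx * (cy * ℓ ^ dy) ≡⟨ lemma cx (ℓ ^ dx) cy (ℓ ^ dy) ⟩
  cx * cy * (ℓ ^ dx * ℓ ^ dy) ≡⟨ cong (cx * cy *_) (sym (ℕ.^-distribˡ-+-* ℓ dx dy)) ⟩
  cx * cy * ℓ ^ (dx + dy) ∎
  where
  open ℕ.≤-Reasoning
  cx = coefficient x
  cy = coefficient y
  dx = degree x
  dy = degree y
  lemma : ∀ a b c d → a * b * (c * d) ≡ a * c * (b * d)
  lemma = solve-∀

module Parameters (c p : ℕ) where

  q : ℕ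
  q = suc p

  -- The names correspond to the parameters of Instance; W₁ = 64 (n rowsᴱ₁ + rowsᴱ₂).
  bᴱ eᴱ a₀ᴱ aᴱ rᴱ wᴱ lgᴱ fixedᴱ rowsᴱ₁ rowsᴱ₂ passesᴱ ρᴱ spaceᴱ : Expr
  ρᴱ = con 2 ⊕ varℓ ⊕ con c ⊗ varℓ
  bᴱ = con 2 ⊕ ρᴱ
  eᴱ = (con 1 ⊕ varℓ) ⊗ (con (suc (3 * q)) ⊗ ((con 3 ⊕ con 3 ⊗ varM) ⊗ ((con 1 ⊕ varM) ⊗ (con 1 ⊕ varM))))
  a₀ᴱ = eᴱ ⊕ bᴱ
  aᴱ = con 1 ⊕ a₀ᴱ
  rᴱ = con 7 ⊕ varℓ ⊕ aᴱ
  wᴱ = con 2 ⊗ varM ⊕ bᴱ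
  lgᴱ = con 1 ⊕ varℓ
  fixedᴱ = varM ⊕ wᴱ ⊕ (rᴱ ⊕ aᴱ)
  rowsᴱ₁ = fixedᴱ ⊕ con 2 ⊗ lgᴱ ⊕ aᴱ ⊗ lgᴱ
  rowsᴱ₂ = aᴱ ⊗ fixedᴱ
  passesᴱ = con (suc (3 * q)) ⊗ (con 3 ⊕ con 3 ⊗ varM)
  spaceᴱ = ρᴱ ⊕ (passesᴱ ⊕ ((con 1 ⊕ varℓ) ⊗ (con 1 ⊕ (con 1 ⊕ (con 1 ⊕ wᴱ)))
    ⊕ (con 1 ⊕ varℓ) ⊗ ((con 1 ⊕ varM) ⊗ (con 1 ⊕ varM) ⊗ (con 64 ⊗ (rowsᴱ₁ ⊕ rowsᴱ₂))) ⊗ (con 1 ⊕ (con 1 ⊕ varM))))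

abstract
  spaceCoefficient : (c p : ℕ) → ℕ
  spaceCoefficient c p = coefficient (Parameters.spaceᴱ c p)

  spaceDegree : ℕ → ℕ
  spaceDegree c = degree (Parameters.spaceᴱ c 0)

  spaceCoefficient≡ : ∀ c p → spaceCoefficient c p ≡ coefficient (Parameters.spaceᴱ c p)
  spaceCoefficient≡ c p = refl

  spaceDegree≡ : ∀ c p → spaceDegree c ≡ degree (Parameters.spaceᴱ c p)
  spaceDegree≡ c p = refl

module Choice (c p n m k : ℕ) (0<p : 0 < p) where

  open Parameters c p

  M ℓ ρ a₀ e₀ r W₁ : ℕ
  M = ⌈log₂ m ⌉
  ℓ = M + ⌈log₂ n ⌉
  ρ = ⟦ ρᴱ ⟧ M ℓ
  a₀ = ⟦ a₀ᴱ ⟧ M ℓ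
  e₀ = ⟦ eᴱ ⟧ M ℓ
  r = ⟦ rᴱ ⟧ M ℓ
  W₁ = 64 * (n * ⟦ rowsᴱ₁ ⟧ M ℓ + ⟦ rowsᴱ₂ ⟧ M ℓ)

  n≤2^ℓ : n ≤ 2 ^ ℓ
  n≤2^ℓ = ℕ.≤-trans (n≤2^⌈log₂n⌉ n) (ℕ.^-monoʳ-≤ 2 (ℕ.m≤n+m ⌈log₂ n ⌉ M))

  nm≤2^ℓ : n * m ≤ 2 ^ ℓ
  nm≤2^ℓ = ℕ.≤-trans (ℕ.*-mono-≤ (n≤2^⌈log₂n⌉ n) (n≤2^⌈log₂n⌉ m)) (ℕ.≤-reflexive (trans (ℕ.*-comm (2 ^ ⌈log₂ n ⌉) (2 ^ M)) (sym (ℕ.^-distribˡ-+-* 2 M ⌈log₂ n ⌉))))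

  module _ (ℓ a r : ℕ) (n≤2^ℓ : n ≤ 2 ^ ℓ) (r≡ : r ≡ 7 + ℓ + a) where

    reps-bound : ∀ θ .{{_ : NonZero θ}} → (n ℕ./ θ + a) * 64 ≤ 2 ^ r
    reps-bound θ = begin
      (n ℕ./ θ + a) * 64 ≤⟨ ℕ.*-monoˡ-≤ 64 (ℕ.+-mono-≤ (ℕ.≤-trans (ℕ.m/n≤m n θ) n≤2^ℓ) (ℕ.<⇒≤ (n<2^n a))) ⟩
      (2 ^ ℓ + 2 ^ a) * 64 ≤⟨ ℕ.*-monoˡ-≤ 64 (ℕ.+-mono-≤ (ℕ.^-monoʳ-≤ 2 (ℕ.m≤m+n ℓ a)) (ℕ.^-monoʳ-≤ 2 (ℕ.m≤n+m a ℓ))) ⟩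
      (2 ^ (ℓ + a) + 2 ^ (ℓ + a)) * 64 ≡⟨ lemma (2 ^ (ℓ + a)) ⟩
      2 ^ 7 * 2 ^ (ℓ + a) ≡⟨ sym (ℕ.^-distribˡ-+-* 2 7 (ℓ + a)) ⟩
      2 ^ (7 + (ℓ + a)) ≡⟨ cong (2 ^_) (sym (trans r≡ (ℕ.+-assoc 7 ℓ a))) ⟩
      2 ^ r ∎
      where
      open ℕ.≤-Reasoning
      lemma : ∀ x → (x + x) * 64 ≡ 128 * x
      lemma = solve-∀

  rows-bound : ∀ a lg f θ .{{_ : NonZero θ}} → (n ℕ./ θ + a) * 64 * (f + lg * (2 * θ ⊓ n)) ≤ 64 * (n * (f + 2 * lg + a * lg) + a * f)
  rows-bound a lg f θ = begin
    (d + a) * 64 * (f + lg * t) ≡⟨ lemma d a f lg t ⟩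
    64 * (d * f + lg * (d * t) + (a * lg * t + a * f)) ≤⟨ ℕ.*-monoʳ-≤ 64 (ℕ.+-mono-≤ (ℕ.+-mono-≤ (ℕ.*-monoˡ-≤ f (ℕ.m/n≤m n θ)) (ℕ.*-monoʳ-≤ lg dt≤)) (ℕ.+-monoˡ-≤ (a * f) (ℕ.*-monoʳ-≤ (a * lg) (ℕ.m⊓n≤n (2 * θ) n)))) ⟩
    64 * (n * f + lg * (2 * n) + (a * lg * n + a * f)) ≡⟨ lemma′ n a f lg ⟩
    64 * (n * (f + 2 * lg + a * lg) + a * f) ∎
    where
    open ℕ.≤-Reasoning
    d = n ℕ./ θ
    t = 2 * θ ⊓ n
    dt≤ : d * t ≤ 2 * n
    dt≤ = begin
      d * t ≤⟨ ℕ.*-monoʳ-≤ d (ℕ.m⊓n≤m (2 * θ) n) ⟩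
      d * (2 * θ) ≡⟨ lemma″ d θ ⟩
      2 * (d * θ) ≤⟨ ℕ.*-monoʳ-≤ 2 (ℕ.m/n*n≤m n θ) ⟩
      2 * n ∎
      where
      lemma″ : ∀ d θ → d * (2 * θ) ≡ 2 * (d * θ)
      lemma″ = solve-∀
    lemma : ∀ d a f lg t → (d + a) * 64 * (f + lg * t) ≡ 64 * (d * f + lg * (d * t) + (a * lg * t + a * f))
    lemma = solve-∀
    lemma′ : ∀ n a f lg → 64 * (n * f + lg * (2 * n) + (a * lg * n + a * f)) ≡ 64 * (n * (f + 2 * lg + a * lg) + a * f)
    lemma′ = solve-∀

  regroup : ∀ M w x y → (M + w + x) + y ≡ (M + w + y) + x
  regroup = solve-∀

  rows≤W₁ : ∀ θ .{{_ : NonZero θ}} → (n ℕ./ θ + suc a₀) * 64 * ((M + (2 * M + (2 + ρ)) + suc ℓ * (2 * θ ⊓ n)) + (r + suc a₀)) ≤ W₁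
  rows≤W₁ θ = ℕ.≤-trans (ℕ.≤-reflexive (cong ((n ℕ./ θ + suc a₀) * 64 *_) (regroup M (2 * M + (2 + ρ)) (suc ℓ * (2 * θ ⊓ n)) (r + suc a₀))))
    (rows-bound (suc a₀) (suc ℓ) (M + (2 * M + (2 + ρ)) + (r + suc a₀)) θ)

  open Instance {n} m k M ℓ p ρ a₀ e₀ r W₁ 0<p (n≤2^⌈log₂n⌉ m) n≤2^ℓ
    (reps-bound ℓ (suc a₀) r n≤2^ℓ refl) rows≤W₁ (ℕ.<⇒≤ (n<2^n e₀)) refl public
    using (algorithm; success-probability)

  large : 0 < n → 0 < m → suc (suc n * m) * (n * m) ^ c ≤ 2 ^ ρ
  large 0<n 0<m = begin
    suc (suc n * m) * (n * m) ^ c ≤⟨ ℕ.*-mono-≤ few (ℕ.^-monoˡ-≤ c nm≤2^ℓ) ⟩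
    2 ^ (2 + ℓ) * (2 ^ ℓ) ^ c ≡⟨ cong (2 ^ (2 + ℓ) *_) (trans (ℕ.^-*-assoc 2 ℓ c) (cong (2 ^_) (ℕ.*-comm ℓ c))) ⟩
    2 ^ (2 + ℓ) * 2 ^ (c * ℓ) ≡⟨ sym (ℕ.^-distribˡ-+-* 2 (2 + ℓ) (c * ℓ)) ⟩
    2 ^ ρ ∎
    where
    open ℕ.≤-Reasoning
    few : suc (suc n * m) ≤ 2 ^ (2 + ℓ)
    few = begin
      1 + (m + n * m) ≤⟨ ℕ.+-mono-≤ (ℕ.*-mono-≤ 0<n 0<m) (ℕ.+-monoˡ-≤ (n * m) (ℕ.≤-trans (ℕ.≤-reflexive (sym (ℕ.*-identityˡ m))) (ℕ.*-monoˡ-≤ m 0<n))) ⟩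
      n * m + (n * m + n * m) ≤⟨ ℕ.m≤n+m _ (n * m) ⟩
      n * m + (n * m + (n * m + n * m)) ≡⟨ lemma (n * m) ⟩
      4 * (n * m) ≤⟨ ℕ.*-monoʳ-≤ 4 nm≤2^ℓ ⟩
      4 * 2 ^ ℓ ≡⟨ sym (ℕ.^-distribˡ-+-* 2 2 ℓ) ⟩
      2 ^ (2 + ℓ) ∎
      where
      lemma : ∀ x → x + (x + (x + x)) ≡ 4 * x
      lemma = solve-∀

  space≤ : 0 < n → 0 < M → StreamingAlgorithm.space algorithm ≤ spaceCoefficient c p * (n * ℓ ^ spaceDegree c)
  space≤ 0<n 0<M = subst₂ (λ C d → StreamingAlgorithm.space algorithm ≤ C * (n * ℓ ^ d)) (sym (spaceCoefficient≡ c p)) (sym (spaceDegree≡ c p)) (ℕ.≤-trans (bound ρ (⟦ passesᴱ ⟧ M ℓ) (suc ℓ) (⟦ wᴱ ⟧ M ℓ) (suc M * suc M) (⟦ rowsᴱ₁ ⟧ M ℓ) (⟦ rowsᴱ₂ ⟧ M ℓ) M)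
    (ℕ.≤-trans (ℕ.*-monoʳ-≤ n (expr-bound spaceᴱ (ℕ.m≤m+n M ⌈log₂ n ⌉) (ℕ.≤-trans 0<M (ℕ.m≤m+n M ⌈log₂ n ⌉)))) (ℕ.≤-reflexive (swap n (coefficient spaceᴱ) (ℓ ^ degree spaceᴱ)))))
    where
    swap : ∀ a b c → a * (b * c) ≡ b * (a * c)
    swap = solve-∀
    n≡ : ∀ x → x ≤ n * x
    n≡ x = ℕ.≤-trans (ℕ.≤-reflexive (sym (ℕ.*-identityˡ x))) (ℕ.*-monoˡ-≤ x 0<n)
    bound : ∀ ρ P G w B x y M → ρ + (P + (G * suc (n + n * suc w) + G * (B * (64 * (n * x + y))) * suc (suc M))) ≤
      n * (ρ + (P + (G * (1 + (1 + (1 + w))) + G * (B * (64 * (x + y))) * (1 + (1 + M)))))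
    bound ρ P G w B x y M = ℕ.≤-trans (ℕ.+-mono-≤ (n≡ ρ) (ℕ.+-mono-≤ (n≡ P) (ℕ.+-mono-≤
        (ℕ.*-monoʳ-≤ G (ℕ.+-monoˡ-≤ (n + n * suc w) 0<n))
        (ℕ.*-monoˡ-≤ (suc (suc M)) (ℕ.*-monoʳ-≤ G (ℕ.*-monoʳ-≤ B (ℕ.*-monoʳ-≤ 64 (ℕ.+-monoʳ-≤ (n * x) (n≡ y)))))))))
      (ℕ.≤-reflexive (lemma n ρ P G w B x y M))
      where
      lemma : ∀ n ρ P G w B x y M → n * ρ + (n * P + (G * (n + (n + n * (1 + w))) + G * (B * (64 * (n * x + n * y))) * (2 + M))) ≡
        n * (ρ + (P + (G * (1 + (1 + (1 + w))) + G * (B * (64 * (x + y))) * (1 + (1 + M)))))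
      lemma = solve-∀


  abstract
    coverageAlgorithm : CoverageAlgorithm n
    coverageAlgorithm = algorithm

    coverageAlgorithm≡ : algorithm ≡ coverageAlgorithm
    coverageAlgorithm≡ = refl

  coverageAlgorithm-passes : StreamingAlgorithm.passes coverageAlgorithm ≡ suc (3 * q) * (3 + 3 * M)
  coverageAlgorithm-passes = sym (cong StreamingAlgorithm.passes coverageAlgorithm≡)

  coverageAlgorithm-space : 0 < n → 0 < M → StreamingAlgorithm.space coverageAlgorithm ≤ spaceCoefficient c p * (n * ℓ ^ spaceDegree c)
  coverageAlgorithm-space 0<n 0<M = subst (λ A → StreamingAlgorithm.space A ≤ spaceCoefficient c p * (n * ℓ ^ spaceDegree c)) coverageAlgorithm≡ (space≤ 0<n 0<M)

  coverageAlgorithm-success : .{{_ : NonZero ((n * m) ^ c)}} → 0 < n → 0 < m → ∀ a 𝒞 → Defines a 𝒞 → length 𝒞 ≤ m →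
    Pr[ StreamingAlgorithm.run coverageAlgorithm a ∈ (λ s → GoodSelection k p (k ⊓ m) 𝒞 (StreamingAlgorithm.output coverageAlgorithm s)) ]≥ (1ℚ ℚ.- recip ((n * m) ^ c))
  coverageAlgorithm-success 0<n 0<m a 𝒞 defines len≤m =
    subst (λ A → Pr[ StreamingAlgorithm.run A a ∈ (λ s → GoodSelection k p (k ⊓ m) 𝒞 (StreamingAlgorithm.output A s)) ]≥ (1ℚ ℚ.- recip ((n * m) ^ c)))
      coverageAlgorithm≡ (success-probability ((n * m) ^ c) (large 0<n 0<m) a 𝒞 defines len≤m)

-- p + 1 is about 4/ε.
steps : ℚ → ℕ
steps ε = suc (4 * ℚ.↧ₙ ε ℕ./ suc (pred ℤ.∣ ℚ.↥ ε ∣))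

record Fraction (ε : ℚ) : Set where
  field
    num den : ℕ
    0<num : 0 < num
    num<den : num < den
    ε*den : ε ℚ.* fromℕ den ≡ fromℕ num
    steps≡ : steps ε ≡ suc (4 * den ℕ./ suc (pred num))

fraction : ∀ ε → 0ℚ ℚ.< ε → ε ℚ.< 1ℚ → Fraction ε
fraction ε@(ℚ.mkℚ (+ zero) d _) (ℚ.*<* (ℤ.+<+ ())) _
fraction ε@(ℚ.mkℚ ℤ.-[1+ u ] d _) (ℚ.*<* ()) _
fraction ε@(ℚ.mkℚ (+ suc u) d _) _ (ℚ.*<* lt) = record
  { num = suc u
  ; den = suc d
  ; 0<num = s≤s z≤n
  ; num<den = ℤ.drop‿+<+ (subst₂ ℤ._<_ (ℤ.*-identityʳ (+ suc u)) (ℤ.*-identityˡ (+ suc d)) lt)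
  ; ε*den = trans (cong (ε ℚ.*_) (fromℕ-mk (suc d))) (trans
      (ℚ.toℚᵘ-injective (ℚᵘ.≃-trans (ℚ.toℚᵘ-homo-* ε (whole (suc d))) (ℚᵘ.*≡* (cancel (+ suc u) (+ suc d)))))
      (sym (fromℕ-mk (suc u))))
  ; steps≡ = refl
  }
  where
  whole : ℕ → ℚ
  whole k = ℚ.mkℚ (+ k) 0 (Coprime.sym (Coprime.1-coprimeTo k))
  cancel : ∀ x y → x ℤ.* y ℤ.* + 1 ≡ x ℤ.* (y ℤ.* + 1)
  cancel = ℤRing.solve-∀

module Steps {ε : ℚ} (fr : Fraction ε) where

  open Fraction fr

  q : ℕ
  q = suc (steps ε)

  instance
    num≢0 : NonZero num
    num≢0 = ℕ.>-nonZero 0<num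
    den≢0 : NonZero den
    den≢0 = ℕ.>-nonZero (ℕ.<-trans 0<num num<den)

  quotient : ℕ
  quotient = 4 * den ℕ./ suc (pred num)

  pred-num : suc (pred num) ≡ num
  pred-num = ℕ.suc-pred num

  4den≤q*num : 4 * den ≤ q * num
  4den≤q*num = begin
    4 * den ≡⟨ ℕ.m≡m%n+[m/n]*n (4 * den) (suc (pred num)) ⟩
    4 * den ℕ.% suc (pred num) + quotient * suc (pred num) ≤⟨ ℕ.+-monoˡ-≤ _ (ℕ.<⇒≤ (ℕ.m%n<n (4 * den) (suc (pred num)))) ⟩
    suc (pred num) + quotient * suc (pred num) ≡⟨ cong (suc quotient *_) pred-num ⟩
    suc quotient * num ≤⟨ ℕ.*-monoˡ-≤ num (ℕ.≤-trans (ℕ.≤-reflexive (sym steps≡)) (ℕ.n≤1+n (steps ε))) ⟩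
    q * num ∎
    where open ℕ.≤-Reasoning

  q*num≤6den : q * num ≤ 6 * den
  q*num≤6den = begin
    q * num ≡⟨ cong (λ x → suc x * num) steps≡ ⟩
    num + (num + quotient * num) ≡⟨ cong (λ x → num + (num + quotient * x)) (sym pred-num) ⟩
    num + (num + quotient * suc (pred num)) ≤⟨ ℕ.+-mono-≤ (ℕ.<⇒≤ num<den) (ℕ.+-mono-≤ (ℕ.<⇒≤ num<den) (ℕ.m/n*n≤m (4 * den) (suc (pred num)))) ⟩
    den + (den + 4 * den) ≡⟨ lemma den ⟩
    6 * den ∎
    where
    open ℕ.≤-Reasoning
    lemma : ∀ d → d + (d + 4 * d) ≡ 6 * d
    lemma = solve-∀

  small : fromℕ 4 ℚ.* recip q ℚ.≤ ε
  small = ℚ.*-cancelʳ-≤-pos (fromℕ den) {{ℚ.normalize-pos den 1}} (begin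
    fromℕ 4 ℚ.* recip q ℚ.* fromℕ den ≡⟨ lemma (fromℕ 4) (recip q) (fromℕ den) ⟩
    (fromℕ 4 ℚ.* fromℕ den) ℚ.* recip q ≡⟨ cong (ℚ._* recip q) (sym (fromℕ-* 4 den)) ⟩
    fromℕ (4 * den) ℚ.* recip q ≤⟨ ℚ.*-monoʳ-≤-nonNeg (recip q) {{ℚ.nonNegative (0≤recip q)}} (fromℕ-mono 4den≤q*num) ⟩
    fromℕ (q * num) ℚ.* recip q ≡⟨ cong (ℚ._* recip q) (fromℕ-* q num) ⟩
    fromℕ q ℚ.* fromℕ num ℚ.* recip q ≡⟨ lemma′ (fromℕ q) (fromℕ num) (recip q) ⟩
    (fromℕ q ℚ.* recip q) ℚ.* fromℕ num ≡⟨ trans (cong (ℚ._* fromℕ num) (fromℕ*recip q)) (ℚ.*-identityˡ (fromℕ num)) ⟩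
    fromℕ num ≡⟨ sym ε*den ⟩
    ε ℚ.* fromℕ den ∎)
    where
    open ℚ.≤-Reasoning
    lemma : ∀ a b c → a ℚ.* b ℚ.* c ≡ (a ℚ.* c) ℚ.* b
    lemma = Ring.solve-∀ ℚ-ring
    lemma′ : ∀ a b c → a ℚ.* b ℚ.* c ≡ (a ℚ.* c) ℚ.* b
    lemma′ = Ring.solve-∀ ℚ-ring

  few-passes : ∀ M → 0 < M → fromℕ (suc (3 * q) * (3 + 3 * M)) ℚ.* ε ℚ.≤ fromℕ (144 * M)
  few-passes M 0<M = ℚ.*-cancelʳ-≤-pos (fromℕ den) {{ℚ.normalize-pos den 1}} (begin
    fromℕ passes ℚ.* ε ℚ.* fromℕ den ≡⟨ ℚ.*-assoc (fromℕ passes) ε (fromℕ den) ⟩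
    fromℕ passes ℚ.* (ε ℚ.* fromℕ den) ≡⟨ cong (fromℕ passes ℚ.*_) ε*den ⟩
    fromℕ passes ℚ.* fromℕ num ≡⟨ sym (fromℕ-* passes num) ⟩
    fromℕ (passes * num) ≤⟨ fromℕ-mono passes≤ ⟩
    fromℕ (144 * M * den) ≡⟨ fromℕ-* (144 * M) den ⟩
    fromℕ (144 * M) ℚ.* fromℕ den ∎)
    where
    open ℚ.≤-Reasoning
    passes = suc (3 * q) * (3 + 3 * M)
    passes≤ : passes * num ≤ 144 * M * den
    passes≤ = ℕR.begin
      suc (3 * q) * (3 + 3 * M) * num ℕR.≤⟨ ℕ.*-monoˡ-≤ num (ℕ.*-mono-≤ (ℕ.+-monoˡ-≤ (3 * q) (s≤s (z≤n {steps ε}))) (ℕ.+-monoˡ-≤ (3 * M) (ℕ.*-monoʳ-≤ 3 0<M))) ⟩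
      (q + 3 * q) * (3 * M + 3 * M) * num ℕR.≡⟨ lemma q M num ⟩
      24 * M * (q * num) ℕR.≤⟨ ℕ.*-monoʳ-≤ (24 * M) q*num≤6den ⟩
      24 * M * (6 * den) ℕR.≡⟨ lemma′ M den ⟩
      144 * M * den ℕR.∎
      where
      module ℕR = ℕ.≤-Reasoning
      lemma : ∀ q M x → (q + 3 * q) * (3 * M + 3 * M) * x ≡ 24 * M * (q * x)
      lemma = solve-∀
      lemma′ : ∀ M d → 24 * M * (6 * d) ≡ 144 * M * d
      lemma′ = solve-∀

approximation : ∀ {n} (𝒞 : List (Subset n)) {k m ε} sel → 0 < m → 0ℚ ℚ.< ε → ε ℚ.< 1ℚ → GoodSelection k (steps ε) (k ⊓ m) 𝒞 sel →
  IsApproximation (λ N → e/[e-1] N ℚ.+ ε) 𝒞 k (chosen sel 𝒞)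
approximation {n} 𝒞 {k} {m} {ε} sel 0<m 0<ε ε<1 (len≤ , guarantee) =
  (len≤ , unique-choice (chosen! sel 𝒞) (λ S∈ → proj₁ (chosen⊆ sel 𝒞 S∈))) , o , isOptimum ,
  λ δ 0<δ → 0 , λ N _ → ℚ.≤-trans (ratio N (k ⊓ m) refl guarantee)
    (≤-by-slack δ (ℚ.<⇒≤ 0<δ) refl)
  where
  open Optimum (optimum 𝒞 k)
  o = coverage family
  c = coverage (chosen sel 𝒞)
  empty : ∀ 𝒯 → length 𝒯 ≤ 0 → coverage {n} 𝒯 ≡ 0
  empty [] _ = Sub.∣⊥∣≡0 n
  no-cap : k ⊓ m ≡ 0 → k ≤ 0
  no-cap eq with ℕ.⊓-sel k m
  ... | inj₁ ⊓≡k = ℕ.≤-reflexive (trans (sym ⊓≡k) eq)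
  ... | inj₂ ⊓≡m = contradiction (trans (sym ⊓≡m) eq) (ℕ.>⇒≢ 0<m)
  ratio : ∀ N cap → k ⊓ m ≡ cap → Guarantee (steps ε) cap o c → fromℕ o ℚ.≤ (e/[e-1] N ℚ.+ ε) ℚ.* fromℕ c
  ratio N cap _ (inj₂ h) = Ratio.ratio₂ N ε (ℚ.<⇒≤ 0<ε) (ℚ.<⇒≤ ε<1) {o} {c} h
  ratio N (suc cap) _ (inj₁ h) = Ratio.ratio₁ N ε (ℚ.<⇒≤ 0<ε) (ℚ.<⇒≤ ε<1) (steps ε) (suc cap) {o} {c} (Steps.small (fraction ε 0<ε ε<1)) h
  ratio N zero eq (inj₁ h) = Ratio.ratio₂ N ε (ℚ.<⇒≤ 0<ε) (ℚ.<⇒≤ ε<1) {o} {c}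
    (subst (λ o → 4 * (o ∸ c) ≤ o) (sym (empty family (ℕ.≤-trans length≤ (no-cap eq)))) (ℕ.≤-reflexive (cong (4 *_) (ℕ.0∸n≡0 c))))

0<⌈log₂m⌉ : ∀ m .{{_ : NonTrivial m}} → 0 < ⌈log₂ m ⌉
0<⌈log₂m⌉ m = ⌈log₂⌉-mono-≤ {2} {m} (ℕ.nonTrivial⇒n>1 m)

corollary7 : ∀ (c : ℕ) →
    Σ[ alg ∈ (ℚ → (n m k : ℕ) → CoverageAlgorithm n) ]
    ∃[ d ] ∃[ D ]
    ∀ (ε : ℚ) → 0ℚ ℚ.< ε → ε ℚ.< 1ℚ →
    ∃[ C ]
    ∀ (n m k : ℕ) .{{_ : NonZero n}} .{{_ : NonTrivial m}} →
    let open StreamingAlgorithm (alg ε n m k) in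
    space ≤ C * (n * (⌈log₂ m ⌉ + ⌈log₂ n ⌉) ^ d) ×
    fromℕ passes ℚ.* ε ℚ.≤ fromℕ (D * ⌈log₂ m ⌉) ×
    (∀ (a : List (Update n)) → IsDynamicStream a →
    ∀ (𝒞 : List (Subset n)) → Defines a 𝒞 → length 𝒞 ≤ m →
    Pr[ run a ∈ (λ s → IsApproximation (λ N → e/[e-1] N ℚ.+ ε) 𝒞 k (chosen (output s) 𝒞)) ]≥ highProbability c n m)
corollary7 c =
  (λ ε n m k → Choice.coverageAlgorithm c (steps ε) n m k (s≤s z≤n)) ,
  spaceDegree c , 144 ,
  λ ε 0<ε ε<1 → spaceCoefficient c (steps ε) ,
  λ n m k →
    Choice.coverageAlgorithm-space c (steps ε) n m k (s≤s z≤n) (ℕ.>-nonZero⁻¹ n) (0<⌈log₂m⌉ m) ,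
    subst (λ P → fromℕ P ℚ.* ε ℚ.≤ fromℕ (144 * ⌈log₂ m ⌉)) (sym (Choice.coverageAlgorithm-passes c (steps ε) n m k (s≤s z≤n)))
      (Steps.few-passes (fraction ε 0<ε ε<1) ⌈log₂ m ⌉ (0<⌈log₂m⌉ m)) ,
    λ a _ 𝒞 defines len≤m →
      let 0<m = ℕ.<-trans (s≤s z≤n) (ℕ.nonTrivial⇒n>1 m)
          (event , sound , likely) = Choice.coverageAlgorithm-success c (steps ε) n m k (s≤s z≤n)
            {{ℕ.m^n≢0 (n * m) c {{ℕ.m*n≢0 n m {{ℕ.>-nonZero (ℕ.>-nonZero⁻¹ n)}} {{ℕ.>-nonZero 0<m}}}}}} (ℕ.>-nonZero⁻¹ n) 0<m a 𝒞 defines len≤m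
      in event , (λ s h → approximation 𝒞 {k} {m} (StreamingAlgorithm.output (Choice.coverageAlgorithm c (steps ε) n m k (s≤s z≤n)) s) 0<m 0<ε ε<1 (sound s h)) , likely
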